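{- Let $G$ be a subgroup of $\Gamma=\mathrm{PSL}_2(\mathbb{Z})$. If the widths of all cusps of $X(G)$ are the same, then $N_\Gamma(G)/G=N_{\mathrm{PSL}_2(\mathbb{R})}(G)/G$.
   Context: $N_H(G)$ denotes the normaliser of $G$ in $H$. $\mathbb{H}$ is the hyperbolic upper half-plane, $\mathbb{H}^*=\mathbb{H}\sqcup\mathbb{Q}\sqcup\{\infty\}$, $X(G)=G\backslash\mathbb{H}^*$, and the cusps of $X(G)$ are the elements of $G\backslash(\mathbb{Q}\sqcup\{\infty\})$. Let $\triangle$ be the hyperbolic triangle with vertices $e^{\pi i/3},0,\infty$. For a cusp $x\in X(G)$, the edges of the copies of the triangle $\triangle$ (the images in $X(G)$ of its $\Gamma$-copies) cut a small neighbourhood of $x$ into some number of sectors; this number is called the width of the cusp $x$ and denoted $w_x$. Each copy of $\triangle$ contributes $0$, $1$ or $2$ to $w_x$. -}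

module Defs where

open import Level using (Level; _⊔_; suc; 0ℓ)
open import Algebra.Bundles using (Group; CommutativeMonoid; CommutativeRing)
open import Algebra.Morphism.Structures using (module GroupMorphisms; module RingMorphisms)
import Algebra.Properties.CommutativeSemigroup as CommutativeSemigroupProperties
import Algebra.Properties.Group as GroupProperties
import Algebra.Properties.Ring as RingProperties
import Algebra.Solver.Ring.NaturalCoefficients.Default as SemiringSolver
open import Data.Fin using (Fin)
open import Data.Integer as ℤ using (ℤ)
import Data.Integer.Properties as ℤ
open import Data.Nat as ℕ using (ℕ)
import Data.Nat.Properties as ℕ
open import Data.Product using (Σ; ∃; _×_; _,_; proj₁; proj₂)
open import Data.Rational as ℚ using (ℚ; 0ℚ; 1ℚ; ½; ∣_∣)
import Data.Rational.Properties as ℚ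
import Data.Rational.Solver as ℚ-Solver
import Data.Rational.Unnormalised as ℚᵘ
import Data.Rational.Unnormalised.Properties as ℚᵘ
open import Data.Sum using (_⊎_; inj₁; inj₂)
open import Function.Bundles using (Bijection; _⇔_; mk⇔; module Equivalence)
open import Relation.Binary.Bundles using (Setoid)
import Relation.Binary.Construct.On as On
open import Relation.Binary.Definitions using (_Respects_)
open import Relation.Binary.PropositionalEquality as ≡ using (_≡_)
import Relation.Binary.Reasoning.Setoid as SetoidReasoning
open import Relation.Unary using (Pred; _∈_)
open import Relation.Unary.Relation.Binary.Equality using (≐-setoid)

private
  variable
    h ℓ k ℓ′ p : Level

record Subgroup (H : Group h ℓ) (p : Level) : Set (h ⊔ ℓ ⊔ suc p) where
  open Group H
  field
    member   : Pred Carrier p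
    resp     : member Respects _≈_
    ε-closed : ε ∈ member
    ∙-closed : ∀ {x y} → x ∈ member → y ∈ member → x ∙ y ∈ member
    ⁻¹-closed : ∀ {x} → x ∈ member → x ⁻¹ ∈ member

module _ {H : Group h ℓ} (G : Subgroup H p) where
  open Group H
  open Subgroup G
  open GroupProperties H

  private
    conj-∙ : ∀ m n g → m ∙ (n ∙ g ∙ n ⁻¹) ∙ m ⁻¹ ≈ (m ∙ n) ∙ g ∙ (m ∙ n) ⁻¹
    conj-∙ m n g = begin
      m ∙ (n ∙ g ∙ n ⁻¹) ∙ m ⁻¹       ≈⟨ ∙-congʳ (sym (assoc _ _ _)) ⟩
      (m ∙ (n ∙ g)) ∙ n ⁻¹ ∙ m ⁻¹     ≈⟨ assoc _ _ _ ⟩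
      (m ∙ (n ∙ g)) ∙ (n ⁻¹ ∙ m ⁻¹)   ≈⟨ ∙-cong (sym (assoc _ _ _)) (sym (⁻¹-anti-homo-∙ m n)) ⟩
      (m ∙ n) ∙ g ∙ (m ∙ n) ⁻¹        ∎
      where open SetoidReasoning setoid

    conj-ε : ∀ g → ε ∙ g ∙ ε ⁻¹ ≈ g
    conj-ε g = trans (∙-cong (identityˡ g) ε⁻¹≈ε) (identityʳ g)

    conj-cong : ∀ {m n} g → m ≈ n → m ∙ g ∙ m ⁻¹ ≈ n ∙ g ∙ n ⁻¹
    conj-cong g m≈n = ∙-cong (∙-congʳ m≈n) (⁻¹-cong m≈n)

    conj-⁻¹ : ∀ n g → n ∙ (n ⁻¹ ∙ g ∙ (n ⁻¹) ⁻¹) ∙ n ⁻¹ ≈ g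
    conj-⁻¹ n g = trans (conj-∙ n (n ⁻¹) g) (trans (conj-cong g (inverseʳ n)) (conj-ε g))

  Normalises : Pred Carrier (h ⊔ p)
  Normalises n = ∀ g → (g ∈ member) ⇔ (n ∙ g ∙ n ⁻¹ ∈ member)

  normaliser : Subgroup H (h ⊔ p)
  normaliser = record
    { member    = Normalises
    ; resp      = λ m≈n m∈ g → mk⇔
        (λ g∈ → resp (conj-cong g m≈n) (to (m∈ g) g∈))
        (λ h∈ → from (m∈ g) (resp (sym (conj-cong g m≈n)) h∈))
    ; ε-closed  = λ g → mk⇔ (resp (sym (conj-ε g))) (resp (conj-ε g))
    ; ∙-closed  = λ {m} {n} m∈ n∈ g → mk⇔
        (λ g∈ → resp (conj-∙ m n g) (to (m∈ _) (to (n∈ g) g∈)))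
        (λ h∈ → from (n∈ g) (from (m∈ _) (resp (sym (conj-∙ m n g)) h∈)))
    ; ⁻¹-closed = λ {n} n∈ g → mk⇔
        (λ g∈ → from (n∈ _) (resp (sym (conj-⁻¹ n g)) g∈))
        (λ h∈ → resp (conj-⁻¹ n g) (to (n∈ _) h∈))
    }
    where open Equivalence

  private
    module N = Subgroup normaliser

    conj⁻¹ : ∀ {n g} → Normalises n → g ∈ member → n ⁻¹ ∙ g ∙ n ∈ member
    conj⁻¹ {n} {g} n∈ g∈ = resp (∙-congˡ (⁻¹-involutive n))
      (Equivalence.to (N.⁻¹-closed n∈ g) g∈)

  -- The quotient N_H(G)/G.  As there are no quotient types, its elements are
  -- those of N_H(G), with x and y equal when xG = yG.
  Normaliser/ : Group (h ⊔ p) p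
  Normaliser/ = record
    { Carrier = Σ Carrier Normalises
    ; _≈_     = _~_
    ; _∙_     = λ (x , x∈) (y , y∈) → x ∙ y , N.∙-closed x∈ y∈
    ; ε       = ε , N.ε-closed
    ; _⁻¹     = λ (x , x∈) → x ⁻¹ , N.⁻¹-closed x∈
    ; isGroup = record
      { isMonoid = record
        { isSemigroup = record
          { isMagma = record
            { isEquivalence = record { refl = ≈⇒~ refl ; sym = ~-sym ; trans = ~-trans }
            ; ∙-cong        = λ {x} {y} {u} {v} → ~-∙-cong {x} {y} {u} {v}
            }
          ; assoc = λ (x , _) (y , _) (z , _) → ≈⇒~ (assoc x y z)
          }
        ; identity = (λ (x , _) → ≈⇒~ (identityˡ x)) , (λ (x , _) → ≈⇒~ (identityʳ x))
        }
      ; inverse = (λ (x , _) → ≈⇒~ (inverseˡ x)) , (λ (x , _) → ≈⇒~ (inverseʳ x))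
      ; ⁻¹-cong = λ {x} {y} → ~-⁻¹-cong {x} {y}
      }
    }
    where
    open SetoidReasoning setoid

    _~_ : Σ Carrier Normalises → Σ Carrier Normalises → Set p
    (x , _) ~ (y , _) = x ⁻¹ ∙ y ∈ member

    ≈⇒~ : ∀ {x y} → x ≈ y → x ⁻¹ ∙ y ∈ member
    ≈⇒~ {x} x≈y = resp (trans (sym (inverseˡ x)) (∙-congˡ x≈y)) ε-closed

    ~-sym : ∀ {x y} → x ⁻¹ ∙ y ∈ member → y ⁻¹ ∙ x ∈ member
    ~-sym {x} {y} r = resp
      (trans (⁻¹-anti-homo-∙ _ _) (∙-congˡ (⁻¹-involutive x))) (⁻¹-closed r)

    ~-trans : ∀ {x y z} → x ⁻¹ ∙ y ∈ member → y ⁻¹ ∙ z ∈ member → x ⁻¹ ∙ z ∈ member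
    ~-trans {x} {y} {z} r s = resp
      (trans (assoc _ _ _) (∙-congˡ (\\-leftDividesˡ y z))) (∙-closed r s)

    ~-∙-cong : ∀ {x y u v} → x ~ y → u ~ v →
               (proj₁ x ∙ proj₁ u) ⁻¹ ∙ (proj₁ y ∙ proj₁ v) ∈ member
    ~-∙-cong {x , _} {y , _} {u , u∈} {v , _} r s = resp eq (∙-closed (conj⁻¹ u∈ r) s)
      where
      eq : (u ⁻¹ ∙ (x ⁻¹ ∙ y) ∙ u) ∙ (u ⁻¹ ∙ v) ≈ (x ∙ u) ⁻¹ ∙ (y ∙ v)
      eq = begin
        (u ⁻¹ ∙ (x ⁻¹ ∙ y) ∙ u) ∙ (u ⁻¹ ∙ v)  ≈⟨ assoc _ _ _ ⟩
        u ⁻¹ ∙ (x ⁻¹ ∙ y) ∙ (u ∙ (u ⁻¹ ∙ v))  ≈⟨ ∙-congˡ (\\-leftDividesˡ u v) ⟩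
        u ⁻¹ ∙ (x ⁻¹ ∙ y) ∙ v                 ≈⟨ ∙-congʳ (sym (assoc _ _ _)) ⟩
        u ⁻¹ ∙ x ⁻¹ ∙ y ∙ v                   ≈⟨ assoc _ _ _ ⟩
        (u ⁻¹ ∙ x ⁻¹) ∙ (y ∙ v)               ≈⟨ ∙-congʳ (sym (⁻¹-anti-homo-∙ x u)) ⟩
        (x ∙ u) ⁻¹ ∙ (y ∙ v)                  ∎

    ~-⁻¹-cong : ∀ {x y} → x ~ y → (proj₁ x ⁻¹) ⁻¹ ∙ proj₁ y ⁻¹ ∈ member
    ~-⁻¹-cong {x , x∈} {y , y∈} r = resp eq (Equivalence.to (x∈ _) (~-sym r))
      where
      eq : x ∙ (y ⁻¹ ∙ x) ∙ x ⁻¹ ≈ (x ⁻¹) ⁻¹ ∙ y ⁻¹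
      eq = begin
        x ∙ (y ⁻¹ ∙ x) ∙ x ⁻¹     ≈⟨ ∙-congʳ (sym (assoc _ _ _)) ⟩
        x ∙ y ⁻¹ ∙ x ∙ x ⁻¹       ≈⟨ //-rightDividesʳ x _ ⟩
        x ∙ y ⁻¹                  ≈⟨ ∙-congʳ (sym (⁻¹-involutive x)) ⟩
        (x ⁻¹) ⁻¹ ∙ y ⁻¹          ∎

module _ (H : Group h ℓ) (K : Group k ℓ′) where
  private
    module H = Group H
    module K = Group K
  open GroupMorphisms H.rawGroup K.rawGroup

  module _ {f : H.Carrier → K.Carrier} (f-hom : IsGroupHomomorphism f) where
    open IsGroupHomomorphism f-hom

    image : Subgroup H p → Subgroup K (h ⊔ ℓ′ ⊔ p)
    image G = record
      { member    = λ k → ∃ λ g → g ∈ member × f g K.≈ k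
      ; resp      = λ k≈k′ (g , g∈ , eq) → g , g∈ , K.trans eq k≈k′
      ; ε-closed  = H.ε , ε-closed , ε-homo
      ; ∙-closed  = λ (g , g∈ , eq) (h , h∈ , eq′) →
                      g H.∙ h , ∙-closed g∈ h∈ , K.trans (homo g h) (K.∙-cong eq eq′)
      ; ⁻¹-closed = λ (g , g∈ , eq) →
                      g H.⁻¹ , ⁻¹-closed g∈ , K.trans (⁻¹-homo g) (K.⁻¹-cong eq)
      }
      where open Subgroup G

    private
      conj-homo : ∀ n g → f (n H.∙ g H.∙ n H.⁻¹) K.≈ f n K.∙ f g K.∙ f n K.⁻¹
      conj-homo n g = K.trans (homo _ _) (K.∙-cong (homo n g) (⁻¹-homo n))

    image-normalises : (G : Subgroup H p) → ∀ {n} →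
                       Normalises G n → Normalises (image G) (f n)
    image-normalises G {n} n∈ k = mk⇔
      (λ (g , g∈ , eq) → n H.∙ g H.∙ n H.⁻¹ , Equivalence.to (n∈ g) g∈ ,
        K.trans (conj-homo n g) (K.∙-congʳ (K.∙-congˡ eq)))
      (λ (g , g∈ , eq) → n H.⁻¹ H.∙ g H.∙ (n H.⁻¹) H.⁻¹ ,
        Equivalence.to (N.⁻¹-closed n∈ g) g∈ , (begin
          f (n H.⁻¹ H.∙ g H.∙ (n H.⁻¹) H.⁻¹)
            ≈⟨ conj-homo (n H.⁻¹) g ⟩
          f (n H.⁻¹) K.∙ f g K.∙ f (n H.⁻¹) K.⁻¹
            ≈⟨ K.∙-cong (K.∙-cong (⁻¹-homo n) eq) (K.⁻¹-cong (⁻¹-homo n)) ⟩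
          f n K.⁻¹ K.∙ (f n K.∙ k K.∙ f n K.⁻¹) K.∙ (f n K.⁻¹) K.⁻¹
            ≈⟨ K.∙-congˡ (⁻¹-involutive (f n)) ⟩
          f n K.⁻¹ K.∙ (f n K.∙ k K.∙ f n K.⁻¹) K.∙ f n
            ≈⟨ K.∙-congʳ (K.∙-congˡ (K.assoc _ _ _)) ⟩
          f n K.⁻¹ K.∙ (f n K.∙ (k K.∙ f n K.⁻¹)) K.∙ f n
            ≈⟨ K.∙-congʳ (\\-leftDividesʳ (f n) _) ⟩
          k K.∙ f n K.⁻¹ K.∙ f n
            ≈⟨ //-rightDividesˡ (f n) k ⟩
          k ∎))
      where
      module N = Subgroup (normaliser G)
      open GroupProperties K
      open SetoidReasoning K.setoid

    induced : (G : Subgroup H p) →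
              Group.Carrier (Normaliser/ G) → Group.Carrier (Normaliser/ (image G))
    induced G (n , n∈) = f n , image-normalises G n∈

module PSL₂-Definitions {r ℓ} (R : CommutativeRing r ℓ) where
  open CommutativeRing R
  open RingProperties ring
  open SemiringSolver commutativeSemiring
  open CommutativeSemigroupProperties *-commutativeSemigroup
    using () renaming (interchange to *-interchange)
  open CommutativeSemigroupProperties (CommutativeMonoid.commutativeSemigroup +-commutativeMonoid)
    using () renaming (interchange to +-interchange)

  record SL₂ : Set (r ⊔ ℓ) where
    no-eta-equality
    field
      a b c d : Carrier
      det     : a * d - b * c ≈ 1#

  record _≋_ (A B : SL₂) : Set ℓ where
    constructor mk≋
    private
      module A = SL₂ A
      module B = SL₂ B
    field
      a≈ : A.a ≈ B.a
      b≈ : A.b ≈ B.b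
      c≈ : A.c ≈ B.c
      d≈ : A.d ≈ B.d

  det⁺ : ∀ {x y} → x - y ≈ 1# → x ≈ 1# + y
  det⁺ {x} {y} eq = trans (sym (//-rightDividesˡ y x)) (+-congʳ eq)

  det⁻ : ∀ {x y} → x ≈ 1# + y → x - y ≈ 1#
  det⁻ {x} {y} eq = trans (+-congʳ eq) (//-rightDividesʳ y 1#)

  x*-y+y*x≈0 : ∀ x y → x * - y + y * x ≈ 0#
  x*-y+y*x≈0 x y = trans (+-cong (sym (-‿distribʳ-* x y)) (*-comm y x)) (-‿inverseˡ _)

  -x*-y≈x*y : ∀ x y → - x * - y ≈ x * y
  -x*-y≈x*y x y = trans (sym (-‿distribˡ-* x (- y)))
    (trans (-‿cong (sym (-‿distribʳ-* x y))) (-‿involutive _))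

  -x*y+-z*w : ∀ x y z w → - x * y + - z * w ≈ - (x * y + z * w)
  -x*y+-z*w x y z w = trans (+-cong (sym (-‿distribˡ-* x y)) (sym (-‿distribˡ-* z w)))
    (-‿+-comm _ _)

  x*-y+z*-w : ∀ x y z w → x * - y + z * - w ≈ - (x * y + z * w)
  x*-y+z*-w x y z w = trans (+-cong (sym (-‿distribʳ-* x y)) (sym (-‿distribʳ-* z w)))
    (-‿+-comm _ _)

  assocˡ : ∀ a b a′ b′ c′ d′ x y →
           (a * a′ + b * c′) * x + (a * b′ + b * d′) * y
           ≈ a * (a′ * x + b′ * y) + b * (c′ * x + d′ * y)
  assocˡ a b a′ b′ c′ d′ x y = begin
    (a * a′ + b * c′) * x + (a * b′ + b * d′) * y
      ≈⟨ +-cong (distribʳ x _ _) (distribʳ y _ _) ⟩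
    (a * a′ * x + b * c′ * x) + (a * b′ * y + b * d′ * y)
      ≈⟨ +-interchange _ _ _ _ ⟩
    (a * a′ * x + a * b′ * y) + (b * c′ * x + b * d′ * y)
      ≈⟨ +-cong (+-cong (*-assoc _ _ _) (*-assoc _ _ _)) (+-cong (*-assoc _ _ _) (*-assoc _ _ _)) ⟩
    (a * (a′ * x) + a * (b′ * y)) + (b * (c′ * x) + b * (d′ * y))
      ≈⟨ +-cong (distribˡ a _ _) (distribˡ b _ _) ⟨
    a * (a′ * x + b′ * y) + b * (c′ * x + d′ * y) ∎
    where open SetoidReasoning setoid

  expand : ∀ p q r s → (p + q) * (r + s) ≈ (p * s + q * r) + (p * r + q * s)
  expand = solve 4 (λ p q r s →
    (p :+ q) :* (r :+ s) := (p :* s :+ q :* r) :+ (p :* r :+ q :* s)) refl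

  1+u*1+v : ∀ u v w → (1# + u) * (1# + v) + u * v + w
                    ≈ 1# + ((1# + u) * v + u * (1# + v) + w)
  1+u*1+v = solve 3 (λ u v w → (con 1 :+ u) :* (con 1 :+ v) :+ u :* v :+ w
    := con 1 :+ ((con 1 :+ u) :* v :+ u :* (con 1 :+ v) :+ w)) refl

  det-∙ : ∀ a b c d a′ b′ c′ d′ → a * d - b * c ≈ 1# → a′ * d′ - b′ * c′ ≈ 1# →
          (a * a′ + b * c′) * (c * b′ + d * d′) - (a * b′ + b * d′) * (c * a′ + d * c′) ≈ 1#
  det-∙ a b c d a′ b′ c′ d′ eq eq′ = det⁻ (begin
    (a * a′ + b * c′) * (c * b′ + d * d′)
      ≈⟨ expand _ _ _ _ ⟩
    ((a * a′) * (d * d′) + (b * c′) * (c * b′)) + ((a * a′) * (c * b′) + (b * c′) * (d * d′))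
      ≈⟨ +-cong (+-cong (*-interchange _ _ _ _) (trans (*-interchange _ _ _ _) (*-congˡ (*-comm _ _))))
                (+-cong (*-interchange _ _ _ _) (*-interchange _ _ _ _)) ⟩
    (a * d) * (a′ * d′) + (b * c) * (b′ * c′) + rest
      ≈⟨ +-congʳ (+-congʳ (*-cong (det⁺ eq) (det⁺ eq′))) ⟩
    (1# + b * c) * (1# + b′ * c′) + (b * c) * (b′ * c′) + rest
      ≈⟨ 1+u*1+v _ _ _ ⟩
    1# + ((1# + b * c) * (b′ * c′) + (b * c) * (1# + b′ * c′) + rest)
      ≈⟨ +-congˡ (+-congʳ (+-cong (*-congʳ (det⁺ eq)) (*-congˡ (det⁺ eq′)))) ⟨
    1# + ((a * d) * (b′ * c′) + (b * c) * (a′ * d′) + rest)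
      ≈⟨ +-congˡ (+-cong
           (+-cong (*-interchange _ _ _ _) (trans (*-interchange _ _ _ _) (*-congˡ (*-comm _ _))))
           (+-cong (trans (*-interchange _ _ _ _) (*-congˡ (*-comm _ _)))
                   (trans (*-interchange _ _ _ _) (*-congˡ (*-comm _ _))))) ⟨
    1# + (((a * b′) * (d * c′) + (b * d′) * (c * a′)) + ((a * b′) * (c * a′) + (b * d′) * (d * c′)))
      ≈⟨ +-congˡ (expand _ _ _ _) ⟨
    1# + (a * b′ + b * d′) * (c * a′ + d * c′) ∎)
    where
    open SetoidReasoning setoid
    rest = (a * c) * (a′ * b′) + (b * d) * (c′ * d′)

  module _ (A B : SL₂) where
    private
      module A = SL₂ A
      module B = SL₂ B
    open SL₂

    _·_ : SL₂
    _·_ .a   = A.a * B.a + A.b * B.c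
    _·_ .b   = A.a * B.b + A.b * B.d
    _·_ .c   = A.c * B.a + A.d * B.c
    _·_ .d   = A.c * B.b + A.d * B.d
    _·_ .det = det-∙ A.a A.b A.c A.d B.a B.b B.c B.d A.det B.det

  I : SL₂
  I .SL₂.a   = 1#
  I .SL₂.b   = 0#
  I .SL₂.c   = 0#
  I .SL₂.d   = 1#
  I .SL₂.det = det⁻ (trans (*-identityʳ 1#) (sym (trans (+-congˡ (zeroʳ 0#)) (+-identityʳ 1#))))

  module _ (A : SL₂) where
    private module A = SL₂ A
    open SL₂

    adj : SL₂
    adj .a   = A.d
    adj .b   = - A.b
    adj .c   = - A.c
    adj .d   = A.a
    adj .det = trans (+-cong (*-comm A.d A.a) (-‿cong (-x*-y≈x*y A.b A.c))) A.det

    neg : SL₂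
    neg .a   = - A.a
    neg .b   = - A.b
    neg .c   = - A.c
    neg .d   = - A.d
    neg .det = trans (+-cong (-x*-y≈x*y A.a A.d) (-‿cong (-x*-y≈x*y A.b A.c))) A.det

  ≋-refl : ∀ {A} → A ≋ A
  ≋-refl = mk≋ refl refl refl refl

  ≋-sym : ∀ {A B} → A ≋ B → B ≋ A
  ≋-sym (mk≋ a b c d) = mk≋ (sym a) (sym b) (sym c) (sym d)

  ≋-trans : ∀ {A B C} → A ≋ B → B ≋ C → A ≋ C
  ≋-trans (mk≋ a b c d) (mk≋ a′ b′ c′ d′) =
    mk≋ (trans a a′) (trans b b′) (trans c c′) (trans d d′)

  ·-cong : ∀ {A B C D} → A ≋ B → C ≋ D → (A · C) ≋ (B · D)
  ·-cong (mk≋ a b c d) (mk≋ a′ b′ c′ d′) = mk≋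
    (+-cong (*-cong a a′) (*-cong b c′)) (+-cong (*-cong a b′) (*-cong b d′))
    (+-cong (*-cong c a′) (*-cong d c′)) (+-cong (*-cong c b′) (*-cong d d′))

  adj-cong : ∀ {A B} → A ≋ B → adj A ≋ adj B
  adj-cong (mk≋ a b c d) = mk≋ d (-‿cong b) (-‿cong c) a

  neg-cong : ∀ {A B} → A ≋ B → neg A ≋ neg B
  neg-cong (mk≋ a b c d) = mk≋ (-‿cong a) (-‿cong b) (-‿cong c) (-‿cong d)

  neg-neg : ∀ A → neg (neg A) ≋ A
  neg-neg _ = mk≋ (-‿involutive _) (-‿involutive _) (-‿involutive _) (-‿involutive _)

  neg-·ˡ : ∀ A B → (neg A · B) ≋ neg (A · B)
  neg-·ˡ _ _ = mk≋ (-x*y+-z*w _ _ _ _) (-x*y+-z*w _ _ _ _) (-x*y+-z*w _ _ _ _) (-x*y+-z*w _ _ _ _)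

  neg-·ʳ : ∀ A B → (A · neg B) ≋ neg (A · B)
  neg-·ʳ _ _ = mk≋ (x*-y+z*-w _ _ _ _) (x*-y+z*-w _ _ _ _) (x*-y+z*-w _ _ _ _) (x*-y+z*-w _ _ _ _)

  ·-assoc : ∀ A B C → ((A · B) · C) ≋ (A · (B · C))
  ·-assoc _ _ _ = mk≋ (assocˡ _ _ _ _ _ _ _ _) (assocˡ _ _ _ _ _ _ _ _)
                      (assocˡ _ _ _ _ _ _ _ _) (assocˡ _ _ _ _ _ _ _ _)

  1x+0y≈x : ∀ x y → 1# * x + 0# * y ≈ x
  1x+0y≈x = solve 2 (λ x y → con 1 :* x :+ con 0 :* y := x) refl

  0x+1y≈y : ∀ x y → 0# * x + 1# * y ≈ y
  0x+1y≈y = solve 2 (λ x y → con 0 :* x :+ con 1 :* y := y) refl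

  x1+y0≈x : ∀ x y → x * 1# + y * 0# ≈ x
  x1+y0≈x = solve 2 (λ x y → x :* con 1 :+ y :* con 0 := x) refl

  x0+y1≈y : ∀ x y → x * 0# + y * 1# ≈ y
  x0+y1≈y = solve 2 (λ x y → x :* con 0 :+ y :* con 1 := y) refl

  ·-identityˡ : ∀ A → (I · A) ≋ A
  ·-identityˡ _ = mk≋ (1x+0y≈x _ _) (1x+0y≈x _ _) (0x+1y≈y _ _) (0x+1y≈y _ _)

  ·-identityʳ : ∀ A → (A · I) ≋ A
  ·-identityʳ _ = mk≋ (x1+y0≈x _ _) (x0+y1≈y _ _) (x1+y0≈x _ _) (x0+y1≈y _ _)

  ·-inverseʳ : ∀ A → (A · adj A) ≋ I
  ·-inverseʳ A = let open SL₂ A in mk≋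
    (trans (+-congˡ (sym (-‿distribʳ-* b c))) det)
    (x*-y+y*x≈0 a b)
    (trans (+-congˡ (trans (sym (-‿distribʳ-* d c)) (-‿cong (*-comm d c)))) (-‿inverseʳ _))
    (trans (+-comm _ _)
      (trans (+-cong (*-comm d a) (trans (sym (-‿distribʳ-* c b)) (-‿cong (*-comm c b)))) det))

  ·-inverseˡ : ∀ A → (adj A · A) ≋ I
  ·-inverseˡ A = let open SL₂ A in mk≋
    (trans (+-cong (*-comm d a) (sym (-‿distribˡ-* b c))) det)
    (trans (+-cong (*-comm d b) (sym (-‿distribˡ-* b d))) (-‿inverseʳ _))
    (trans (+-cong (sym (-‿distribˡ-* c a)) (*-comm a c)) (-‿inverseˡ _))
    (trans (+-comm _ _)
      (trans (+-congˡ (trans (sym (-‿distribˡ-* c b)) (-‿cong (*-comm c b)))) det))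

  -- The equality of SL₂(R)/{±I}.
  _≈±_ : SL₂ → SL₂ → Set ℓ
  A ≈± B = A ≋ B ⊎ A ≋ neg B

  ≈±-sym : ∀ {A B} → A ≈± B → B ≈± A
  ≈±-sym (inj₁ e) = inj₁ (≋-sym e)
  ≈±-sym {A} {B} (inj₂ e) = inj₂ (≋-sym (≋-trans (neg-cong e) (neg-neg B)))

  ≈±-trans : ∀ {A B C} → A ≈± B → B ≈± C → A ≈± C
  ≈±-trans (inj₁ e) (inj₁ f) = inj₁ (≋-trans e f)
  ≈±-trans (inj₁ e) (inj₂ f) = inj₂ (≋-trans e f)
  ≈±-trans (inj₂ e) (inj₁ f) = inj₂ (≋-trans e (neg-cong f))
  ≈±-trans {C = C} (inj₂ e) (inj₂ f) = inj₁ (≋-trans e (≋-trans (neg-cong f) (neg-neg C)))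

  ·-cong± : ∀ {A B C D} → A ≈± B → C ≈± D → (A · C) ≈± (B · D)
  ·-cong± (inj₁ e) (inj₁ f) = inj₁ (·-cong e f)
  ·-cong± {B = B} {D = D} (inj₁ e) (inj₂ f) = inj₂ (≋-trans (·-cong e f) (neg-·ʳ B D))
  ·-cong± {B = B} {D = D} (inj₂ e) (inj₁ f) = inj₂ (≋-trans (·-cong e f) (neg-·ˡ B D))
  ·-cong± {B = B} {D = D} (inj₂ e) (inj₂ f) = inj₁ (≋-trans (·-cong e f)
    (≋-trans (neg-·ˡ B (neg D)) (≋-trans (neg-cong (neg-·ʳ B D)) (neg-neg (B · D)))))

  adj-cong± : ∀ {A B} → A ≈± B → adj A ≈± adj B
  adj-cong± (inj₁ e) = inj₁ (adj-cong e)
  adj-cong± (inj₂ (mk≋ a b c d)) = inj₂ (mk≋ d (-‿cong b) (-‿cong c) a)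

  -- This is the usual PSL₂ when ±1 are the only square roots of 1 in R, as in
  -- ℤ and ℝ.
  PSL₂ : Group (r ⊔ ℓ) ℓ
  PSL₂ = record
    { Carrier = SL₂
    ; _≈_     = _≈±_
    ; _∙_     = _·_
    ; ε       = I
    ; _⁻¹     = adj
    ; isGroup = record
      { isMonoid = record
        { isSemigroup = record
          { isMagma = record
            { isEquivalence = record
                { refl = inj₁ ≋-refl ; sym = ≈±-sym ; trans = ≈±-trans }
            ; ∙-cong = ·-cong±
            }
          ; assoc = λ A B C → inj₁ (·-assoc A B C)
          }
        ; identity = (λ A → inj₁ (·-identityˡ A)) , (λ A → inj₁ (·-identityʳ A))
        }
      ; inverse = (λ A → inj₁ (·-inverseˡ A)) , (λ A → inj₁ (·-inverseʳ A))
      ; ⁻¹-cong = adj-cong±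
      }
    }

open PSL₂-Definitions using (SL₂; PSL₂; mk≋)

module _ {r ℓ s ℓ′} (R : CommutativeRing r ℓ) (S : CommutativeRing s ℓ′) where
  private
    module R = CommutativeRing R
    module S = CommutativeRing S
    module P = PSL₂-Definitions R
    module Q = PSL₂-Definitions S
  open RingMorphisms R.rawRing S.rawRing
  open GroupMorphisms (Group.rawGroup (PSL₂ R)) (Group.rawGroup (PSL₂ S))

  module _ {f : R.Carrier → S.Carrier} (f-hom : IsRingHomomorphism f) where
    open IsRingHomomorphism f-hom

    private
      dot-homo : ∀ x y z w → f (x R.* y R.+ z R.* w) S.≈ f x S.* f y S.+ f z S.* f w
      dot-homo x y z w = S.trans (+-homo _ _) (S.+-cong (*-homo x y) (*-homo z w))

    map-SL₂ : SL₂ R → SL₂ S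
    map-SL₂ A .Q.SL₂.a   = f (P.SL₂.a A)
    map-SL₂ A .Q.SL₂.b   = f (P.SL₂.b A)
    map-SL₂ A .Q.SL₂.c   = f (P.SL₂.c A)
    map-SL₂ A .Q.SL₂.d   = f (P.SL₂.d A)
    map-SL₂ A .Q.SL₂.det = let open P.SL₂ A in
      S.trans (S.+-cong (S.sym (*-homo a d)) (S.trans (S.-‿cong (S.sym (*-homo b c))) (S.sym (-‿homo _))))
        (S.trans (S.sym (+-homo _ _)) (S.trans (⟦⟧-cong det) 1#-homo))

    map-SL₂-isGroupHomomorphism : IsGroupHomomorphism map-SL₂
    map-SL₂-isGroupHomomorphism = record
      { isMonoidHomomorphism = record
        { isMagmaHomomorphism = record
          { isRelHomomorphism = record { cong = cong± }
          ; homo = λ _ _ → inj₁ (mk≋ (dot-homo _ _ _ _) (dot-homo _ _ _ _)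
                                     (dot-homo _ _ _ _) (dot-homo _ _ _ _))
          }
        ; ε-homo = inj₁ (mk≋ 1#-homo 0#-homo 0#-homo 1#-homo)
        }
      ; ⁻¹-homo = λ _ → inj₁ (mk≋ S.refl (-‿homo _) (-‿homo _) S.refl)
      }
      where
      cong± : ∀ {A B} → A P.≈± B → map-SL₂ A Q.≈± map-SL₂ B
      cong± (inj₁ (mk≋ a b c d)) = inj₁ (mk≋ (⟦⟧-cong a) (⟦⟧-cong b) (⟦⟧-cong c) (⟦⟧-cong d))
      cong± (inj₂ (mk≋ a b c d)) = inj₂ (mk≋ (neg′ a) (neg′ b) (neg′ c) (neg′ d))
        where
        neg′ : ∀ {x y} → x R.≈ R.- y → f x S.≈ S.- f y
        neg′ e = S.trans (⟦⟧-cong e) (-‿homo _)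

module RealNumbers where
  open ℚ-Solver.+-*-Solver

  Eventually : (ℕ → Set) → Set
  Eventually P = ∃ λ N → ∀ n → N ℕ.≤ n → P n

  -- Cauchy sequences of rationals, each carrying a modulus of convergence.
  record ℝ : Set where
    no-eta-equality
    field
      seq    : ℕ → ℚ
      cauchy : ∀ ε → 0ℚ ℚ.< ε → ∃ λ N → ∀ m n → N ℕ.≤ m → N ℕ.≤ n →
               ∣ seq m ℚ.- seq n ∣ ℚ.< ε

  open ℝ

  infix 4 _≈_ _<_
  infixl 6 _+_ _-_
  infixl 7 _*_
  infix 8 -_

  record _≈_ (x y : ℝ) : Set where
    constructor mk≈
    field
      close : ∀ ε → 0ℚ ℚ.< ε → Eventually λ n → ∣ seq x n ℚ.- seq y n ∣ ℚ.< ε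

  record _<_ (x y : ℝ) : Set where
    constructor mk<
    field
      gap   : ℚ
      gap>0 : 0ℚ ℚ.< gap
      below : Eventually λ n → seq x n ℚ.+ gap ℚ.< seq y n

  both : ∀ {P Q : ℕ → Set} → Eventually P → Eventually Q → Eventually λ n → P n × Q n
  both (M , p) (N , q) = M ℕ.⊔ N , λ n h →
    p n (ℕ.≤-trans (ℕ.m≤m⊔n M N) h) , q n (ℕ.≤-trans (ℕ.m≤n⊔m M N) h)

  mapE : ∀ {P Q : ℕ → Set} → (∀ {n} → P n → Q n) → Eventually P → Eventually Q
  mapE f (N , p) = N , λ n h → f (p n h)

  half>0 : ∀ {ε} → 0ℚ ℚ.< ε → 0ℚ ℚ.< ½ ℚ.* ε
  half>0 {ε} 0<ε = ℚ.positive⁻¹ (½ ℚ.* ε) ⦃ ℚ.pos*pos⇒pos ½ ε ⦃ ℚ.positive 0<ε ⦄ ⦄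

  halves : ∀ ε → ½ ℚ.* ε ℚ.+ ½ ℚ.* ε ≡ ε
  halves ε = ≡.trans (≡.sym (ℚ.*-distribʳ-+ ε ½ ½)) (ℚ.*-identityˡ ε)

  triangle : ∀ {ε} p q → ∣ p ∣ ℚ.< ½ ℚ.* ε → ∣ q ∣ ℚ.< ½ ℚ.* ε → ∣ p ℚ.+ q ∣ ℚ.< ε
  triangle {ε} p q p< q< = ℚ.≤-<-trans (ℚ.∣p+q∣≤∣p∣+∣q∣ p q)
    (≡.subst (∣ p ∣ ℚ.+ ∣ q ∣ ℚ.<_) (halves ε) (ℚ.+-mono-< p< q<))

  triangle≡ : ∀ ε p q r → p ℚ.+ q ≡ r → ∣ p ∣ ℚ.< ½ ℚ.* ε → ∣ q ∣ ℚ.< ½ ℚ.* ε → ∣ r ∣ ℚ.< ε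
  triangle≡ _ p q _ ≡.refl = triangle p q

  ∣p-q∣≡∣q-p∣ : ∀ p q → ∣ p ℚ.- q ∣ ≡ ∣ q ℚ.- p ∣
  ∣p-q∣≡∣q-p∣ p q = ≡.trans (≡.sym (ℚ.∣-p∣≡∣p∣ (p ℚ.- q)))
    (≡.cong ∣_∣ (solve 2 (λ p q → :- (p :- q) := q :- p) ≡.refl p q))

  telescope : ∀ p q r → (p ℚ.- q) ℚ.+ (q ℚ.- r) ≡ p ℚ.- r
  telescope = solve 3 (λ p q r → (p :- q) :+ (q :- r) := p :- r) ≡.refl

  sum-diff : ∀ p q r s → (p ℚ.- r) ℚ.+ (q ℚ.- s) ≡ (p ℚ.+ q) ℚ.- (r ℚ.+ s)
  sum-diff = solve 4 (λ p q r s → (p :- r) :+ (q :- s) := (p :+ q) :- (r :+ s)) ≡.refl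

  neg-diff : ∀ p q → ∣ ℚ.- p ℚ.- ℚ.- q ∣ ≡ ∣ p ℚ.- q ∣
  neg-diff p q = ≡.trans (≡.cong ∣_∣ (solve 2 (λ p q → :- p :- :- q := :- (p :- q)) ≡.refl p q))
    (ℚ.∣-p∣≡∣p∣ (p ℚ.- q))

  prod-diff : ∀ p q r s → p ℚ.* (q ℚ.- s) ℚ.+ s ℚ.* (p ℚ.- r) ≡ p ℚ.* q ℚ.- r ℚ.* s
  prod-diff = solve 4 (λ p q r s → p :* (q :- s) :+ s :* (p :- r) := p :* q :- r :* s) ≡.refl

  -- ε / 2B
  frac : ∀ (B : ℚ) → 0ℚ ℚ.< B → ℚ → ℚ
  frac B 0<B ε = ℚ.1/_ B ⦃ ℚ.pos⇒nonZero B ⦃ ℚ.positive 0<B ⦄ ⦄ ℚ.* (½ ℚ.* ε)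

  frac>0 : ∀ {B ε} (0<B : 0ℚ ℚ.< B) → 0ℚ ℚ.< ε → 0ℚ ℚ.< frac B 0<B ε
  frac>0 {B} {ε} 0<B 0<ε = ℚ.positive⁻¹ (frac B 0<B ε) ⦃ ℚ.pos*pos⇒pos
    (ℚ.1/_ B ⦃ ℚ.pos⇒nonZero B ⦃ ℚ.positive 0<B ⦄ ⦄) ⦃ ℚ.1/pos⇒pos B ⦃ ℚ.positive 0<B ⦄ ⦄
    (½ ℚ.* ε) ⦃ ℚ.positive (half>0 0<ε) ⦄ ⦄

  B*frac : ∀ {B} ε (0<B : 0ℚ ℚ.< B) → B ℚ.* frac B 0<B ε ≡ ½ ℚ.* ε
  B*frac {B} ε 0<B = ≡.trans (≡.sym (ℚ.*-assoc B _ _))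
    (≡.trans (≡.cong (ℚ._* (½ ℚ.* ε)) (ℚ.*-inverseʳ B ⦃ ℚ.pos⇒nonZero B ⦃ ℚ.positive 0<B ⦄ ⦄))
      (ℚ.*-identityˡ _))

  ∣p*q∣< : ∀ {B} ε (0<B : 0ℚ ℚ.< B) p q → ∣ p ∣ ℚ.≤ B → ∣ q ∣ ℚ.< frac B 0<B ε →
           ∣ p ℚ.* q ∣ ℚ.< ½ ℚ.* ε
  ∣p*q∣< {B} ε 0<B p q p≤ q< = begin-strict
    ∣ p ℚ.* q ∣          ≡⟨ ℚ.∣p*q∣≡∣p∣*∣q∣ p q ⟩
    ∣ p ∣ ℚ.* ∣ q ∣      ≤⟨ ℚ.*-monoʳ-≤-nonNeg ∣ q ∣ ⦃ ℚ.∣-∣-nonNeg q ⦄ p≤ ⟩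
    B ℚ.* ∣ q ∣          <⟨ ℚ.*-monoʳ-<-pos B ⦃ ℚ.positive 0<B ⦄ q< ⟩
    B ℚ.* frac B 0<B ε   ≡⟨ B*frac ε 0<B ⟩
    ½ ℚ.* ε              ∎
    where open ℚ.≤-Reasoning

  bounded : ∀ x → ∃ λ B → 0ℚ ℚ.< B × Eventually λ n → ∣ seq x n ∣ ℚ.≤ B
  bounded x with cauchy x 1ℚ (ℚ.positive⁻¹ 1ℚ)
  ... | N , h = 1ℚ ℚ.+ ∣ seq x N ∣ , 0<B , N , λ n N≤n → begin
    ∣ seq x n ∣                              ≡⟨ ≡.cong ∣_∣ (split (seq x n) (seq x N)) ⟩
    ∣ (seq x n ℚ.- seq x N) ℚ.+ seq x N ∣    ≤⟨ ℚ.∣p+q∣≤∣p∣+∣q∣ (seq x n ℚ.- seq x N) (seq x N) ⟩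
    ∣ seq x n ℚ.- seq x N ∣ ℚ.+ ∣ seq x N ∣  ≤⟨ ℚ.+-monoˡ-≤ ∣ seq x N ∣ (ℚ.<⇒≤ (h n N N≤n ℕ.≤-refl)) ⟩
    1ℚ ℚ.+ ∣ seq x N ∣                       ∎
    where
    open ℚ.≤-Reasoning
    split : ∀ p q → p ≡ (p ℚ.- q) ℚ.+ q
    split = solve 2 (λ p q → p := (p :- q) :+ q) ≡.refl
    0<B : 0ℚ ℚ.< 1ℚ ℚ.+ ∣ seq x N ∣
    0<B = ℚ.+-mono-<-≤ (ℚ.positive⁻¹ 1ℚ) (ℚ.0≤∣p∣ (seq x N))

  fromℚ : ℚ → ℝ
  fromℚ q .seq _ = q
  fromℚ q .cauchy ε 0<ε = 0 , λ _ _ _ _ →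
    ≡.subst (ℚ._< ε) (≡.sym (≡.cong ∣_∣ (ℚ.+-inverseʳ q))) 0<ε

  fromℤ : ℤ → ℝ
  fromℤ i = fromℚ (i ℚ./ 1)

  0ℝ 1ℝ : ℝ
  0ℝ = fromℚ 0ℚ
  1ℝ = fromℚ 1ℚ

  _+_ : ℝ → ℝ → ℝ
  (x + y) .seq n = seq x n ℚ.+ seq y n
  (x + y) .cauchy ε 0<ε =
    let M , p = cauchy x (½ ℚ.* ε) (half>0 0<ε)
        N , q = cauchy y (½ ℚ.* ε) (half>0 0<ε)
    in M ℕ.⊔ N , λ m n hm hn →
       triangle≡ ε (seq x m ℚ.- seq x n) (seq y m ℚ.- seq y n) _
         (sum-diff (seq x m) (seq y m) (seq x n) (seq y n))
         (p m n (ℕ.≤-trans (ℕ.m≤m⊔n M N) hm) (ℕ.≤-trans (ℕ.m≤m⊔n M N) hn))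
         (q m n (ℕ.≤-trans (ℕ.m≤n⊔m M N) hm) (ℕ.≤-trans (ℕ.m≤n⊔m M N) hn))

  -_ : ℝ → ℝ
  (- x) .seq n = ℚ.- seq x n
  (- x) .cauchy ε 0<ε =
    let N , p = cauchy x ε 0<ε
    in N , λ m n hm hn →
       ≡.subst (ℚ._< ε) (≡.sym (neg-diff (seq x m) (seq x n))) (p m n hm hn)

  _*_ : ℝ → ℝ → ℝ
  (x * y) .seq n = seq x n ℚ.* seq y n
  (x * y) .cauchy ε 0<ε =
    let A , 0<A , K , a = bounded x
        B , 0<B , L , b = bounded y
        M , p = cauchy x (frac B 0<B ε) (frac>0 0<B 0<ε)
        N , q = cauchy y (frac A 0<A ε) (frac>0 0<A 0<ε)
    in (K ℕ.⊔ L) ℕ.⊔ (M ℕ.⊔ N) , λ m n hm hn →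
       let hK = ℕ.m⊔n≤o⇒m≤o K L (ℕ.m⊔n≤o⇒m≤o (K ℕ.⊔ L) (M ℕ.⊔ N) hm)
           hL = ℕ.m⊔n≤o⇒n≤o K L (ℕ.m⊔n≤o⇒m≤o (K ℕ.⊔ L) (M ℕ.⊔ N) hn)
           hMN  = ℕ.m⊔n≤o⇒n≤o (K ℕ.⊔ L) (M ℕ.⊔ N) hm
           hMN′ = ℕ.m⊔n≤o⇒n≤o (K ℕ.⊔ L) (M ℕ.⊔ N) hn
       in triangle≡ ε (seq x m ℚ.* (seq y m ℚ.- seq y n)) (seq y n ℚ.* (seq x m ℚ.- seq x n)) _
            (prod-diff (seq x m) (seq y m) (seq x n) (seq y n))
            (∣p*q∣< ε 0<A (seq x m) (seq y m ℚ.- seq y n) (a m hK)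
              (q m n (ℕ.m⊔n≤o⇒n≤o M N hMN) (ℕ.m⊔n≤o⇒n≤o M N hMN′)))
            (∣p*q∣< ε 0<B (seq y n) (seq x m ℚ.- seq x n) (b n hL)
              (p m n (ℕ.m⊔n≤o⇒m≤o M N hMN) (ℕ.m⊔n≤o⇒m≤o M N hMN′)))

  _-_ : ℝ → ℝ → ℝ
  x - y = x + - y

  pointwise : ∀ {x y} → (∀ n → seq x n ≡ seq y n) → x ≈ y
  pointwise {x} {y} eq = mk≈ λ ε 0<ε → 0 , λ n _ → ≡.subst (ℚ._< ε)
    (≡.sym (≡.cong ∣_∣ (≡.trans (≡.cong (ℚ._- seq y n) (eq n)) (ℚ.+-inverseʳ (seq y n))))) 0<ε

  ≈-sym : ∀ {x y} → x ≈ y → y ≈ x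
  ≈-sym {x} {y} (mk≈ h) = mk≈ λ ε 0<ε →
    mapE (λ {n} → ≡.subst (ℚ._< ε) (∣p-q∣≡∣q-p∣ (seq x n) (seq y n))) (h ε 0<ε)

  ≈-trans : ∀ {x y z} → x ≈ y → y ≈ z → x ≈ z
  ≈-trans {x} {y} {z} (mk≈ g) (mk≈ h) = mk≈ λ ε 0<ε →
    mapE (λ {n} (p , q) → triangle≡ ε (seq x n ℚ.- seq y n) (seq y n ℚ.- seq z n) _
           (telescope (seq x n) (seq y n) (seq z n)) p q)
      (both (g (½ ℚ.* ε) (half>0 0<ε)) (h (½ ℚ.* ε) (half>0 0<ε)))

  +-cong : ∀ {x y u v} → x ≈ y → u ≈ v → x + u ≈ y + v
  +-cong {x} {y} {u} {v} (mk≈ g) (mk≈ h) = mk≈ λ ε 0<ε →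
    mapE (λ {n} (p , q) → triangle≡ ε (seq x n ℚ.- seq y n) (seq u n ℚ.- seq v n) _
           (sum-diff (seq x n) (seq u n) (seq y n) (seq v n)) p q)
      (both (g (½ ℚ.* ε) (half>0 0<ε)) (h (½ ℚ.* ε) (half>0 0<ε)))

  -‿cong : ∀ {x y} → x ≈ y → - x ≈ - y
  -‿cong {x} {y} (mk≈ g) = mk≈ λ ε 0<ε →
    mapE (λ {n} → ≡.subst (ℚ._< ε) (≡.sym (neg-diff (seq x n) (seq y n)))) (g ε 0<ε)

  *-cong : ∀ {x y u v} → x ≈ y → u ≈ v → x * u ≈ y * v
  *-cong {x} {y} {u} {v} (mk≈ g) (mk≈ h) = mk≈ λ ε 0<ε →
    let A , 0<A , a = bounded x
        B , 0<B , b = bounded v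
    in mapE (λ {n} ((a , b) , (p , q)) →
         triangle≡ ε (seq x n ℚ.* (seq u n ℚ.- seq v n)) (seq v n ℚ.* (seq x n ℚ.- seq y n)) _
           (prod-diff (seq x n) (seq u n) (seq y n) (seq v n))
           (∣p*q∣< ε 0<A (seq x n) (seq u n ℚ.- seq v n) a q)
           (∣p*q∣< ε 0<B (seq v n) (seq x n ℚ.- seq y n) b p))
         (both (both a b) (both (g (frac B 0<B ε) (frac>0 0<B 0<ε)) (h (frac A 0<A ε) (frac>0 0<A 0<ε))))

  ℝ-commutativeRing : CommutativeRing 0ℓ 0ℓ
  ℝ-commutativeRing = record
    { Carrier = ℝ
    ; _≈_ = _≈_
    ; _+_ = _+_
    ; _*_ = _*_
    ; -_  = -_
    ; 0#  = 0ℝ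
    ; 1#  = 1ℝ
    ; isCommutativeRing = record
      { isRing = record
        { +-isAbelianGroup = record
          { isGroup = record
            { isMonoid = record
              { isSemigroup = record
                { isMagma = record
                  { isEquivalence = record
                    { refl = pointwise λ _ → ≡.refl ; sym = ≈-sym ; trans = ≈-trans }
                  ; ∙-cong = +-cong
                  }
                ; assoc = λ x y z → pointwise λ n → ℚ.+-assoc (seq x n) (seq y n) (seq z n)
                }
              ; identity = (λ x → pointwise λ n → ℚ.+-identityˡ (seq x n))
                         , (λ x → pointwise λ n → ℚ.+-identityʳ (seq x n))
              }
            ; inverse = (λ x → pointwise λ n → ℚ.+-inverseˡ (seq x n))
                      , (λ x → pointwise λ n → ℚ.+-inverseʳ (seq x n))
            ; ⁻¹-cong = -‿cong
            }
          ; comm = λ x y → pointwise λ n → ℚ.+-comm (seq x n) (seq y n)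
          }
        ; *-cong = *-cong
        ; *-assoc = λ x y z → pointwise λ n → ℚ.*-assoc (seq x n) (seq y n) (seq z n)
        ; *-identity = (λ x → pointwise λ n → ℚ.*-identityˡ (seq x n))
                     , (λ x → pointwise λ n → ℚ.*-identityʳ (seq x n))
        ; distrib = (λ x y z → pointwise λ n → ℚ.*-distribˡ-+ (seq x n) (seq y n) (seq z n))
                  , (λ x y z → pointwise λ n → ℚ.*-distribʳ-+ (seq x n) (seq y n) (seq z n))
        }
      ; *-comm = λ x y → pointwise λ n → ℚ.*-comm (seq x n) (seq y n)
      }
    }

  module ℤR = CommutativeRing ℤ.+-*-commutativeRing

  toℚᵘ-/1 : ∀ i → ℚ.toℚᵘ (i ℚ./ 1) ℚᵘ.≃ i ℚᵘ./ 1
  toℚᵘ-/1 i = ℚ.toℚᵘ-fromℚᵘ (i ℚᵘ./ 1)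

  /1-+ : ∀ i j → (i ℤ.+ j) ℚ./ 1 ≡ i ℚ./ 1 ℚ.+ j ℚ./ 1
  /1-+ i j = ℚ.toℚᵘ-injective (begin
    ℚ.toℚᵘ ((i ℤ.+ j) ℚ./ 1)                   ≈⟨ toℚᵘ-/1 (i ℤ.+ j) ⟩
    (i ℤ.+ j) ℚᵘ./ 1                           ≈⟨ ℚᵘ.*≡* (≡.cong (ℤ._* ℤ.1ℤ)
      (≡.cong₂ ℤ._+_ (≡.sym (ℤ.*-identityʳ i)) (≡.sym (ℤ.*-identityʳ j)))) ⟩
    i ℚᵘ./ 1 ℚᵘ.+ j ℚᵘ./ 1                     ≈⟨ ℚᵘ.+-cong (toℚᵘ-/1 i) (toℚᵘ-/1 j) ⟨
    ℚ.toℚᵘ (i ℚ./ 1) ℚᵘ.+ ℚ.toℚᵘ (j ℚ./ 1)     ≈⟨ ℚ.toℚᵘ-homo-+ (i ℚ./ 1) (j ℚ./ 1) ⟨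
    ℚ.toℚᵘ (i ℚ./ 1 ℚ.+ j ℚ./ 1)               ∎)
    where open SetoidReasoning ℚᵘ.≃-setoid

  /1-* : ∀ i j → (i ℤ.* j) ℚ./ 1 ≡ (i ℚ./ 1) ℚ.* (j ℚ./ 1)
  /1-* i j = ℚ.toℚᵘ-injective (begin
    ℚ.toℚᵘ ((i ℤ.* j) ℚ./ 1)                   ≈⟨ toℚᵘ-/1 (i ℤ.* j) ⟩
    (i ℤ.* j) ℚᵘ./ 1                           ≈⟨ ℚᵘ.≃-refl ⟩
    (i ℚᵘ./ 1) ℚᵘ.* (j ℚᵘ./ 1)                 ≈⟨ ℚᵘ.*-cong (toℚᵘ-/1 i) (toℚᵘ-/1 j) ⟨
    ℚ.toℚᵘ (i ℚ./ 1) ℚᵘ.* ℚ.toℚᵘ (j ℚ./ 1)     ≈⟨ ℚ.toℚᵘ-homo-* (i ℚ./ 1) (j ℚ./ 1) ⟨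
    ℚ.toℚᵘ ((i ℚ./ 1) ℚ.* (j ℚ./ 1))           ∎)
    where open SetoidReasoning ℚᵘ.≃-setoid

  /1-neg : ∀ i → (ℤ.- i) ℚ./ 1 ≡ ℚ.- (i ℚ./ 1)
  /1-neg i = ℚ.toℚᵘ-injective (begin
    ℚ.toℚᵘ ((ℤ.- i) ℚ./ 1)   ≈⟨ toℚᵘ-/1 (ℤ.- i) ⟩
    ℚᵘ.- (i ℚᵘ./ 1)          ≈⟨ ℚᵘ.-‿cong (toℚᵘ-/1 i) ⟨
    ℚᵘ.- ℚ.toℚᵘ (i ℚ./ 1)    ≈⟨ ℚ.toℚᵘ-homo‿- (i ℚ./ 1) ⟨
    ℚ.toℚᵘ (ℚ.- (i ℚ./ 1))   ∎)
    where open SetoidReasoning ℚᵘ.≃-setoid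

  open RingMorphisms ℤR.rawRing (CommutativeRing.rawRing ℝ-commutativeRing)

  fromℤ-isRingHomomorphism : IsRingHomomorphism fromℤ
  fromℤ-isRingHomomorphism = record
    { isSemiringHomomorphism = record
      { isNearSemiringHomomorphism = record
        { +-isMonoidHomomorphism = record
          { isMagmaHomomorphism = record
            { isRelHomomorphism = record { cong = λ { ≡.refl → pointwise λ _ → ≡.refl } }
            ; homo = λ i j → pointwise λ _ → /1-+ i j
            }
          ; ε-homo = pointwise λ _ → ≡.refl
          }
        ; *-homo = λ i j → pointwise λ _ → /1-* i j
        }
      ; 1#-homo = pointwise λ _ → ≡.refl
      }
    ; -‿homo = λ i → pointwise λ _ → /1-neg i
    }

open RealNumbers using (ℝ-commutativeRing; fromℤ-isRingHomomorphism)

SL₂ℤ : Set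
SL₂ℤ = SL₂ ℤ.+-*-commutativeRing

PSL₂ℤ PSL₂ℝ : Group 0ℓ 0ℓ
PSL₂ℤ = PSL₂ ℤ.+-*-commutativeRing
PSL₂ℝ = PSL₂ ℝ-commutativeRing

ι : SL₂ℤ → SL₂ ℝ-commutativeRing
ι = map-SL₂ ℤ.+-*-commutativeRing ℝ-commutativeRing fromℤ-isRingHomomorphism

ι-isGroupHomomorphism :
  GroupMorphisms.IsGroupHomomorphism (Group.rawGroup PSL₂ℤ) (Group.rawGroup PSL₂ℝ) ι
ι-isGroupHomomorphism = map-SL₂-isGroupHomomorphism
  ℤ.+-*-commutativeRing ℝ-commutativeRing fromℤ-isRingHomomorphism

-- G ≤ PSL₂(ℤ) regarded as a subgroup of PSL₂(ℝ).
inPSL₂ℝ : Subgroup PSL₂ℤ p → Subgroup PSL₂ℝ p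
inPSL₂ℝ = image PSL₂ℤ PSL₂ℝ ι-isGroupHomomorphism

-- The map N_Γ(G)/G → N_{PSL₂(ℝ)}(G)/G given by the inclusion of Γ in PSL₂(ℝ).
inclusion/ : (G : Subgroup PSL₂ℤ p) →
             Group.Carrier (Normaliser/ G) → Group.Carrier (Normaliser/ (inPSL₂ℝ G))
inclusion/ = induced PSL₂ℤ PSL₂ℝ ι-isGroupHomomorphism

module HyperbolicPlane where
  open RealNumbers

  infix 4 _≈ᶜ_ _·_↦_
  infixl 6 _+ᶜ_
  infixl 7 _*ᶜ_

  record ℂ : Set where
    constructor _+i_
    field
      re im : ℝ

  open ℂ public

  _≈ᶜ_ : ℂ → ℂ → Set
  z ≈ᶜ w = re z ≈ re w × im z ≈ im w

  _+ᶜ_ _*ᶜ_ : ℂ → ℂ → ℂ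
  z +ᶜ w = (re z + re w) +i (im z + im w)
  z *ᶜ w = (re z * re w - im z * im w) +i (re z * im w + im z * re w)

  ℤ→ℂ : ℤ → ℂ
  ℤ→ℂ n = fromℤ n +i 0ℝ

  ∣_∣² : ℂ → ℝ
  ∣ z ∣² = re z * re z + im z * im z

  record ℍ : Set where
    constructor mkℍ
    field
      point : ℂ
      im>0  : 0ℝ < im point

  open ℍ public

  -- w = (az + b)/(cz + d), with the denominator cleared.
  _·_↦_ : SL₂ℤ → ℍ → ℍ → Set
  γ · z ↦ w = (ℤ→ℂ c *ᶜ point z +ᶜ ℤ→ℂ d) *ᶜ point w ≈ᶜ ℤ→ℂ a *ᶜ point z +ᶜ ℤ→ℂ b
    where open SL₂ γ

  -- The interior of the triangle with vertices e^{πi/3}, 0 and ∞: its sides lie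
  -- on the geodesics Re z = 0, Re z = 1/2 and |z - 1| = 1.
  △ : Pred ℍ 0ℓ
  △ z = 0ℝ < re (point z)
      × re (point z) < fromℚ ½
      × 1ℝ < ∣ point z +ᶜ ℤ→ℂ (ℤ.- ℤ.1ℤ) ∣²

  copy : SL₂ℤ → Pred ℍ 0ℓ
  copy γ z = ∃ λ z₀ → z₀ ∈ △ × γ · z₀ ↦ z

  data ℚ∞ : Set where
    ∞   : ℚ∞
    rat : ℚ → ℚ∞

  num den : ℚ∞ → ℤ
  num ∞       = ℤ.1ℤ
  num (rat q) = ℚ.↥ q
  den ∞       = ℤ.0ℤ
  den (rat q) = ℚ.↧ q

  -- The basic neighbourhoods of the cusp p/q in ℍ*, less the cusp itself, are
  -- the horoballs Im z > Y |qz - p|²; as p/q is in lowest terms, this is the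
  -- image of { Im z > Y } under any element of Γ taking ∞ to p/q.
  horoball : ℚ∞ → ℝ → Pred ℍ 0ℓ
  horoball x Y z =
    Y * ∣ ℤ→ℂ (den x) *ᶜ point z +ᶜ ℤ→ℂ (ℤ.- num x) ∣² < im (point z)

  module _ (G : Subgroup PSL₂ℤ p) where
    open Subgroup G

    -- The full preimage in ℍ of the image of S in X(G).  Subsets of G\ℍ are
    -- represented by such G-invariant subsets of ℍ.
    imageInX : Pred ℍ 0ℓ → Pred ℍ p
    imageInX S z = ∃ λ g → g ∈ member × ∃ λ z′ → z′ ∈ S × g · z′ ↦ z

    module _ (x : ℚ∞) (Y : ℝ) where

      piece : SL₂ℤ → Pred ℍ 0ℓ
      piece γ z = z ∈ copy γ × z ∈ horoball x Y

      -- The edges of the copies of △ cut ℍ into the open copies, hence cut the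
      -- neighbourhood of x in ℍ into the nonempty pieces.  The sectors are the
      -- images of these pieces in X(G), and are equal when they are the same
      -- subset of X(G).  One copy of △ can thus give two sectors at a cusp,
      -- one for each of its ideal vertices.
      Sectors : Setoid 0ℓ p
      Sectors = On.setoid {B = Σ SL₂ℤ λ γ → ∃ λ z → z ∈ piece γ}
        (≐-setoid ℍ p) (λ (γ , _) → imageInX (piece γ))

    -- All sufficiently small neighbourhoods of the cusp Gx of X(G) are cut into
    -- exactly n sectors.  Since each g ∈ G maps horoball x Y onto
    -- horoball (g x) Y, this depends only on the orbit Gx.
    HasWidth : ℚ∞ → ℕ → Set p
    HasWidth x n = ∃ λ Y₀ → ∀ Y → Y₀ < Y → Bijection (≡.setoid (Fin n)) (Sectors x Y)

open HyperbolicPlane public using (ℚ∞; HasWidth)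

-- Write T for z ↦ z + 1 and S for z ↦ -1/z.  At a cusp x = σ∞ the copies of △
-- that reach a small horoball are those of σTᵏ and σTᵏS, two for every unit of
-- length, and G identifies them exactly through the σTᵏσ⁻¹ it contains.  Hence
-- w = 2h, where σTʰσ⁻¹ generates the stabiliser of x in G; here h is the same
-- for all cusps.
--
-- Let N ∈ SL₂(ℝ) normalise G and let τ ∈ SL₂(ℤ).  Then NτTʰ(Nτ)⁻¹ is a parabolic
-- element of Γ, so it is σTᵏσ⁻¹ for some σ ∈ SL₂(ℤ), and h ∣ k since it lies in G.
-- Comparing entries, σ⁻¹Nτ is upper triangular and its first entry p satisfies
-- p² = k/h ∈ ℤ.  The same holds for N⁻¹ in place of N, and the two squares
-- multiply to 1, so p = ±1 and the first column of Nτ is integral.  The cases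
-- τ = 1 and τ = S give the two columns of N.
module Submission where

open import Algebra.Bundles using (Group; CommutativeRing)
open import Algebra.Morphism.Structures using (module GroupMorphisms; module RingMorphisms)
import Algebra.Properties.Group as GroupProperties
import Algebra.Solver.Ring as RingSolver
open import Algebra.Solver.Ring.AlmostCommutativeRing using (fromCommutativeRing; _-Raw-AlmostCommutative⟶_)
open import Data.Bool using (Bool; true; false)
open import Data.Empty using (⊥; ⊥-elim)
open import Data.Fin as Fin using (Fin)
import Data.Fin.Properties as Fin
open import Data.Integer as ℤ using (ℤ)
import Data.Integer.DivMod as ℤ
open import Data.Integer.GCD using (gcd)
import Data.Integer.Properties as ℤ
import Data.Integer.Solver as ℤ-RingSolver
open import Data.Maybe as Maybe using (Maybe)
open import Data.Nat as ℕ using (ℕ)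
import Data.Nat.Coprimality as Coprimality
open import Data.Nat.GCD using (module Bézout)
import Data.Nat.Properties as ℕ
open import Data.Product using (∃; _×_; _,_; proj₁; proj₂)
open import Data.Rational as ℚ using (ℚ; 0ℚ; 1ℚ; ½; ∣_∣)
import Data.Rational.Properties as ℚ
import Data.Rational.Solver as ℚ-Solver
import Data.Rational.Unnormalised as ℚᵘ
import Data.Rational.Unnormalised.Properties as ℚᵘ
open import Data.Sum using (_⊎_; inj₁; inj₂)
open import Function.Bundles using (Bijection; Equivalence; mk⇔)
open import Level using (Level; 0ℓ)
open import Relation.Binary.Bundles using (Setoid)
open import Relation.Binary.Definitions using (tri<; tri≈; tri>)
open import Relation.Binary.PropositionalEquality as ≡ using (_≡_; _≢_)
import Relation.Binary.Reasoning.Setoid as SetoidReasoning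
open import Relation.Nullary using (¬_; yes; no)
open import Relation.Nullary.Decidable using (dec⇒maybe)
open import Relation.Unary using (_∈_; _⊆_)
open import Defs
open RealNumbers using (ℝ-commutativeRing; fromℤ-isRingHomomorphism)

-- Reals are Cauchy sequences and `G` is an arbitrary predicate, so neither the order of ℝ nor
-- membership in `G` can be decided, and this shapes the proof. The geometry is reduced to strict
-- inequalities, which hold of the rational terms of the sequences from some index on; at one such
-- index they are refuted or exploited by polynomial identities over ℚ, and what is concluded
-- concerns integers. The least period is not found by searching `G`: sectors are labelled by
-- integers, one for each half-unit interval at the cusp, so that equality of sectors becomes
-- congruence modulo a subgroup of ℤ, and finiteness of the width shows that this subgroup is wℤ.
-- The passage back by N⁻¹ is forced, because integrality of p² leaves room for rescaling: the
-- diagonal matrix with entries √m and 1/√m conjugates Tʰ to the m-th power of Tʰ. Equality in PSL₂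
-- is up to sign. In the intertwining relation for C = σ⁻¹Nτ the minus sign would make the first
-- column of C vanish.

-- Ordered arithmetic in ℚ and ℝ.

module ℚ-Order where
  open ℚ-Solver.+-*-Solver

  0<q-p : ∀ {p q} → p ℚ.< q → 0ℚ ℚ.< q ℚ.- p
  0<q-p {p} {q} p<q = ≡.subst (ℚ._< q ℚ.- p) (ℚ.+-inverseʳ p) (ℚ.+-monoˡ-< (ℚ.- p) p<q)

  0<q-p⁻¹ : ∀ {p q} → 0ℚ ℚ.< q ℚ.- p → p ℚ.< q
  0<q-p⁻¹ {p} {q} 0<d = ≡.subst₂ ℚ._<_ (ℚ.+-identityˡ p)
    (solve 2 (λ p q → q :- p :+ p := q) ≡.refl p q) (ℚ.+-monoˡ-< p 0<d)

  0≤q-p : ∀ {p q} → p ℚ.≤ q → 0ℚ ℚ.≤ q ℚ.- p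
  0≤q-p {p} {q} p≤q = ≡.subst (ℚ._≤ q ℚ.- p) (ℚ.+-inverseʳ p) (ℚ.+-monoˡ-≤ (ℚ.- p) p≤q)

  0≤q-p⁻¹ : ∀ {p q} → 0ℚ ℚ.≤ q ℚ.- p → p ℚ.≤ q
  0≤q-p⁻¹ {p} {q} 0≤d = ≡.subst₂ ℚ._≤_ (ℚ.+-identityˡ p)
    (solve 2 (λ p q → q :- p :+ p := q) ≡.refl p q) (ℚ.+-monoˡ-≤ p 0≤d)

  0<p+q : ∀ {p q} → 0ℚ ℚ.< p → 0ℚ ℚ.< q → 0ℚ ℚ.< p ℚ.+ q
  0<p+q = ℚ.+-mono-<

  0<p+≤q : ∀ {p q} → 0ℚ ℚ.< p → 0ℚ ℚ.≤ q → 0ℚ ℚ.< p ℚ.+ q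
  0<p+≤q = ℚ.+-mono-<-≤

  0≤p+q : ∀ {p q} → 0ℚ ℚ.≤ p → 0ℚ ℚ.≤ q → 0ℚ ℚ.≤ p ℚ.+ q
  0≤p+q = ℚ.+-mono-≤

  0<p*q : ∀ {p q} → 0ℚ ℚ.< p → 0ℚ ℚ.< q → 0ℚ ℚ.< p ℚ.* q
  0<p*q {p} {q} 0<p 0<q =
    ℚ.positive⁻¹ (p ℚ.* q) ⦃ ℚ.pos*pos⇒pos p ⦃ ℚ.positive 0<p ⦄ q ⦃ ℚ.positive 0<q ⦄ ⦄

  0≤p*q : ∀ {p q} → 0ℚ ℚ.≤ p → 0ℚ ℚ.≤ q → 0ℚ ℚ.≤ p ℚ.* q
  0≤p*q {p} {q} 0≤p 0≤q = ℚ.nonNegative⁻¹ (p ℚ.* q)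
    ⦃ ℚ.nonNeg*nonNeg⇒nonNeg p ⦃ ℚ.nonNegative 0≤p ⦄ q ⦃ ℚ.nonNegative 0≤q ⦄ ⦄

  0≤p*p : ∀ p → 0ℚ ℚ.≤ p ℚ.* p
  0≤p*p p with ℚ.≤-total 0ℚ p
  ... | inj₁ 0≤p = 0≤p*q 0≤p 0≤p
  ... | inj₂ p≤0 = ≡.subst (0ℚ ℚ.≤_) (solve 1 (λ p → (:- p) :* (:- p) := p :* p) ≡.refl p)
    (0≤p*q (ℚ.neg-antimono-≤ p≤0) (ℚ.neg-antimono-≤ p≤0))

  p≤∣p∣ : ∀ p → p ℚ.≤ ∣ p ∣
  p≤∣p∣ p with ℚ.≤-total 0ℚ p
  ... | inj₁ 0≤p = ℚ.≤-reflexive (≡.sym (ℚ.0≤p⇒∣p∣≡p 0≤p))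
  ... | inj₂ p≤0 = ℚ.≤-trans p≤0 (ℚ.0≤∣p∣ p)

  -p≤∣p∣ : ∀ p → ℚ.- p ℚ.≤ ∣ p ∣
  -p≤∣p∣ p = ≡.subst (ℚ.- p ℚ.≤_) (ℚ.∣-p∣≡∣p∣ p) (p≤∣p∣ (ℚ.- p))

  ∣p∣<e : ∀ {p e} → p ℚ.< e → ℚ.- p ℚ.< e → ∣ p ∣ ℚ.< e
  ∣p∣<e {p} {e} p<e -p<e with ℚ.∣p∣≡p∨∣p∣≡-p p
  ... | inj₁ eq = ≡.subst (ℚ._< e) (≡.sym eq) p<e
  ... | inj₂ eq = ≡.subst (ℚ._< e) (≡.sym eq) -p<e

  recip : ∀ p → 0ℚ ℚ.< p → ℚ
  recip p 0<p = ℚ.1/_ p ⦃ ℚ.pos⇒nonZero p ⦃ ℚ.positive 0<p ⦄ ⦄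

  p*recip : ∀ p (0<p : 0ℚ ℚ.< p) → p ℚ.* recip p 0<p ≡ 1ℚ
  p*recip p 0<p = ℚ.*-inverseʳ p ⦃ ℚ.pos⇒nonZero p ⦃ ℚ.positive 0<p ⦄ ⦄

  0<recip : ∀ p (0<p : 0ℚ ℚ.< p) → 0ℚ ℚ.< recip p 0<p
  0<recip p 0<p = ℚ.positive⁻¹ (recip p 0<p) ⦃ ℚ.1/pos⇒pos p ⦃ ℚ.positive 0<p ⦄ ⦄

  *-cancel-< : ∀ {r p q} → 0ℚ ℚ.< r → r ℚ.* p ℚ.< r ℚ.* q → p ℚ.< q
  *-cancel-< {r} 0<r = ℚ.*-cancelˡ-<-nonNeg r ⦃ ℚ.pos⇒nonNeg r ⦃ ℚ.positive 0<r ⦄ ⦄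

  -- Here |1/p - 1/q| = |q - p|/pq, and pq > g² absorbs the factor g² of the hypothesis. The two
  -- signs of the absolute value are the same computation with p and q exchanged. This gives the
  -- Cauchy property of `inv`.
  recip-diff< : ∀ {g p q e} (0<g : 0ℚ ℚ.< g) (g<p : g ℚ.< p) (g<q : g ℚ.< q)
                (0<p : 0ℚ ℚ.< p) (0<q : 0ℚ ℚ.< q) →
                ∣ p ℚ.- q ∣ ℚ.< g ℚ.* g ℚ.* e → 0ℚ ℚ.< e →
                ∣ recip p 0<p ℚ.- recip q 0<q ∣ ℚ.< e
  recip-diff< {g} {p} {q} {e} 0<g g<p g<q 0<p 0<q h 0<e =
    ∣p∣<e (half p q r s 0<p 0<q g<p g<q (p*recip p 0<p) (p*recip q 0<q)
             (ℚ.≤-<-trans (-p≤∣p∣ (p ℚ.- q)) h))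
          (≡.subst (ℚ._< e) (solve 2 (λ r s → s :- r := :- (r :- s)) ≡.refl r s)
            (half q p s r 0<q 0<p g<q g<p (p*recip q 0<q) (p*recip p 0<p)
              (ℚ.≤-<-trans (≡.subst (ℚ._≤ ∣ p ℚ.- q ∣)
                (solve 2 (λ p q → p :- q := :- (q :- p)) ≡.refl p q) (p≤∣p∣ (p ℚ.- q))) h)))
    where
    r s : ℚ
    r = recip p 0<p
    s = recip q 0<q
    half : ∀ p q r s → 0ℚ ℚ.< p → 0ℚ ℚ.< q → g ℚ.< p → g ℚ.< q →
           p ℚ.* r ≡ 1ℚ → q ℚ.* s ≡ 1ℚ → ℚ.- (p ℚ.- q) ℚ.< g ℚ.* g ℚ.* e → r ℚ.- s ℚ.< e
    half p q r s 0<p 0<q g<p g<q pr qs h = *-cancel-< (0<p*q 0<p 0<q) (begin-strict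
      p ℚ.* q ℚ.* (r ℚ.- s)
        ≡⟨ solve 4 (λ p q r s → p :* q :* (r :- s) := q :* (p :* r) :- p :* (q :* s)) ≡.refl p q r s ⟩
      q ℚ.* (p ℚ.* r) ℚ.- p ℚ.* (q ℚ.* s)
        ≡⟨ ≡.cong₂ (λ u v → q ℚ.* u ℚ.- p ℚ.* v) pr qs ⟩
      q ℚ.* 1ℚ ℚ.- p ℚ.* 1ℚ
        ≡⟨ solve 2 (λ p q → q :* con 1ℚ :- p :* con 1ℚ := :- (p :- q)) ≡.refl p q ⟩
      ℚ.- (p ℚ.- q)
        <⟨ h ⟩
      g ℚ.* g ℚ.* e
        <⟨ 0<q-p⁻¹ (≡.subst (0ℚ ℚ.<_)
             (solve 4 (λ g p q e → (g :* (q :- g) :+ q :* (p :- g)) :* e := p :* q :* e :- g :* g :* e) ≡.refl g p q e)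
             (0<p*q (0<p+q (0<p*q 0<g (0<q-p g<q)) (0<p*q 0<q (0<q-p g<p))) 0<e)) ⟩
      p ℚ.* q ℚ.* e ∎)
      where open ℚ.≤-Reasoning

-- Coefficients are integers sent into the ring by `f`, because equality of integers is decidable,
-- unlike equality in ℝ or ℂ.
module ℤ-Solver {r ℓ} (R : CommutativeRing r ℓ) {f : ℤ → CommutativeRing.Carrier R}
  (f-hom : RingMorphisms.IsRingHomomorphism
    (CommutativeRing.rawRing ℤ.+-*-commutativeRing) (CommutativeRing.rawRing R) f) where
  open RingMorphisms.IsRingHomomorphism f-hom

  morphism : CommutativeRing.rawRing ℤ.+-*-commutativeRing -Raw-AlmostCommutative⟶ fromCommutativeRing R
  morphism = record
    { ⟦_⟧ = f ; +-homo = +-homo ; *-homo = *-homo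
    ; -‿homo = -‿homo ; 0-homo = 0#-homo ; 1-homo = 1#-homo }

  _coeff≟_ : ∀ i j → Maybe (CommutativeRing._≈_ R (f i) (f j))
  i coeff≟ j = Maybe.map ⟦⟧-cong (dec⇒maybe (i ℤ.≟ j))

  open RingSolver (CommutativeRing.rawRing ℤ.+-*-commutativeRing) (fromCommutativeRing R) morphism _coeff≟_ public

module ℝ-Solver = ℤ-Solver ℝ-commutativeRing fromℤ-isRingHomomorphism

module Reals where
  open RealNumbers public
  open ℝ public using (seq; cauchy)
  open CommutativeRing ℝ-commutativeRing public
    using (refl; sym; trans; setoid; +-congˡ; +-congʳ; *-congˡ; *-congʳ)
  open ℚ-Order

  private variable
    x y z : ℝ

  0<y-x : x < y → 0ℝ < y - x
  0<y-x {x} {y} (mk< g 0<g below) = mk< g 0<g (mapE (λ {n} h → 0<q-p⁻¹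
    (≡.subst (0ℚ ℚ.<_) (solve 3 (λ x y g → y :- (x :+ g) := y :- x :- (con 0ℚ :+ g)) ≡.refl (seq x n) (seq y n) g) (0<q-p h))) below)
    where open ℚ-Solver.+-*-Solver

  eventually-< : x < y → Eventually λ n → seq x n ℚ.< seq y n
  eventually-< {x} {y} (mk< g 0<g below) = mapE (λ {n} h → ℚ.<-trans
    (≡.subst (ℚ._< seq x n ℚ.+ g) (ℚ.+-identityʳ (seq x n)) (ℚ.+-monoʳ-< (seq x n) 0<g)) h) below

  fromℚ-< : ∀ {p q} → p ℚ.< q → fromℚ p < fromℚ q
  fromℚ-< {p} {q} p<q = mk< (½ ℚ.* (q ℚ.- p)) (half>0 (0<q-p p<q)) (0 , λ _ _ → 0<q-p⁻¹
    (≡.subst (0ℚ ℚ.<_) (solve 2 (λ p q → con ½ :* (q :- p) := q :- (p :+ con ½ :* (q :- p))) ≡.refl p q)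
      (half>0 (0<q-p p<q))))
    where open ℚ-Solver.+-*-Solver

  <-≤-pointwise : x < y → (∀ n → seq y n ℚ.≤ seq z n) → x < z
  <-≤-pointwise (mk< g 0<g below) y≤z = mk< g 0<g (mapE (λ {n} h → ℚ.<-≤-trans h (y≤z n)) below)

  0<x*x+y : ∀ x → 0ℝ < y → 0ℝ < x * x + y
  0<x*x+y {y} x 0<y = <-≤-pointwise 0<y λ n → ≡.subst (ℚ._≤ seq x n ℚ.* seq x n ℚ.+ seq y n)
    (ℚ.+-identityˡ (seq y n)) (ℚ.+-monoˡ-≤ (seq y n) (0≤p*p (seq x n)))

  <-trans : x < y → y < z → x < z
  <-trans {x} {y} {z} (mk< g 0<g p) q = mk< g 0<g
    (mapE (λ (h , k) → ℚ.<-trans h k) (both p (eventually-< q)))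

  -- Half of the gap pays for the distance between y and z.
  <-respʳ : y ≈ z → x < y → x < z
  <-respʳ {y} {z} {x} (mk≈ close) (mk< g 0<g below) = mk< (½ ℚ.* g) (half>0 0<g)
    (mapE (λ {n} (h , k) → 0<q-p⁻¹ (≡.subst (0ℚ ℚ.<_)
        (solve 4 (λ x y z g → (y :- (x :+ g)) :+ (con ½ :* g :- (y :- z)) := z :- (x :+ con ½ :* g)) ≡.refl (seq x n) (seq y n) (seq z n) g)
        (0<p+q (0<q-p h) (0<q-p (ℚ.≤-<-trans (p≤∣p∣ (seq y n ℚ.- seq z n)) k)))))
      (both below (close _ (half>0 0<g))))
    where open ℚ-Solver.+-*-Solver

  <-respˡ : y ≈ z → y < x → z < x
  <-respˡ {y} {z} {x} (mk≈ close) (mk< g 0<g below) = mk< (½ ℚ.* g) (half>0 0<g)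
    (mapE (λ {n} (h , k) → 0<q-p⁻¹ (≡.subst (0ℚ ℚ.<_)
        (solve 4 (λ x y z g → (x :- (y :+ g)) :+ (con ½ :* g :- (:- (y :- z))) := x :- (z :+ con ½ :* g)) ≡.refl (seq x n) (seq y n) (seq z n) g)
        (0<p+q (0<q-p h) (0<q-p (ℚ.≤-<-trans (-p≤∣p∣ (seq y n ℚ.- seq z n)) k)))))
      (both below (close _ (half>0 0<g))))
    where open ℚ-Solver.+-*-Solver

  <-asym : x < y → ¬ y < x
  <-asym {x} {y} x<y y<x =
    let N , h = both (eventually-< x<y) (eventually-< y<x)
        p , q = h N ℕ.≤-refl
    in ℚ.<-asym {seq x N} {seq y N} p q

  <-irrefl : x ≈ y → ¬ x < y
  <-irrefl x≈y x<y = let x<x = <-respʳ (sym x≈y) x<y in <-asym x<x x<x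

  0<y-x⁻¹ : 0ℝ < y - x → x < y
  0<y-x⁻¹ {y} {x} (mk< g 0<g below) = mk< g 0<g (mapE (λ {n} h → 0<q-p⁻¹
    (≡.subst (0ℚ ℚ.<_) (solve 3 (λ x y g → y :- x :- (con 0ℚ :+ g) := y :- (x :+ g)) ≡.refl (seq x n) (seq y n) g) (0<q-p h))) below)
    where open ℚ-Solver.+-*-Solver

  0<x+y : 0ℝ < x → 0ℝ < y → 0ℝ < x + y
  0<x+y {x} {y} (mk< g 0<g p) 0<y = mk< g 0<g
    (mapE (λ {n} (a , b) → 0<q-p⁻¹ (≡.subst (0ℚ ℚ.<_)
        (solve 3 (λ x y g → (x :- (con 0ℚ :+ g)) :+ y := x :+ y :- (con 0ℚ :+ g)) ≡.refl (seq x n) (seq y n) g)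
        (ℚ-Order.0<p+q (0<q-p a) b)))
      (both p (eventually-< 0<y)))
    where open ℚ-Solver.+-*-Solver

  const-< : ∀ {p q} → (∀ n → seq x n ≡ p) → (∀ n → seq y n ≡ q) → p ℚ.< q → x < y
  const-< x≡p y≡q p<q = <-respˡ (pointwise λ n → ≡.sym (x≡p n)) (<-respʳ (pointwise λ n → ≡.sym (y≡q n)) (fromℚ-< p<q))

  0<x*y : 0ℝ < x → 0ℝ < y → 0ℝ < x * y
  0<x*y {x} {y} (mk< g 0<g p) (mk< h 0<h q) = mk< (g ℚ.* h) (0<p*q 0<g 0<h)
    (mapE (λ {n} (a , b) → 0<q-p⁻¹ (≡.subst (0ℚ ℚ.<_)
        (solve 4 (λ x y g h → (x :- (con 0ℚ :+ g)) :* (y :- (con 0ℚ :+ h)) :+ (g :* (y :- (con 0ℚ :+ h)) :+ h :* (x :- (con 0ℚ :+ g)))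
           := x :* y :- (con 0ℚ :+ g :* h)) ≡.refl (seq x n) (seq y n) g h)
        (0<p+q (0<p*q (0<q-p a) (0<q-p b)) (0<p+q (0<p*q 0<g (0<q-p b)) (0<p*q 0<h (0<q-p a))))))
      (both p q))
    where open ℚ-Solver.+-*-Solver

  *-monoʳ-< : 0ℝ < x → y < z → x * y < x * z
  *-monoʳ-< {x} {y} {z} 0<x y<z = 0<y-x⁻¹ (<-respʳ
    (solve 3 (λ x y z → x :* (z :- y) := x :* z :- x :* y) refl x y z) (0<x*y 0<x (0<y-x y<z)))
    where open ℝ-Solver

  module _ {x : ℝ} (0<x : 0ℝ < x) where
    private
      open _<_ 0<x renaming (gap to g; gap>0 to 0<g)
      N = proj₁ below

      g<x : ∀ n → N ℕ.≤ n → g ℚ.< seq x n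
      g<x n h = ≡.subst (ℚ._< seq x n) (ℚ.+-identityˡ g) (proj₂ below n h)

      g<x⊔ : ∀ n → g ℚ.< seq x (n ℕ.⊔ N)
      g<x⊔ n = g<x _ (ℕ.m≤n⊔m n N)

      0<x⊔ : ∀ n → 0ℚ ℚ.< seq x (n ℕ.⊔ N)
      0<x⊔ n = ℚ.<-trans 0<g (g<x⊔ n)

    -- The index is raised to at least N, because only from N on are the terms of x known to exceed
    -- the gap; earlier ones may vanish.
    inv : ℝ
    inv .seq n = recip (seq x (n ℕ.⊔ N)) (0<x⊔ n)
    inv .cauchy e 0<e =
      let M , h = cauchy x (g ℚ.* g ℚ.* e) (0<p*q (0<p*q 0<g 0<g) 0<e)
      in M , λ m n hm hn → recip-diff< 0<g (g<x⊔ m) (g<x⊔ n) (0<x⊔ m) (0<x⊔ n)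
        (h _ _ (ℕ.≤-trans hm (ℕ.m≤m⊔n m N)) (ℕ.≤-trans hn (ℕ.m≤m⊔n n N))) 0<e

    x*inv : x * inv ≈ 1ℝ
    x*inv = mk≈ λ e 0<e → N , λ n N≤n → ≡.subst (λ q → ∣ q ℚ.- 1ℚ ∣ ℚ.< e)
      (≡.sym (≡.trans (≡.cong (λ k → seq x k ℚ.* inv .seq n) (≡.sym (ℕ.m≥n⇒m⊔n≡m N≤n)))
        (p*recip _ (0<x⊔ n)))) 0<e

    -- If |x| ≤ B eventually, then 1/x ≥ 1/B, and half of 1/B serves as the gap.
    0<inv : 0ℝ < inv
    0<inv = let B , 0<B , M , h = bounded x in
      mk< (½ ℚ.* recip B 0<B) (half>0 (0<recip B 0<B)) (M , λ n M≤n → *-cancel-< (0<p*q 0<B (0<x⊔ n)) (begin-strict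
        B ℚ.* seq x (n ℕ.⊔ N) ℚ.* (0ℚ ℚ.+ ½ ℚ.* recip B 0<B)
          ≡⟨ solve 3 (λ B x r → B :* x :* (con 0ℚ :+ con ½ :* r) := con ½ :* x :* (B :* r)) ≡.refl B (seq x (n ℕ.⊔ N)) (recip B 0<B) ⟩
        ½ ℚ.* seq x (n ℕ.⊔ N) ℚ.* (B ℚ.* recip B 0<B)
          ≡⟨ ≡.cong (½ ℚ.* seq x (n ℕ.⊔ N) ℚ.*_) (p*recip B 0<B) ⟩
        ½ ℚ.* seq x (n ℕ.⊔ N) ℚ.* 1ℚ
          <⟨ 0<q-p⁻¹ (≡.subst (0ℚ ℚ.<_) (solve 1 (λ x → con ½ :* x := x :- con ½ :* x :* con 1ℚ) ≡.refl (seq x (n ℕ.⊔ N))) (half>0 (0<x⊔ n))) ⟩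
        seq x (n ℕ.⊔ N)
          ≤⟨ p≤∣p∣ _ ⟩
        ∣ seq x (n ℕ.⊔ N) ∣
          ≤⟨ h _ (ℕ.≤-trans M≤n (ℕ.m≤m⊔n n N)) ⟩
        B
          ≡⟨ solve 1 (λ B → B := B :* con 1ℚ) ≡.refl B ⟩
        B ℚ.* 1ℚ
          ≡⟨ ≡.cong (B ℚ.*_) (p*recip _ (0<x⊔ n)) ⟨
        B ℚ.* (seq x (n ℕ.⊔ N) ℚ.* recip _ (0<x⊔ n))
          ≡⟨ ℚ.*-assoc B _ _ ⟨
        B ℚ.* seq x (n ℕ.⊔ N) ℚ.* recip _ (0<x⊔ n) ∎))
      where
      open ℚ.≤-Reasoning
      open ℚ-Solver.+-*-Solver

    inv*[x*y] : ∀ y → inv * (x * y) ≈ y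
    inv*[x*y] y = trans (solve 3 (λ i x y → i :* (x :* y) := (x :* i) :* y) refl inv x y)
      (trans (*-congʳ x*inv) (solve 1 (λ y → con ℤ.1ℤ :* y := y) refl y))
      where open ℝ-Solver

    *-cancelˡ : ∀ {u v} → x * u ≈ x * v → u ≈ v
    *-cancelˡ {u} {v} eq = trans (sym (inv*[x*y] u)) (trans (*-congˡ eq) (inv*[x*y] v))

    *-cancelˡ-< : ∀ {u v} → x * u < x * v → u < v
    *-cancelˡ-< {u} {v} h = <-respˡ (inv*[x*y] u) (<-respʳ (inv*[x*y] v) (*-monoʳ-< 0<inv h))

-- Integers inside ℝ.

module Integers where
  open Reals

  private variable
    i j : ℤ

  /1-mono-< : i ℤ.< j → i ℚ./ 1 ℚ.< j ℚ./ 1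
  /1-mono-< {i} {j} i<j = ℚ.toℚᵘ-cancel-<
    (ℚᵘ.<-respˡ-≃ (ℚᵘ.≃-sym (toℚᵘ-/1 i)) (ℚᵘ.<-respʳ-≃ (ℚᵘ.≃-sym (toℚᵘ-/1 j))
      (ℚᵘ.*<* (≡.subst₂ ℤ._<_ (≡.sym (ℤ.*-identityʳ i)) (≡.sym (ℤ.*-identityʳ j)) i<j))))

  /1-mono-≤ : i ℤ.≤ j → i ℚ./ 1 ℚ.≤ j ℚ./ 1
  /1-mono-≤ {i} {j} i≤j with i ℤ.≟ j
  ... | yes ≡.refl = ℚ.≤-refl
  ... | no i≢j = ℚ.<⇒≤ (/1-mono-< (ℤ.≤∧≢⇒< i≤j i≢j))

  fromℤ-mono-< : i ℤ.< j → fromℤ i < fromℤ j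
  fromℤ-mono-< i<j = fromℚ-< (/1-mono-< i<j)

  fromℤ-injective : fromℤ i ≈ fromℤ j → i ≡ j
  fromℤ-injective {i} {j} eq with ℤ.<-cmp i j
  ... | tri≈ _ i≡j _ = i≡j
  ... | tri< i<j _ _ = ⊥-elim (<-irrefl eq (fromℤ-mono-< i<j))
  ... | tri> _ _ j<i = ⊥-elim (<-irrefl (sym eq) (fromℤ-mono-< j<i))

  fromℤ-cancel-< : fromℤ i < fromℤ j → i ℤ.< j
  fromℤ-cancel-< {i} {j} h with ℤ.<-cmp i j
  ... | tri< i<j _ _ = i<j
  ... | tri≈ _ ≡.refl _ = ⊥-elim (<-irrefl refl h)
  ... | tri> _ _ j<i = ⊥-elim (<-asym h (fromℤ-mono-< j<i))

  0<i*i : i ≢ ℤ.0ℤ → ℤ.0ℤ ℤ.< i ℤ.* i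
  0<i*i {ℤ.+ ℕ.zero} i≢0 = ⊥-elim (i≢0 ≡.refl)
  0<i*i {ℤ.+[1+ n ]} _ = ℤ.+<+ (ℕ.s≤s ℕ.z≤n)
  0<i*i {ℤ.-[1+ n ]} _ = ℤ.+<+ (ℕ.s≤s ℕ.z≤n)

  -- If C² + CD < 0 then D² + CD > 0, because their sum is (C + D)².
  integer-cases : ∀ c d → ℤ.0ℤ ℤ.≤ c ℤ.* d ⊎
    (c ℤ.* d ℤ.≤ ℤ.0ℤ × (ℤ.0ℤ ℤ.≤ c ℤ.* (c ℤ.+ d) ⊎ ℤ.1ℤ ℤ.≤ d ℤ.* (c ℤ.+ d)))
  integer-cases c d with ℤ.≤-total ℤ.0ℤ (c ℤ.* d) | ℤ.0ℤ ℤ.≤? c ℤ.* (c ℤ.+ d)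
  ... | inj₁ 0≤cd | _ = inj₁ 0≤cd
  ... | inj₂ cd≤0 | yes h = inj₂ (cd≤0 , inj₁ h)
  ... | inj₂ cd≤0 | no h = inj₂ (cd≤0 , inj₂ (ℤ.i<j⇒suc[i]≤j (≡.subst (ℤ.0ℤ ℤ.<_) eq
          (ℤ.+-mono-≤-< (0≤i*i (c ℤ.+ d)) (ℤ.neg-mono-< (ℤ.≰⇒> h))))))
    where
    0≤i*i : ∀ i → ℤ.0ℤ ℤ.≤ i ℤ.* i
    0≤i*i i with i ℤ.≟ ℤ.0ℤ
    ... | yes ≡.refl = ℤ.≤-refl
    ... | no i≢0 = ℤ.<⇒≤ (0<i*i i≢0)
    eq : (c ℤ.+ d) ℤ.* (c ℤ.+ d) ℤ.+ ℤ.- (c ℤ.* (c ℤ.+ d)) ≡ d ℤ.* (c ℤ.+ d)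
    eq = solve 2 (λ c d → (c :+ d) :* (c :+ d) :+ :- (c :* (c :+ d)) := d :* (c :+ d)) ≡.refl c d
      where open ℤ-RingSolver.+-*-Solver

-- Lower bounds for |cz + d|² on the triangle.

module QuadraticForm where
  open ℚ-Order
  open Integers
  open RealNumbers using (/1-*; /1-+)
  open ℚ-Solver.+-*-Solver

  -- |cz + d|² at z = x + iy, with the zeros left by the multiplication in ℂ, so
  -- that the n-th term of the real number |cz + d|² is form c d applied to the
  -- n-th terms of the coordinates.
  form : ℤ → ℤ → ℚ → ℚ → ℚ
  form c d x y = P ℚ.* P ℚ.+ Q ℚ.* Q
    where
    P = c ℚ./ 1 ℚ.* x ℚ.- 0ℚ ℚ.* y ℚ.+ d ℚ./ 1
    Q = c ℚ./ 1 ℚ.* y ℚ.+ 0ℚ ℚ.* x ℚ.+ 0ℚ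

  -- The same expression as `form`, zeros included, for the solver: the identities below have to
  -- match `form` as it unfolds.
  formᴾ : ∀ {n} → Polynomial n → Polynomial n → Polynomial n → Polynomial n → Polynomial n
  formᴾ c d x y = P :* P :+ Q :* Q
    where
    P = c :* x :- con 0ℚ :* y :+ d
    Q = c :* y :+ con 0ℚ :* x :+ con 0ℚ

  0≤/1 : ∀ {i j} → ℤ.0ℤ ℤ.≤ i ℤ.* j → 0ℚ ℚ.≤ i ℚ./ 1 ℚ.* (j ℚ./ 1)
  0≤/1 {i} {j} h = ≡.subst (0ℚ ℚ.≤_) (/1-* i j) (/1-mono-≤ h)

  1≤/1 : ∀ {i j} → ℤ.1ℤ ℤ.≤ i ℤ.* j → 1ℚ ℚ.≤ i ℚ./ 1 ℚ.* (j ℚ./ 1)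
  1≤/1 {i} {j} h = ≡.subst (1ℚ ℚ.≤_) (/1-* i j) (/1-mono-≤ h)

  1≤i² : ∀ {i} → i ≢ ℤ.0ℤ → 1ℚ ℚ.≤ i ℚ./ 1 ℚ.* (i ℚ./ 1)
  1≤i² {i} i≢0 = 1≤/1 {i} {i} (ℤ.i<j⇒suc[i]≤j (0<i*i i≢0))

  module _ {x y : ℚ} (0<x : 0ℚ ℚ.< x) (x<½ : x ℚ.< ½)
           (1<∣z-1∣² : 1ℚ ℚ.< (x ℚ.+ ℚ.- 1ℚ) ℚ.* (x ℚ.+ ℚ.- 1ℚ) ℚ.+ (y ℚ.+ 0ℚ) ℚ.* (y ℚ.+ 0ℚ)) where

    private
      r : ℚ
      r = x ℚ.* x ℚ.+ y ℚ.* y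

      0≤x = ℚ.<⇒≤ 0<x

      0≤r : 0ℚ ℚ.≤ r
      0≤r = 0≤p+q (0≤p*p x) (0≤p*p y)

      0≤r-2x : 0ℚ ℚ.≤ r ℚ.- (x ℚ.+ x)
      0≤r-2x = ≡.subst (0ℚ ℚ.≤_) (solve 2 (λ x y →
        (x :+ :- con 1ℚ) :* (x :+ :- con 1ℚ) :+ (y :+ con 0ℚ) :* (y :+ con 0ℚ) :- con 1ℚ
          := x :* x :+ y :* y :- (x :+ x)) ≡.refl x y) (0≤q-p (ℚ.<⇒≤ 1<∣z-1∣²))

      0≤1-2x : 0ℚ ℚ.≤ 1ℚ ℚ.- (x ℚ.+ x)
      0≤1-2x = ≡.subst (0ℚ ℚ.≤_) (solve 1 (λ x → (con ½ :- x) :+ (con ½ :- x) := con 1ℚ :- (x :+ x)) ≡.refl x)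
        (0≤p+q (0≤q-p (ℚ.<⇒≤ x<½)) (0≤q-p (ℚ.<⇒≤ x<½)))

    -- Write r = |z|²; the form is c²r + 2xcd + d². For cd ≥ 0 it is at least d² ≥ 1. For cd ≤ 0 the
    -- middle term is bounded below either by rcd, since 2x ≤ r outside the circle |z - 1| = 1,
    -- leaving r·c(c + d) + d², or by cd, since 2x ≤ 1, leaving c²r + d(c + d). `integer-cases` says
    -- which of the two suffices.
    1≤form : ∀ c d → c ≢ ℤ.0ℤ → d ≢ ℤ.0ℤ → 1ℚ ℚ.≤ form c d x y
    1≤form c d c≢0 d≢0 = 0≤q-p⁻¹ (certificate (integer-cases c d))
      where
      C = c ℚ./ 1
      D = d ℚ./ 1
      0≤C² = ℚ.≤-trans (ℚ.<⇒≤ (ℚ.positive⁻¹ 1ℚ)) (1≤i² c≢0)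
      0≤D²-1 = 0≤q-p (1≤i² d≢0)
      0≤-CD : c ℤ.* d ℤ.≤ ℤ.0ℤ → 0ℚ ℚ.≤ 0ℚ ℚ.- C ℚ.* D
      0≤-CD h = 0≤q-p (≡.subst (ℚ._≤ 0ℚ) (/1-* c d) (/1-mono-≤ h))
      certificate : _ → 0ℚ ℚ.≤ form c d x y ℚ.- 1ℚ
      certificate (inj₁ 0≤cd) = ≡.subst (0ℚ ℚ.≤_)
        (solve 4 (λ c d x y → c :* c :* (x :* x :+ y :* y) :+ (x :+ x) :* (c :* d) :+ (d :* d :- con 1ℚ)
          := formᴾ c d x y :- con 1ℚ) ≡.refl C D x y)
        (0≤p+q (0≤p+q (0≤p*q 0≤C² 0≤r) (0≤p*q (0≤p+q 0≤x 0≤x) (0≤/1 {c} {d} 0≤cd))) 0≤D²-1)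
      certificate (inj₂ (cd≤0 , inj₁ h)) = ≡.subst (0ℚ ℚ.≤_)
        (solve 4 (λ c d x y → (x :* x :+ y :* y :- (x :+ x)) :* (con 0ℚ :- c :* d)
             :+ (x :* x :+ y :* y) :* (c :* (c :+ d)) :+ (d :* d :- con 1ℚ)
          := formᴾ c d x y :- con 1ℚ) ≡.refl C D x y)
        (0≤p+q (0≤p+q (0≤p*q 0≤r-2x (0≤-CD cd≤0))
          (0≤p*q 0≤r (≡.subst (λ e → 0ℚ ℚ.≤ C ℚ.* e) (/1-+ c d) (0≤/1 {c} {c ℤ.+ d} h)))) 0≤D²-1)
      certificate (inj₂ (cd≤0 , inj₂ h)) = ≡.subst (0ℚ ℚ.≤_)
        (solve 4 (λ c d x y → c :* c :* (x :* x :+ y :* y) :+ (con 1ℚ :- (x :+ x)) :* (con 0ℚ :- c :* d)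
             :+ (d :* (c :+ d) :- con 1ℚ)
          := formᴾ c d x y :- con 1ℚ) ≡.refl C D x y)
        (0≤p+q (0≤p+q (0≤p*q 0≤C² 0≤r) (0≤p*q 0≤1-2x (0≤-CD cd≤0)))
          (0≤q-p (≡.subst (λ e → 1ℚ ℚ.≤ D ℚ.* e) (/1-+ c d) (1≤/1 {d} {c ℤ.+ d} h))))

    -- Both 1 and y² are lower bounds for the form, so y ≤ (1 + y²)/2 is one.
    near-classification : ∀ c d {Y} → 1ℚ ℚ.< Y → Y ℚ.* form c d x y ℚ.< y → c ≡ ℤ.0ℤ ⊎ d ≡ ℤ.0ℤ
    near-classification c d {Y} 1<Y near with c ℤ.≟ ℤ.0ℤ | d ℤ.≟ ℤ.0ℤ
    ... | yes c≡0 | _ = inj₁ c≡0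
    ... | no _ | yes d≡0 = inj₂ d≡0
    ... | no c≢0 | no d≢0 = ⊥-elim (ℚ.<-irrefl ≡.refl (≡.subst (0ℚ ℚ.<_)
        (solve 3 (λ N y Y →
            (y :- Y :* N) :+ (y :- Y :* N) :+ (((Y :- con 1ℚ) :* N :+ (Y :- con 1ℚ) :* N)
              :+ (N :- con 1ℚ) :+ (N :- y :* y) :+ (con 1ℚ :- y) :* (con 1ℚ :- y)) := con 0ℚ)
          ≡.refl (form c d x y) y Y)
        (0<p+≤q (0<p+q (0<q-p near) (0<q-p near))
          (0≤p+q (0≤p+q (0≤p+q (0≤p+q 0≤ 0≤) (0≤q-p 1≤N)) 0≤N-y²) (0≤p*p (1ℚ ℚ.- y))))))
      where
      1≤N = 1≤form c d c≢0 d≢0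
      0≤ = 0≤p*q (0≤q-p (ℚ.<⇒≤ 1<Y)) (ℚ.≤-trans (ℚ.<⇒≤ (ℚ.positive⁻¹ 1ℚ)) 1≤N)
      0≤N-y² : 0ℚ ℚ.≤ form c d x y ℚ.- y ℚ.* y
      0≤N-y² = ≡.subst (0ℚ ℚ.≤_)
        (solve 4 (λ c d x y → (c :* x :+ d) :* (c :* x :+ d) :+ (c :* c :- con 1ℚ) :* (y :* y)
          := formᴾ c d x y :- y :* y) ≡.refl (c ℚ./ 1) (d ℚ./ 1) x y)
        (0≤p+q (0≤p*p (c ℚ./ 1 ℚ.* x ℚ.+ d ℚ./ 1)) (0≤p*q (0≤q-p (1≤i² c≢0)) (0≤p*p y)))

  -- No point lies near both of the ideal vertices ∞ and 0.
  near-exclusive : ∀ {x y Y} → 1ℚ ℚ.< Y →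
    Y ℚ.* form ℤ.0ℤ ℤ.1ℤ x y ℚ.< y → Y ℚ.* form ℤ.1ℤ ℤ.0ℤ x y ℚ.< y → ⊥
  near-exclusive {x} {y} {Y} 1<Y h k = ℚ.<-irrefl ≡.refl (≡.subst (0ℚ ℚ.<_)
    (solve 3 (λ x y Y →
        (y :- Y :* formᴾ (con 0ℚ) (con 1ℚ) x y) :* y :+ (y :- Y :* formᴾ (con 1ℚ) (con 0ℚ) x y)
        :+ ((Y :- con 1ℚ) :* (x :* x :+ y :* y) :+ x :* x :+ (Y :- con 1ℚ) :* y) := con 0ℚ)
      ≡.refl x y Y)
    (0<p+≤q (0<p+q (0<p*q (0<q-p h) 0<y) (0<q-p k))
      (0≤p+q (0≤p+q (0≤p*q 0≤Y-1 (0≤p+q (0≤p*p x) (0≤p*p y))) (0≤p*p x)) (0≤p*q 0≤Y-1 (ℚ.<⇒≤ 0<y)))))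
    where
    0≤Y-1 = 0≤q-p (ℚ.<⇒≤ 1<Y)
    0<y : 0ℚ ℚ.< y
    0<y = ℚ.<-trans (0<p*q (ℚ.<-trans (ℚ.positive⁻¹ 1ℚ) 1<Y) (ℚ.positive⁻¹ 1ℚ))
      (≡.subst (ℚ._< y) (solve 3 (λ x y Y → Y :* formᴾ (con 0ℚ) (con 1ℚ) x y := Y :* con 1ℚ) ≡.refl x y Y) h)

-- Complex arithmetic and Möbius transformations.

module Möbius where
  open HyperbolicPlane
  open Reals hiding (refl; sym; trans; setoid; +-congˡ; +-congʳ; *-congˡ; *-congʳ; +-cong; *-cong)
  private
    module R = CommutativeRing ℝ-commutativeRing
    module F = RingMorphisms.IsRingHomomorphism fromℤ-isRingHomomorphism
  open PSL₂-Definitions ℤ.+-*-commutativeRing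
    using (module SL₂; _·_; I; adj; neg; _≋_; mk≋; _≈±_)

  infix 8 -ᶜ_
  -ᶜ_ : ℂ → ℂ
  -ᶜ z = (- re z) +i (- im z)

  ℂ-commutativeRing : CommutativeRing 0ℓ 0ℓ
  ℂ-commutativeRing = record
    { Carrier = ℂ
    ; _≈_ = _≈ᶜ_
    ; _+_ = _+ᶜ_
    ; _*_ = _*ᶜ_
    ; -_  = -ᶜ_
    ; 0#  = 0ℝ +i 0ℝ
    ; 1#  = 1ℝ +i 0ℝ
    ; isCommutativeRing = record
      { isRing = record
        { +-isAbelianGroup = record
          { isGroup = record
            { isMonoid = record
              { isSemigroup = record
                { isMagma = record
                  { isEquivalence = record
                    { refl = R.refl , R.refl
                    ; sym = λ (p , q) → R.sym p , R.sym q
                    ; trans = λ (p , q) (p′ , q′) → R.trans p p′ , R.trans q q′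
                    }
                  ; ∙-cong = λ (p , q) (p′ , q′) → R.+-cong p p′ , R.+-cong q q′
                  }
                ; assoc = λ x y z → R.+-assoc (re x) (re y) (re z) , R.+-assoc (im x) (im y) (im z)
                }
              ; identity = (λ x → R.+-identityˡ (re x) , R.+-identityˡ (im x))
                         , (λ x → R.+-identityʳ (re x) , R.+-identityʳ (im x))
              }
            ; inverse = (λ x → R.-‿inverseˡ (re x) , R.-‿inverseˡ (im x))
                      , (λ x → R.-‿inverseʳ (re x) , R.-‿inverseʳ (im x))
            ; ⁻¹-cong = λ (p , q) → R.-‿cong p , R.-‿cong q
            }
          ; comm = λ x y → R.+-comm (re x) (re y) , R.+-comm (im x) (im y)
          }
        ; *-cong = λ (p , q) (p′ , q′) →
            R.+-cong (R.*-cong p p′) (R.-‿cong (R.*-cong q q′)) , R.+-cong (R.*-cong p q′) (R.*-cong q p′)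
        ; *-assoc = λ x y z →
            solve 6 (λ a b c d e f → (a :* c :- b :* d) :* e :- (a :* d :+ b :* c) :* f
              := a :* (c :* e :- d :* f) :- b :* (c :* f :+ d :* e)) R.refl
              (re x) (im x) (re y) (im y) (re z) (im z) ,
            solve 6 (λ a b c d e f → (a :* c :- b :* d) :* f :+ (a :* d :+ b :* c) :* e
              := a :* (c :* f :+ d :* e) :+ b :* (c :* e :- d :* f)) R.refl
              (re x) (im x) (re y) (im y) (re z) (im z)
        ; *-identity =
            (λ x → solve 2 (λ a b → con ℤ.1ℤ :* a :- con ℤ.0ℤ :* b := a) R.refl (re x) (im x) ,
                   solve 2 (λ a b → con ℤ.1ℤ :* b :+ con ℤ.0ℤ :* a := b) R.refl (re x) (im x)) ,
            (λ x → solve 2 (λ a b → a :* con ℤ.1ℤ :- b :* con ℤ.0ℤ := a) R.refl (re x) (im x) ,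
                   solve 2 (λ a b → a :* con ℤ.0ℤ :+ b :* con ℤ.1ℤ := b) R.refl (re x) (im x))
        ; distrib =
            (λ x y z →
              solve 6 (λ a b c d e f → a :* (c :+ e) :- b :* (d :+ f) := (a :* c :- b :* d) :+ (a :* e :- b :* f))
                R.refl (re x) (im x) (re y) (im y) (re z) (im z) ,
              solve 6 (λ a b c d e f → a :* (d :+ f) :+ b :* (c :+ e) := (a :* d :+ b :* c) :+ (a :* f :+ b :* e))
                R.refl (re x) (im x) (re y) (im y) (re z) (im z)) ,
            (λ x y z →
              solve 6 (λ a b c d e f → (c :+ e) :* a :- (d :+ f) :* b := (c :* a :- d :* b) :+ (e :* a :- f :* b))
                R.refl (re x) (im x) (re y) (im y) (re z) (im z) ,
              solve 6 (λ a b c d e f → (c :+ e) :* b :+ (d :+ f) :* a := (c :* b :+ d :* a) :+ (e :* b :+ f :* a))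
                R.refl (re x) (im x) (re y) (im y) (re z) (im z))
        }
      ; *-comm = λ x y →
          solve 4 (λ a b c d → a :* c :- b :* d := c :* a :- d :* b) R.refl (re x) (im x) (re y) (im y) ,
          solve 4 (λ a b c d → a :* d :+ b :* c := c :* b :+ d :* a) R.refl (re x) (im x) (re y) (im y)
      }
    }
    where open ℝ-Solver

  open CommutativeRing ℂ-commutativeRing
    using (rawRing; setoid; refl; sym; trans; +-cong; +-congˡ; +-congʳ; *-congˡ; *-congʳ)

  ℤ→ℂ-isRingHomomorphism : RingMorphisms.IsRingHomomorphism
    (CommutativeRing.rawRing ℤ.+-*-commutativeRing) rawRing ℤ→ℂ
  ℤ→ℂ-isRingHomomorphism = record
    { isSemiringHomomorphism = record
      { isNearSemiringHomomorphism = record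
        { +-isMonoidHomomorphism = record
          { isMagmaHomomorphism = record
            { isRelHomomorphism = record { cong = λ { ≡.refl → refl } }
            ; homo = λ i j → F.+-homo i j , R.sym (R.+-identityˡ 0ℝ)
            }
          ; ε-homo = F.0#-homo , R.refl
          }
        ; *-homo = λ i j →
            R.trans (F.*-homo i j) (solve 2 (λ a b → a :* b := a :* b :- con ℤ.0ℤ :* con ℤ.0ℤ) R.refl (fromℤ i) (fromℤ j)) ,
            solve 2 (λ a b → con ℤ.0ℤ := a :* con ℤ.0ℤ :+ con ℤ.0ℤ :* b) R.refl (fromℤ i) (fromℤ j)
        }
      ; 1#-homo = F.1#-homo , R.refl
      }
    ; -‿homo = λ i → F.-‿homo i , solve 0 (con ℤ.0ℤ := :- con ℤ.0ℤ) R.refl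
    }
    where open ℝ-Solver

  module ℂ-Solver = ℤ-Solver ℂ-commutativeRing ℤ→ℂ-isRingHomomorphism
  private module G = RingMorphisms.IsRingHomomorphism ℤ→ℂ-isRingHomomorphism

  private
    dot : ∀ x y z w → ℤ→ℂ (x ℤ.* y ℤ.+ z ℤ.* w) ≈ᶜ ℤ→ℂ x *ᶜ ℤ→ℂ y +ᶜ ℤ→ℂ z *ᶜ ℤ→ℂ w
    dot x y z w = trans (G.+-homo (x ℤ.* y) (z ℤ.* w)) (+-cong (G.*-homo x y) (G.*-homo z w))

  ↦-resp : ∀ {A B z w} → A ≋ B → A · z ↦ w → B · z ↦ w
  ↦-resp {A} {B} {z} {w} (mk≋ ea eb ec ed) h = trans
    (*-congʳ {point w} (+-cong (*-congʳ {point z} (G.⟦⟧-cong (≡.sym ec))) (G.⟦⟧-cong (≡.sym ed))))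
    (trans h (+-cong (*-congʳ {point z} (G.⟦⟧-cong ea)) (G.⟦⟧-cong eb)))

  ↦-neg : ∀ {A z w} → A · z ↦ w → neg A · z ↦ w
  ↦-neg {A} {z} {w} h = trans
    (*-congʳ {point w} (+-cong (*-congʳ {point z} (G.-‿homo (SL₂.c A))) (G.-‿homo (SL₂.d A))))
    (trans (solve 4 (λ c d z w → (:- c :* z :+ :- d) :* w := :- ((c :* z :+ d) :* w)) refl c d (point z) (point w))
    (trans (CommutativeRing.-‿cong ℂ-commutativeRing h)
    (trans (solve 3 (λ a b z → :- (a :* z :+ b) := :- a :* z :+ :- b) refl a b (point z))
    (sym (+-cong (*-congʳ {point z} (G.-‿homo (SL₂.a A))) (G.-‿homo (SL₂.b A)))))))
    where
    open ℂ-Solver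
    a = ℤ→ℂ (SL₂.a A) ; b = ℤ→ℂ (SL₂.b A) ; c = ℤ→ℂ (SL₂.c A) ; d = ℤ→ℂ (SL₂.d A)

  ↦-resp± : ∀ {A B z w} → A ≈± B → A · z ↦ w → B · z ↦ w
  ↦-resp± {A} {B} {z} {w} (inj₁ e) h = ↦-resp {A} {B} {z} {w} e h
  ↦-resp± {A} {B} {z} {w} (inj₂ e) h =
    ↦-resp {neg (neg B)} {B} {z} {w} (PSL₂-Definitions.neg-neg ℤ.+-*-commutativeRing B)
      (↦-neg {neg B} {z} {w} (↦-resp {A} {neg B} {z} {w} e h))

  -- Denominators are cleared, so no division occurs: with e = c″z + d″, the denominator of B at z,
  -- the terms are regrouped until v occurs only in ev, which is the numerator of B at z.
  ↦-· : ∀ {A B z v w} → B · z ↦ v → A · v ↦ w → (A · B) · z ↦ w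
  ↦-· {A} {B} {z} {v} {w} h k = begin
    (ℤ→ℂ (A.c ℤ.* B.a ℤ.+ A.d ℤ.* B.c) *ᶜ z′ +ᶜ ℤ→ℂ (A.c ℤ.* B.b ℤ.+ A.d ℤ.* B.d)) *ᶜ w′
      ≈⟨ *-congʳ {w′} (+-cong (*-congʳ {z′} (dot A.c B.a A.d B.c)) (dot A.c B.b A.d B.d)) ⟩
    ((c *ᶜ a″ +ᶜ d *ᶜ c″) *ᶜ z′ +ᶜ (c *ᶜ b″ +ᶜ d *ᶜ d″)) *ᶜ w′
      ≈⟨ solve 8 (λ a b c d c′ d′ z w → ((c′ :* a :+ d′ :* c) :* z :+ (c′ :* b :+ d′ :* d)) :* w
                   := (c′ :* (a :* z :+ b) :+ d′ :* (c :* z :+ d)) :* w) refl a″ b″ c″ d″ c d z′ w′ ⟩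
    (c *ᶜ (a″ *ᶜ z′ +ᶜ b″) +ᶜ d *ᶜ (c″ *ᶜ z′ +ᶜ d″)) *ᶜ w′
      ≈⟨ *-congʳ {w′} (+-congʳ {d *ᶜ (c″ *ᶜ z′ +ᶜ d″)} (*-congˡ {c} h)) ⟨
    (c *ᶜ ((c″ *ᶜ z′ +ᶜ d″) *ᶜ v′) +ᶜ d *ᶜ (c″ *ᶜ z′ +ᶜ d″)) *ᶜ w′
      ≈⟨ solve 5 (λ c d e v w → (c :* (e :* v) :+ d :* e) :* w := e :* ((c :* v :+ d) :* w)) refl c d (c″ *ᶜ z′ +ᶜ d″) v′ w′ ⟩
    (c″ *ᶜ z′ +ᶜ d″) *ᶜ ((c *ᶜ v′ +ᶜ d) *ᶜ w′)
      ≈⟨ *-congˡ {c″ *ᶜ z′ +ᶜ d″} k ⟩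
    (c″ *ᶜ z′ +ᶜ d″) *ᶜ (a *ᶜ v′ +ᶜ b)
      ≈⟨ solve 4 (λ a b e v → e :* (a :* v :+ b) := a :* (e :* v) :+ b :* e) refl a b (c″ *ᶜ z′ +ᶜ d″) v′ ⟩
    a *ᶜ ((c″ *ᶜ z′ +ᶜ d″) *ᶜ v′) +ᶜ b *ᶜ (c″ *ᶜ z′ +ᶜ d″)
      ≈⟨ +-congʳ {b *ᶜ (c″ *ᶜ z′ +ᶜ d″)} (*-congˡ {a} h) ⟩
    a *ᶜ (a″ *ᶜ z′ +ᶜ b″) +ᶜ b *ᶜ (c″ *ᶜ z′ +ᶜ d″)
      ≈⟨ solve 7 (λ a b a′ b′ c′ d′ z → a :* (a′ :* z :+ b′) :+ b :* (c′ :* z :+ d′)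
                    := (a :* a′ :+ b :* c′) :* z :+ (a :* b′ :+ b :* d′)) refl a b a″ b″ c″ d″ z′ ⟩
    (a *ᶜ a″ +ᶜ b *ᶜ c″) *ᶜ z′ +ᶜ (a *ᶜ b″ +ᶜ b *ᶜ d″)
      ≈⟨ +-cong (*-congʳ {z′} (dot A.a B.a A.b B.c)) (dot A.a B.b A.b B.d) ⟨
    ℤ→ℂ (A.a ℤ.* B.a ℤ.+ A.b ℤ.* B.c) *ᶜ z′ +ᶜ ℤ→ℂ (A.a ℤ.* B.b ℤ.+ A.b ℤ.* B.d) ∎
    where
    open SetoidReasoning setoid
    open ℂ-Solver
    module A = SL₂ A
    module B = SL₂ B
    z′ = point z ; v′ = point v ; w′ = point w
    a = ℤ→ℂ A.a ; b = ℤ→ℂ A.b ; c = ℤ→ℂ A.c ; d = ℤ→ℂ A.d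
    a″ = ℤ→ℂ B.a ; b″ = ℤ→ℂ B.b ; c″ = ℤ→ℂ B.c ; d″ = ℤ→ℂ B.d

  ↦-adj : ∀ {A z w} → A · z ↦ w → adj A · w ↦ z
  ↦-adj {A} {z} {w} h = begin
    (ℤ→ℂ (ℤ.- A.c) *ᶜ w′ +ᶜ a) *ᶜ z′
      ≈⟨ *-congʳ {z′} (+-congʳ {a} (*-congʳ {w′} (G.-‿homo A.c))) ⟩
    (-ᶜ c *ᶜ w′ +ᶜ a) *ᶜ z′
      ≈⟨ solve 5 (λ a b c z w → (:- c :* w :+ a) :* z := (a :* z :+ b) :+ (:- (c :* z :* w) :- b)) refl a b c z′ w′ ⟩
    (a *ᶜ z′ +ᶜ b) +ᶜ (-ᶜ (c *ᶜ z′ *ᶜ w′) +ᶜ -ᶜ b)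
      ≈⟨ +-congʳ {(-ᶜ (c *ᶜ z′ *ᶜ w′)) +ᶜ -ᶜ b} h ⟨
    (c *ᶜ z′ +ᶜ d) *ᶜ w′ +ᶜ (-ᶜ (c *ᶜ z′ *ᶜ w′) +ᶜ -ᶜ b)
      ≈⟨ solve 5 (λ b c d z w → (c :* z :+ d) :* w :+ (:- (c :* z :* w) :- b) := d :* w :- b) refl b c d z′ w′ ⟩
    d *ᶜ w′ +ᶜ -ᶜ b
      ≈⟨ +-congˡ {d *ᶜ w′} (G.-‿homo A.b) ⟨
    d *ᶜ w′ +ᶜ ℤ→ℂ (ℤ.- A.b) ∎
    where
    open SetoidReasoning setoid
    open ℂ-Solver
    module A = SL₂ A
    z′ = point z ; w′ = point w
    a = ℤ→ℂ A.a ; b = ℤ→ℂ A.b ; c = ℤ→ℂ A.c ; d = ℤ→ℂ A.d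

  ↦-I : ∀ z → I · z ↦ z
  ↦-I z = solve 1 (λ z → (con ℤ.0ℤ :* z :+ con ℤ.1ℤ) :* z := con ℤ.1ℤ :* z :+ con ℤ.0ℤ) refl (point z)
    where open ℂ-Solver

i*j≡1⇒ : ∀ i j → i ℤ.* j ≡ ℤ.1ℤ → (i ≡ ℤ.1ℤ × j ≡ ℤ.1ℤ) ⊎ (i ≡ ℤ.-1ℤ × j ≡ ℤ.-1ℤ)
i*j≡1⇒ i j eq = cases i j (ℕ.m*n≡1⇒m≡1 ℤ.∣ i ∣ ℤ.∣ j ∣ ∣eq∣) (ℕ.m*n≡1⇒n≡1 ℤ.∣ i ∣ ℤ.∣ j ∣ ∣eq∣) eq
  where
  ∣eq∣ : ℤ.∣ i ∣ ℕ.* ℤ.∣ j ∣ ≡ 1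
  ∣eq∣ = ≡.trans (≡.sym (ℤ.abs-* i j)) (≡.cong ℤ.∣_∣ eq)
  cases : ∀ i j → ℤ.∣ i ∣ ≡ 1 → ℤ.∣ j ∣ ≡ 1 → i ℤ.* j ≡ ℤ.1ℤ →
          (i ≡ ℤ.1ℤ × j ≡ ℤ.1ℤ) ⊎ (i ≡ ℤ.-1ℤ × j ≡ ℤ.-1ℤ)
  cases (ℤ.+ 1) (ℤ.+ 1) ≡.refl ≡.refl _ = inj₁ (≡.refl , ≡.refl)
  cases (ℤ.+ 1) (ℤ.-[1+ 0 ]) ≡.refl ≡.refl ()
  cases (ℤ.-[1+ 0 ]) (ℤ.+ 1) ≡.refl ≡.refl ()
  cases (ℤ.-[1+ 0 ]) (ℤ.-[1+ 0 ]) ≡.refl ≡.refl _ = inj₂ (≡.refl , ≡.refl)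

-- Heights and horoballs under the action.

module Action where
  open HyperbolicPlane
  open Reals
  open Integers
  open Möbius
  open ℝ-Solver
  open PSL₂-Definitions ℤ.+-*-commutativeRing
    using (module SL₂; _·_; adj; mk≋; _≈±_)
  private
    module R = CommutativeRing ℝ-commutativeRing
    module F = RingMorphisms.IsRingHomomorphism fromℤ-isRingHomomorphism

  form : ℤ → ℤ → ℍ → ℝ
  form c d z = ∣ ℤ→ℂ c *ᶜ point z +ᶜ ℤ→ℂ d ∣²

  -- If c ≠ 0, the imaginary part cy of cz + d is nonzero; if c = 0, the determinant makes d nonzero
  -- and the form is d².
  0<form : ∀ A z → 0ℝ < form (SL₂.c A) (SL₂.d A) z
  0<form A z with SL₂.c A ℤ.≟ ℤ.0ℤ
  ... | no c≢0 = 0<x*x+y (re (ℤ→ℂ c *ᶜ point z +ᶜ ℤ→ℂ (SL₂.d A))) (<-respʳ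
          (solve 3 (λ c x y → (c :* c) :* (y :* y) := (c :* y :+ con ℤ.0ℤ :* x :+ con ℤ.0ℤ) :* (c :* y :+ con ℤ.0ℤ :* x :+ con ℤ.0ℤ))
            refl (fromℤ c) (re (point z)) (im (point z)))
          (0<x*y (<-respʳ (F.*-homo c c) (fromℤ-mono-< (0<i*i c≢0))) (0<x*y (im>0 z) (im>0 z))))
    where c = SL₂.c A
  ... | yes c≡0 = <-respʳ
          (trans (F.*-homo d d)
            (trans (solve 3 (λ d x y → d :* d :=
                (con ℤ.0ℤ :* x :- con ℤ.0ℤ :* y :+ d) :* (con ℤ.0ℤ :* x :- con ℤ.0ℤ :* y :+ d)
                :+ (con ℤ.0ℤ :* y :+ con ℤ.0ℤ :* x :+ con ℤ.0ℤ) :* (con ℤ.0ℤ :* y :+ con ℤ.0ℤ :* x :+ con ℤ.0ℤ))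
              refl (fromℤ d) (re (point z)) (im (point z)))
            (R.reflexive (≡.cong (λ c → form c d z) (≡.sym c≡0)))))
          (fromℤ-mono-< (0<i*i d≢0))
    where
    d = SL₂.d A
    zero′ : ∀ a b → a ℤ.* ℤ.0ℤ ℤ.- b ℤ.* ℤ.0ℤ ≡ ℤ.0ℤ
    zero′ a b = ≡.cong₂ ℤ._-_ (ℤ.*-zeroʳ a) (ℤ.*-zeroʳ b)
    d≢0 : d ≢ ℤ.0ℤ
    d≢0 d≡0 with () ← ≡.trans (≡.sym (SL₂.det A)) (≡.trans
        (≡.cong₂ (λ c d → SL₂.a A ℤ.* d ℤ.- SL₂.b A ℤ.* c) c≡0 d≡0)
        (zero′ (SL₂.a A) (SL₂.b A)))

  module _ (A : SL₂ℤ) (z : ℍ) where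
    private
      module A = SL₂ A
      x = re (point z) ; y = im (point z)
      a = fromℤ A.a ; b = fromℤ A.b ; c = fromℤ A.c ; d = fromℤ A.d
      num′ = ℤ→ℂ A.a *ᶜ point z +ᶜ ℤ→ℂ A.b
      den′ = ℤ→ℂ A.c *ᶜ point z +ᶜ ℤ→ℂ A.d
      N = form A.c A.d z

      im-num*conj-den : re den′ * im num′ - im den′ * re num′ ≈ y
      im-num*conj-den = trans
        (solve 6 (λ a b c d x y →
            (c :* x :- con ℤ.0ℤ :* y :+ d) :* (a :* y :+ con ℤ.0ℤ :* x :+ con ℤ.0ℤ)
            :- (c :* y :+ con ℤ.0ℤ :* x :+ con ℤ.0ℤ) :* (a :* x :- con ℤ.0ℤ :* y :+ b)
            := (a :* d :- b :* c) :* y) refl a b c d x y)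
        (trans (*-congʳ (PSL₂-Definitions.SL₂.det (ι A))) (R.*-identityˡ y))

    -- The classical Im(Az) = Im z / |cz + d|². It comes from the product of az + b with the
    -- conjugate of cz + d, whose imaginary part is (ad - bc) Im z.
    form*im : ∀ {w} → A · z ↦ w → N * im (point w) ≈ y
    form*im {w} (hre , him) = trans
      (solve 4 (λ p q u v → (p :* p :+ q :* q) :* v := p :* (p :* v :+ q :* u) :- q :* (p :* u :- q :* v))
        refl (re den′) (im den′) (re (point w)) (im (point w)))
      (trans (+-cong (*-congˡ him) (-‿cong (*-congˡ hre))) im-num*conj-den)

    -- The quotient (az + b)/(cz + d), formed with the conjugate of the denominator.
    act : ℍ
    act = mkℍ
      ((inv (0<form A z) * (re den′ * re num′ + im den′ * im num′))
        +i (inv (0<form A z) * (re den′ * im num′ - im den′ * re num′)))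
      (0<x*y (0<inv (0<form A z)) (<-respʳ (sym im-num*conj-den) (im>0 z)))

    act-↦ : A · z ↦ act
    act-↦ =
      trans (solve 5 (λ p q r s i → p :* (i :* (p :* r :+ q :* s)) :- q :* (i :* (p :* s :- q :* r))
              := ((p :* p :+ q :* q) :* i) :* r) refl (re den′) (im den′) (re num′) (im num′) (inv (0<form A z)))
        (trans (*-congʳ (x*inv (0<form A z))) (R.*-identityˡ _)) ,
      trans (solve 5 (λ p q r s i → p :* (i :* (p :* s :- q :* r)) :+ q :* (i :* (p :* r :+ q :* s))
              := ((p :* p :+ q :* q) :* i) :* s) refl (re den′) (im den′) (re num′) (im num′) (inv (0<form A z)))
        (trans (*-congʳ (x*inv (0<form A z))) (R.*-identityˡ _))

  -- By `form*im` this is Im(Az) > Y. Stated through the bottom row of A, it needs no name for the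
  -- point Az and is visibly unchanged when A is multiplied by a translation on the left.
  Near : SL₂ℤ → ℝ → ℍ → Set
  Near A Y z = Y * form (SL₂.c A) (SL₂.d A) z < im (point z)

  ∣∣²-cong : ∀ {z w} → z ≈ᶜ w → ∣ z ∣² ≈ ∣ w ∣²
  ∣∣²-cong (p , q) = +-cong (*-cong p p) (*-cong q q)

  Near-resp± : ∀ {A B Y z} → A ≈± B → Near A Y z → Near B Y z
  Near-resp± {A} {B} {Y} {z} e = <-respˡ (*-congˡ (form-resp e))
    where
    x = re (point z) ; y = im (point z)
    form-resp : A ≈± B → form (SL₂.c A) (SL₂.d A) z ≈ form (SL₂.c B) (SL₂.d B) z
    form-resp (inj₁ (mk≋ _ _ c≡ d≡)) = R.reflexive (≡.cong₂ (λ c d → form c d z) c≡ d≡)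
    form-resp (inj₂ (mk≋ _ _ c≡ d≡)) = trans (R.reflexive (≡.cong₂ (λ c d → form c d z) c≡ d≡))
      (trans (+-cong (*-cong e₁ e₁) (*-cong e₂ e₂))
        (solve 4 (λ c d x y →
            (:- c :* x :- con ℤ.0ℤ :* y :+ :- d) :* (:- c :* x :- con ℤ.0ℤ :* y :+ :- d)
            :+ (:- c :* y :+ con ℤ.0ℤ :* x :+ con ℤ.0ℤ) :* (:- c :* y :+ con ℤ.0ℤ :* x :+ con ℤ.0ℤ)
            := (c :* x :- con ℤ.0ℤ :* y :+ d) :* (c :* x :- con ℤ.0ℤ :* y :+ d)
            :+ (c :* y :+ con ℤ.0ℤ :* x :+ con ℤ.0ℤ) :* (c :* y :+ con ℤ.0ℤ :* x :+ con ℤ.0ℤ))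
          refl (fromℤ (SL₂.c B)) (fromℤ (SL₂.d B)) x y))
      where
      e₁ = +-cong (+-congʳ {(- (0ℝ * y))} (*-congʳ {x} (F.-‿homo (SL₂.c B)))) (F.-‿homo (SL₂.d B))
      e₂ = +-congʳ {0ℝ} (+-congʳ {0ℝ * x} (*-congʳ {y} (F.-‿homo (SL₂.c B))))

  module _ {x : ℚ∞} {σ : SL₂ℤ} (a≡ : SL₂.a σ ≡ num x) (c≡ : SL₂.c σ ≡ den x)
           (γ : SL₂ℤ) {Y : ℝ} {z w : ℍ} (z↦w : γ · z ↦ w) where
    private
      module σ = SL₂ σ
      module γ = SL₂ γ
      module δ = SL₂ (adj σ · γ)
      module ℂR = CommutativeRing ℂ-commutativeRing
      module S = ℂ-Solver
      module G = RingMorphisms.IsRingHomomorphism ℤ→ℂ-isRingHomomorphism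
      N = form γ.c γ.d z
      M = ∣ ℤ→ℂ (den x) *ᶜ point w +ᶜ ℤ→ℂ (ℤ.- num x) ∣²
      z′ = point z ; w′ = point w
      a = ℤ→ℂ γ.a ; b = ℤ→ℂ γ.b ; c = ℤ→ℂ γ.c ; d = ℤ→ℂ γ.d ; n = ℤ→ℂ σ.a ; m = ℤ→ℂ σ.c

      ∣∣²-* : ∀ z w → ∣ z ∣² * ∣ w ∣² ≈ ∣ -ᶜ (z *ᶜ w) ∣²
      ∣∣²-* z w = solve 4 (λ a b c d → (a :* a :+ b :* b) :* (c :* c :+ d :* d)
          := :- (a :* c :- b :* d) :* :- (a :* c :- b :* d) :+ :- (a :* d :+ b :* c) :* :- (a :* d :+ b :* c))
        refl (re z) (im z) (re w) (im w)

      row : ∀ i j → ℤ→ℂ (ℤ.- σ.c ℤ.* i ℤ.+ σ.a ℤ.* j) ≈ᶜ -ᶜ m *ᶜ ℤ→ℂ i +ᶜ n *ᶜ ℤ→ℂ j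
      row i j = ℂR.trans (G.+-homo (ℤ.- σ.c ℤ.* i) (σ.a ℤ.* j)) (ℂR.+-cong
        (ℂR.trans (G.*-homo (ℤ.- σ.c) i) (ℂR.*-congʳ {ℤ→ℂ i} (G.-‿homo σ.c))) (G.*-homo σ.a j))

      -- The cocycle rule for the denominator of σ⁻¹γ. The bottom row of σ⁻¹ is (-q, p) for the cusp
      -- p/q, while the horoball is written with qw - p; hence the minus sign.
      denominators : -ᶜ ((c *ᶜ z′ +ᶜ d) *ᶜ (ℤ→ℂ (den x) *ᶜ w′ +ᶜ ℤ→ℂ (ℤ.- num x)))
                     ≈ᶜ ℤ→ℂ δ.c *ᶜ z′ +ᶜ ℤ→ℂ δ.d
      denominators = begin
        -ᶜ ((c *ᶜ z′ +ᶜ d) *ᶜ (ℤ→ℂ (den x) *ᶜ w′ +ᶜ ℤ→ℂ (ℤ.- num x)))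
          ≡⟨ ≡.cong₂ (λ i j → -ᶜ ((c *ᶜ z′ +ᶜ d) *ᶜ (ℤ→ℂ i *ᶜ w′ +ᶜ ℤ→ℂ (ℤ.- j)))) c≡ a≡ ⟨
        -ᶜ ((c *ᶜ z′ +ᶜ d) *ᶜ (m *ᶜ w′ +ᶜ ℤ→ℂ (ℤ.- σ.a)))
          ≈⟨ ℂR.-‿cong (ℂR.*-congˡ {c *ᶜ z′ +ᶜ d} (ℂR.+-congˡ {m *ᶜ w′} (G.-‿homo σ.a))) ⟩
        -ᶜ ((c *ᶜ z′ +ᶜ d) *ᶜ (m *ᶜ w′ +ᶜ -ᶜ n))
          ≈⟨ S.solve 4 (λ e m n w → S.:- (e S.:* (m S.:* w S.:+ S.:- n)) S.:= S.:- m S.:* (e S.:* w) S.:+ n S.:* e) ℂR.refl (c *ᶜ z′ +ᶜ d) m n w′ ⟩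
        -ᶜ m *ᶜ ((c *ᶜ z′ +ᶜ d) *ᶜ w′) +ᶜ n *ᶜ (c *ᶜ z′ +ᶜ d)
          ≈⟨ ℂR.+-congʳ {n *ᶜ (c *ᶜ z′ +ᶜ d)} (ℂR.*-congˡ { -ᶜ m} z↦w) ⟩
        -ᶜ m *ᶜ (a *ᶜ z′ +ᶜ b) +ᶜ n *ᶜ (c *ᶜ z′ +ᶜ d)
          ≈⟨ S.solve 7 (λ a b c d m n z → S.:- m S.:* (a S.:* z S.:+ b) S.:+ n S.:* (c S.:* z S.:+ d)
               S.:= (S.:- m S.:* a S.:+ n S.:* c) S.:* z S.:+ (S.:- m S.:* b S.:+ n S.:* d)) ℂR.refl a b c d m n z′ ⟩
        (-ᶜ m *ᶜ a +ᶜ n *ᶜ c) *ᶜ z′ +ᶜ (-ᶜ m *ᶜ b +ᶜ n *ᶜ d)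
          ≈⟨ ℂR.+-cong (ℂR.*-congʳ {z′} (row γ.a γ.c)) (row γ.b γ.d) ⟨
        ℤ→ℂ δ.c *ᶜ z′ +ᶜ ℤ→ℂ δ.d ∎
        where open SetoidReasoning ℂR.setoid

      form-δ : N * M ≈ form δ.c δ.d z
      form-δ = trans (∣∣²-* (c *ᶜ z′ +ᶜ d) (ℤ→ℂ (den x) *ᶜ w′ +ᶜ ℤ→ℂ (ℤ.- num x))) (∣∣²-cong denominators)

      scale : N * (Y * M) ≈ Y * form δ.c δ.d z
      scale = trans (solve 3 (λ N Y M → N :* (Y :* M) := Y :* (N :* M)) refl N Y M) (*-congˡ form-δ)

    -- As σ takes ∞ to the cusp, the horoball is the image of Im > Y under σ, so the question is how
    -- high σ⁻¹γz lies. Multiplying by |cz + d|² for the bottom row of γ replaces Im w by Im z and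
    -- gives the form of σ⁻¹γ on the other side.
    horoball⇒Near : w ∈ horoball x Y → Near (adj σ · γ) Y z
    horoball⇒Near h = <-respˡ scale (<-respʳ (form*im γ z {w} z↦w) (*-monoʳ-< (0<form γ z) h))

    Near⇒horoball : Near (adj σ · γ) Y z → w ∈ horoball x Y
    Near⇒horoball h = *-cancelˡ-< (0<form γ z) (<-respˡ (sym scale) (<-respʳ (sym (form*im γ z {w} z↦w)) h))

-- Copies of the triangle with an end at ∞.

module Translations where
  open PSL₂-Definitions ℤ.+-*-commutativeRing
    using (module SL₂; _·_; _≋_; mk≋)
  open ℤ-RingSolver.+-*-Solver

  T : ℤ → SL₂ℤ
  T k .SL₂.a = ℤ.1ℤ
  T k .SL₂.b = k
  T k .SL₂.c = ℤ.0ℤ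
  T k .SL₂.d = ℤ.1ℤ
  T k .SL₂.det = solve 1 (λ k → con ℤ.1ℤ :* con ℤ.1ℤ :- k :* con ℤ.0ℤ := con ℤ.1ℤ) ≡.refl k

  TS : ℤ → SL₂ℤ
  TS k .SL₂.a = k
  TS k .SL₂.b = ℤ.-1ℤ
  TS k .SL₂.c = ℤ.1ℤ
  TS k .SL₂.d = ℤ.0ℤ
  TS k .SL₂.det = solve 1 (λ k → k :* con ℤ.0ℤ :- con ℤ.-1ℤ :* con ℤ.1ℤ := con ℤ.1ℤ) ≡.refl k

  S : SL₂ℤ
  S = TS ℤ.0ℤ

  T-· : ∀ A k → let open SL₂ (T k · A) in
    a ≡ SL₂.a A ℤ.+ k ℤ.* SL₂.c A × b ≡ SL₂.b A ℤ.+ k ℤ.* SL₂.d A × c ≡ SL₂.c A × d ≡ SL₂.d A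
  T-· A k = top a c , top b d , bottom a c , bottom b d
    where
    open SL₂ A
    top : ∀ x y → ℤ.1ℤ ℤ.* x ℤ.+ k ℤ.* y ≡ x ℤ.+ k ℤ.* y
    top x y = ≡.cong (ℤ._+ k ℤ.* y) (ℤ.*-identityˡ x)
    bottom : ∀ x y → ℤ.0ℤ ℤ.* x ℤ.+ ℤ.1ℤ ℤ.* y ≡ y
    bottom = solve 2 (λ x y → con ℤ.0ℤ :* x :+ con ℤ.1ℤ :* y := y) ≡.refl

  -- corner k e takes △ to the copy whose end at ∞ lies over the interval of
  -- length ½ to the right (e = false) or left (e = true) of k.
  corner : ℤ → Bool → SL₂ℤ
  corner k false = T k
  corner k true  = TS k

  T-corner : ∀ m k e → (T m · corner k e) ≋ corner (m ℤ.+ k) e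
  T-corner m k false = let p , q , r , s = T-· (T k) m in mk≋
    (≡.trans p (solve 1 (λ m → con ℤ.1ℤ :+ m :* con ℤ.0ℤ := con ℤ.1ℤ) ≡.refl m))
    (≡.trans q (solve 2 (λ m k → k :+ m :* con ℤ.1ℤ := m :+ k) ≡.refl m k)) r s
  T-corner m k true = let p , q , r , s = T-· (TS k) m in mk≋
    (≡.trans p (solve 2 (λ m k → k :+ m :* con ℤ.1ℤ := m :+ k) ≡.refl m k))
    (≡.trans q (solve 1 (λ m → con ℤ.-1ℤ :+ m :* con ℤ.0ℤ := con ℤ.-1ℤ) ≡.refl m)) r s

  -- The copy corner k e (△) lies over j/2 < Re < (j + 1)/2 for j = position k e.
  position : ℤ → Bool → ℤ
  position k false = k ℤ.+ k
  position k true  = ℤ.-1ℤ ℤ.+ (k ℤ.+ k)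

  position-translate : ∀ m k e → position (m ℤ.+ k) e ≡ (m ℤ.+ m) ℤ.+ position k e
  position-translate m k false = solve 2 (λ m k → (m :+ k) :+ (m :+ k) := (m :+ m) :+ (k :+ k)) ≡.refl m k
  position-translate m k true = solve 2 (λ m k → con ℤ.-1ℤ :+ ((m :+ k) :+ (m :+ k)) := (m :+ m) :+ (con ℤ.-1ℤ :+ (k :+ k))) ≡.refl m k

  private
    parityℕ : ∀ n → (∃ λ m → n ≡ m ℕ.+ m) ⊎ (∃ λ m → n ≡ ℕ.suc (m ℕ.+ m))
    parityℕ ℕ.zero = inj₁ (0 , ≡.refl)
    parityℕ (ℕ.suc n) with parityℕ n
    ... | inj₁ (m , eq) = inj₂ (m , ≡.cong ℕ.suc eq)
    ... | inj₂ (m , eq) = inj₁ (ℕ.suc m , ≡.trans (≡.cong ℕ.suc eq) (≡.cong ℕ.suc (≡.sym (ℕ.+-suc m m))))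

  position-surjective : ∀ j → ∃ λ k → ∃ λ e → position k e ≡ j
  position-surjective (ℤ.+ n) with parityℕ n
  ... | inj₁ (m , ≡.refl) = ℤ.+ m , false , ≡.refl
  ... | inj₂ (m , ≡.refl) = ℤ.+ ℕ.suc m , true , ≡.cong ℤ.+_ (ℕ.+-suc m m)
  position-surjective ℤ.-[1+ n ] with parityℕ n
  ... | inj₁ (m , ≡.refl) = ℤ.- (ℤ.+ m) , true ,
    solve 1 (λ m → con ℤ.-1ℤ :+ (:- m :+ :- m) := :- (con ℤ.1ℤ :+ (m :+ m))) ≡.refl (ℤ.+ m)
  ... | inj₂ (m , ≡.refl) = ℤ.-[1+ m ] , false , ≡.refl

  i+i≢1 : ∀ i → i ℤ.+ i ≢ ℤ.1ℤ
  i+i≢1 (ℤ.+[1+ n ]) eq with () ← ≡.trans (≡.sym (ℕ.+-suc n n)) (ℕ.suc-injective (ℤ.+-injective eq))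

  i+i-injective : ∀ {i j} → i ℤ.+ i ≡ j ℤ.+ j → i ≡ j
  i+i-injective {i} {j} eq = ℤ.*-cancelˡ-≡ (ℤ.+ 2) i j (≡.trans (2* i) (≡.trans eq (≡.sym (2* j))))
    where
    2* : ∀ i → ℤ.+ 2 ℤ.* i ≡ i ℤ.+ i
    2* = solve 1 (λ i → con (ℤ.+ 2) :* i := i :+ i) ≡.refl

  -- Positions are even for `false` and odd for `true`, so an even difference forces e = f, and
  -- halving it recovers the translation.
  position-difference : ∀ k e l f m → position k e ℤ.- position l f ≡ m ℤ.+ m → k ≡ m ℤ.+ l × e ≡ f
  position-difference k false l false m eq = i+i-injective (begin
    k ℤ.+ k                                  ≡⟨ solve 2 (λ k l → k :+ k := (k :+ k) :- (l :+ l) :+ (l :+ l)) ≡.refl k l ⟩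
    k ℤ.+ k ℤ.- (l ℤ.+ l) ℤ.+ (l ℤ.+ l)      ≡⟨ ≡.cong (ℤ._+ (l ℤ.+ l)) eq ⟩
    (m ℤ.+ m) ℤ.+ (l ℤ.+ l)                  ≡⟨ solve 2 (λ m l → (m :+ m) :+ (l :+ l) := (m :+ l) :+ (m :+ l)) ≡.refl m l ⟩
    (m ℤ.+ l) ℤ.+ (m ℤ.+ l)                  ∎) , ≡.refl
    where open ≡.≡-Reasoning
  position-difference k true l true m eq = proj₁ (position-difference k false l false m (≡.trans
    (solve 2 (λ k l → (k :+ k) :- (l :+ l) := con ℤ.-1ℤ :+ (k :+ k) :- (con ℤ.-1ℤ :+ (l :+ l))) ≡.refl k l) eq)) , ≡.refl
  position-difference k false l true m eq = ⊥-elim (i+i≢1 (m ℤ.+ l ℤ.- k) (begin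
    (m ℤ.+ l ℤ.- k) ℤ.+ (m ℤ.+ l ℤ.- k)
      ≡⟨ solve 3 (λ m l k → (m :+ l :- k) :+ (m :+ l :- k) := (m :+ m) :+ ((l :+ l) :- (k :+ k))) ≡.refl m l k ⟩
    (m ℤ.+ m) ℤ.+ ((l ℤ.+ l) ℤ.- (k ℤ.+ k))
      ≡⟨ ≡.cong (ℤ._+ ((l ℤ.+ l) ℤ.- (k ℤ.+ k))) eq ⟨
    (k ℤ.+ k) ℤ.- (ℤ.-1ℤ ℤ.+ (l ℤ.+ l)) ℤ.+ ((l ℤ.+ l) ℤ.- (k ℤ.+ k))
      ≡⟨ solve 2 (λ l k → (k :+ k) :- (con ℤ.-1ℤ :+ (l :+ l)) :+ ((l :+ l) :- (k :+ k)) := con ℤ.1ℤ) ≡.refl l k ⟩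
    ℤ.1ℤ ∎))
    where open ≡.≡-Reasoning
  position-difference k true l false m eq = ⊥-elim (i+i≢1 (k ℤ.- m ℤ.- l) (begin
    (k ℤ.- m ℤ.- l) ℤ.+ (k ℤ.- m ℤ.- l)
      ≡⟨ solve 3 (λ m l k → (k :- m :- l) :+ (k :- m :- l) := ((k :+ k) :- (l :+ l)) :- (m :+ m)) ≡.refl m l k ⟩
    ((k ℤ.+ k) ℤ.- (l ℤ.+ l)) ℤ.- (m ℤ.+ m)
      ≡⟨ ≡.cong (λ i → ((k ℤ.+ k) ℤ.- (l ℤ.+ l)) ℤ.- i) eq ⟨
    ((k ℤ.+ k) ℤ.- (l ℤ.+ l)) ℤ.- (ℤ.-1ℤ ℤ.+ (k ℤ.+ k) ℤ.- (l ℤ.+ l))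
      ≡⟨ solve 2 (λ l k → ((k :+ k) :- (l :+ l)) :- (con ℤ.-1ℤ :+ (k :+ k) :- (l :+ l)) := con ℤ.1ℤ) ≡.refl l k ⟩
    ℤ.1ℤ ∎))
    where open ≡.≡-Reasoning

module Ends where
  open HyperbolicPlane
  open Reals
  open Integers
  open Möbius
  open Action
  open Translations
  open ℝ-Solver
  open PSL₂-Definitions ℤ.+-*-commutativeRing
    using (module SL₂; _·_; mk≋; _≈±_)
  private
    module R = CommutativeRing ℝ-commutativeRing
    module F = RingMorphisms.IsRingHomomorphism fromℤ-isRingHomomorphism

  private
    at-one-index : ∀ {P} → Eventually P → ∃ P
    at-one-index (N , p) = N , p N ℕ.≤-refl

  -- All hypotheses are strict inequalities and so hold of the rational terms at one common index,
  -- where `near-classification` applies. Its conclusion c = 0 or d = 0 concerns integers only; the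
  -- determinant then leaves a single free entry, up to a common sign.
  corner-near : ∀ {δ Y z} → z ∈ △ → 1ℝ < Y → Near δ Y z → ∃ λ k → ∃ λ e → δ ≈± corner k e
  corner-near {δ} {Y} {z} (0<x , x<½ , 1<) 1<Y near with at-one-index
    (both (both (eventually-< 0<x) (eventually-< x<½)) (both (eventually-< 1<) (both (eventually-< 1<Y) (eventually-< near))))
  ... | n , (p , q) , r , s , t = classify (QuadraticForm.near-classification p q r (SL₂.c δ) (SL₂.d δ) s t)
    where
    open SL₂ δ
    classify : c ≡ ℤ.0ℤ ⊎ d ≡ ℤ.0ℤ → ∃ λ k → ∃ λ e → δ ≈± corner k e
    classify (inj₁ c≡0) with i*j≡1⇒ a d (≡.trans
      (≡.sym (≡.trans (≡.cong (λ c → a ℤ.* d ℤ.- b ℤ.* c) c≡0) (IS.solve 3 (λ a b d → a IS.:* d IS.:- b IS.:* IS.con ℤ.0ℤ IS.:= a IS.:* d) ≡.refl a b d))) det)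
      where module IS = ℤ-RingSolver.+-*-Solver
    ... | inj₁ (a≡ , d≡) = b , false , inj₁ (mk≋ a≡ ≡.refl c≡0 d≡)
    ... | inj₂ (a≡ , d≡) = ℤ.- b , false , inj₂ (mk≋ a≡ (≡.sym (ℤ.neg-involutive b)) c≡0 d≡)
    classify (inj₂ d≡0) with i*j≡1⇒ (ℤ.- b) c (≡.trans
      (≡.sym (≡.trans (≡.cong (λ d → a ℤ.* d ℤ.- b ℤ.* c) d≡0) (IS.solve 3 (λ a b c → a IS.:* IS.con ℤ.0ℤ IS.:- b IS.:* c IS.:= IS.:- b IS.:* c) ≡.refl a b c))) det)
      where module IS = ℤ-RingSolver.+-*-Solver
    ... | inj₁ (-b≡ , c≡) = a , true , inj₁ (mk≋ ≡.refl (ℤ.neg-injective -b≡) c≡ d≡0)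
    ... | inj₂ (-b≡ , c≡) = ℤ.- a , true , inj₂ (mk≋ (≡.sym (ℤ.neg-involutive a)) (ℤ.neg-injective -b≡) c≡ d≡0)

  -- Whatever the translations, `false` puts z near the vertex ∞ of △ and `true` near the vertex 0;
  -- `near-exclusive` separates the two.
  corner-near-unique : ∀ {Y z k m e f} → 1ℝ < Y → Near (corner k e) Y z → Near (corner m f) Y z → e ≡ f
  corner-near-unique {e = false} {false} _ _ _ = ≡.refl
  corner-near-unique {e = true} {true} _ _ _ = ≡.refl
  corner-near-unique {z = z} {e = false} {true} 1<Y h h′ with at-one-index (both (eventually-< 1<Y) (both (eventually-< h) (eventually-< h′)))
  ... | n , p , q , r = ⊥-elim (QuadraticForm.near-exclusive {seq (re (point z)) n} p q r)
  corner-near-unique {z = z} {e = true} {false} 1<Y h h′ with at-one-index (both (eventually-< 1<Y) (both (eventually-< h) (eventually-< h′)))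
  ... | n , p , q , r = ⊥-elim (QuadraticForm.near-exclusive {seq (re (point z)) n} p r q)

  corner-near-translate : ∀ {Y z} k m e → Near (corner k e) Y z → Near (corner m e) Y z
  corner-near-translate k m false h = h
  corner-near-translate k m true h = h

  -- For `false`, Re v = k + x with 0 < 2x < 1. For `true`, v = k - 1/z, so |z|² Re v = k|z|² - x,
  -- and 0 < 2x < |z|² because z lies outside the circle |z - 1| = 1. The real part is doubled so
  -- that the bounds are integers.
  position-bounds : ∀ k e {z v} → z ∈ △ → corner k e · z ↦ v →
    fromℤ (position k e) < re (point v) + re (point v) ×
    re (point v) + re (point v) < fromℤ (ℤ.1ℤ ℤ.+ position k e)
  position-bounds k false {z} {v} (0<x , x<½ , _) (h , _) =
    0<y-x⁻¹ (<-respʳ (sym (begin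
      (u + u) - fromℤ (k ℤ.+ k)
        ≈⟨ +-cong (+-cong u≈ u≈) (-‿cong (F.+-homo k k)) ⟩
      ((x + fromℤ k) + (x + fromℤ k)) - (fromℤ k + fromℤ k)
        ≈⟨ solve 2 (λ k x → ((x :+ k) :+ (x :+ k)) :- (k :+ k) := x :+ x) refl (fromℤ k) x ⟩
      x + x ∎)) (0<x+y 0<x 0<x)) ,
    0<y-x⁻¹ (<-respʳ (sym (begin
      fromℤ (ℤ.1ℤ ℤ.+ (k ℤ.+ k)) - (u + u)
        ≈⟨ +-cong (trans (F.+-homo ℤ.1ℤ (k ℤ.+ k)) (+-cong ½+½ (F.+-homo k k))) (-‿cong (+-cong u≈ u≈)) ⟩
      ((fromℚ ½ + fromℚ ½) + (fromℤ k + fromℤ k)) - ((x + fromℤ k) + (x + fromℤ k))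
        ≈⟨ solve 3 (λ k x h → ((h :+ h) :+ (k :+ k)) :- ((x :+ k) :+ (x :+ k)) := (h :- x) :+ (h :- x)) refl (fromℤ k) x (fromℚ ½) ⟩
      (fromℚ ½ - x) + (fromℚ ½ - x) ∎)) (0<x+y (0<y-x x<½) (0<y-x x<½)))
    where
    open SetoidReasoning setoid
    x = re (point z) ; y = im (point z) ; u = re (point v) ; w = im (point v)
    ½+½ : fromℤ ℤ.1ℤ ≈ fromℚ ½ + fromℚ ½
    ½+½ = pointwise λ _ → ≡.refl
    u≈ : u ≈ x + fromℤ k
    u≈ = trans (solve 4 (λ x y u w → u :=
        (con ℤ.0ℤ :* x :- con ℤ.0ℤ :* y :+ con ℤ.1ℤ) :* u :- (con ℤ.0ℤ :* y :+ con ℤ.0ℤ :* x :+ con ℤ.0ℤ) :* w) refl x y u w)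
      (trans h (solve 3 (λ x y k → con ℤ.1ℤ :* x :- con ℤ.0ℤ :* y :+ k := x :+ k) refl x y (fromℤ k)))
  position-bounds k true {z} {v} (0<x , _ , 1<) (h , h′) =
    *-cancelˡ-< 0<r (0<y-x⁻¹ (<-respʳ (sym (begin
      r * (u + u) - r * fromℤ (ℤ.-1ℤ ℤ.+ (k ℤ.+ k))
        ≈⟨ +-cong ru+ru (-‿cong (*-congˡ (trans (F.+-homo ℤ.-1ℤ (k ℤ.+ k)) (+-congˡ (F.+-homo k k))))) ⟩
      ((fromℤ k * r - x) + (fromℤ k * r - x)) - r * (fromℤ ℤ.-1ℤ + (fromℤ k + fromℤ k))
        ≈⟨ solve 3 (λ x y k → let r = x :* x :+ y :* y in
             ((k :* r :- x) :+ (k :* r :- x)) :- r :* (con ℤ.-1ℤ :+ (k :+ k))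
             := (x :+ con ℤ.-1ℤ) :* (x :+ con ℤ.-1ℤ) :+ (y :+ con ℤ.0ℤ) :* (y :+ con ℤ.0ℤ) :- con ℤ.1ℤ) refl x y (fromℤ k) ⟩
      ∣ point z +ᶜ ℤ→ℂ ℤ.-1ℤ ∣² - 1ℝ ∎)) (0<y-x 1<))) ,
    *-cancelˡ-< 0<r (0<y-x⁻¹ (<-respʳ (sym (begin
      r * fromℤ (ℤ.1ℤ ℤ.+ (ℤ.-1ℤ ℤ.+ (k ℤ.+ k))) - r * (u + u)
        ≈⟨ +-cong (*-congˡ (trans (R.reflexive (≡.cong fromℤ (cancel k))) (F.+-homo k k))) (-‿cong ru+ru) ⟩
      r * (fromℤ k + fromℤ k) - ((fromℤ k * r - x) + (fromℤ k * r - x))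
        ≈⟨ solve 3 (λ x r k → r :* (k :+ k) :- ((k :* r :- x) :+ (k :* r :- x)) := x :+ x) refl x r (fromℤ k) ⟩
      x + x ∎)) (0<x+y 0<x 0<x)))
    where
    open SetoidReasoning setoid
    x = re (point z) ; y = im (point z) ; u = re (point v) ; w = im (point v)
    r = x * x + y * y
    cancel : ∀ k → ℤ.1ℤ ℤ.+ (ℤ.-1ℤ ℤ.+ (k ℤ.+ k)) ≡ k ℤ.+ k
    cancel = IS.solve 1 (λ k → IS.con ℤ.1ℤ IS.:+ (IS.con ℤ.-1ℤ IS.:+ (k IS.:+ k)) IS.:= k IS.:+ k) ≡.refl
      where module IS = ℤ-RingSolver.+-*-Solver
    0<r : 0ℝ < r
    0<r = 0<x*x+y x (0<x*y (im>0 z) (im>0 z))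
    ru : r * u ≈ fromℤ k * r - x
    ru = begin
      r * u
        ≈⟨ solve 4 (λ x y u w → let p = con ℤ.1ℤ :* x :- con ℤ.0ℤ :* y :+ con ℤ.0ℤ ; q = con ℤ.1ℤ :* y :+ con ℤ.0ℤ :* x :+ con ℤ.0ℤ in
             (x :* x :+ y :* y) :* u := x :* (p :* u :- q :* w) :+ y :* (p :* w :+ q :* u)) refl x y u w ⟩
      x * re (den′ *ᶜ point v) + y * im (den′ *ᶜ point v)
        ≈⟨ +-cong (*-congˡ h) (*-congˡ h′) ⟩
      x * re num′ + y * im num′
        ≈⟨ solve 3 (λ x y k → x :* (k :* x :- con ℤ.0ℤ :* y :+ con ℤ.-1ℤ) :+ y :* (k :* y :+ con ℤ.0ℤ :* x :+ con ℤ.0ℤ)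
             := k :* (x :* x :+ y :* y) :- x) refl x y (fromℤ k) ⟩
      fromℤ k * r - x ∎
      where
      den′ = ℤ→ℂ ℤ.1ℤ *ᶜ point z +ᶜ ℤ→ℂ ℤ.0ℤ
      num′ = ℤ→ℂ k *ᶜ point z +ᶜ ℤ→ℂ ℤ.-1ℤ
    ru+ru : r * (u + u) ≈ (fromℤ k * r - x) + (fromℤ k * r - x)
    ru+ru = trans (CommutativeRing.distribˡ ℝ-commutativeRing r u u) (+-cong ru ru)

  -- Open unit intervals with integer ends that share the point 2 Re v coincide.
  position-unique : ∀ {k e l f z z′ v} → z ∈ △ → z′ ∈ △ → corner k e · z ↦ v → corner l f · z′ ↦ v →
                    position k e ≡ position l f
  position-unique {k} {e} {l} {f} {z} {z′} {v} z∈ z′∈ h h′ =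
    let p , q = position-bounds k e {z} {v} z∈ h
        r , s = position-bounds l f {z′} {v} z′∈ h′
    in ℤ.≤-antisym (below (position k e) (position l f) (<-trans p s)) (below (position l f) (position k e) (<-trans r q))
    where
    below : ∀ i j → fromℤ i < fromℤ (ℤ.1ℤ ℤ.+ j) → i ℤ.≤ j
    below i j h = ≡.subst (i ℤ.≤_) (ℤ.pred-suc j) (ℤ.i<j⇒i≤pred[j] (fromℤ-cancel-< {i} {ℤ.1ℤ ℤ.+ j} h))

  module _ {q : ℚ} (1<q : 1ℚ ℚ.< q) where
    open ℚ-Order
    private
      module QS = ℚ-Solver.+-*-Solver
      0<1 = ℚ.positive⁻¹ 1ℚ
      0<q = ℚ.<-trans 0<1 1<q
      t = ½ ℚ.* recip q 0<q
      x = ½ ℚ.* (t ℚ.* t)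
      ¼ = ½ ℚ.* ½
      0<t = half>0 (0<recip q 0<q)
      qt≡½ : q ℚ.* t ≡ ½
      qt≡½ = ≡.trans (QS.solve 2 (λ q r → q QS.:* (QS.con ½ QS.:* r) QS.:= QS.con ½ QS.:* (q QS.:* r)) ≡.refl q (recip q 0<q))
        (≡.cong (½ ℚ.*_) (p*recip q 0<q))
      t<½ : t ℚ.< ½
      t<½ = ≡.subst₂ ℚ._<_ (ℚ.*-identityˡ t) qt≡½ (ℚ.*-monoˡ-<-pos t ⦃ ℚ.positive 0<t ⦄ 1<q)
      0<1-t² : 0ℚ ℚ.< 1ℚ ℚ.- t ℚ.* t
      0<1-t² = ≡.subst (0ℚ ℚ.<_)
        (QS.solve 1 (λ t → (QS.con ½ QS.:- t) QS.:* (QS.con ½ QS.:+ t) QS.:+ (QS.con 1ℚ QS.:- QS.con ½ QS.:* QS.con ½) QS.:= QS.con 1ℚ QS.:- t QS.:* t) ≡.refl t)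
        (0<p+q (0<p*q (0<q-p t<½) (0<p+q (ℚ.positive⁻¹ ½) 0<t)) (ℚ.positive⁻¹ _))

    -- Rational points of △ deep in each of its two ends. Near 0 the point is x + it with t =
    -- 1/(2q): the choice x = t²/2 makes |z - 1|² - 1 equal to x², which is positive, and q|z|² =
    -- t/2 + t³/8 stays below t because t < 1/2.
    sample : Bool → ℍ
    sample false = mkℍ (fromℚ ¼ +i fromℚ (1ℚ ℚ.+ q)) (fromℚ-< (0<p+q 0<1 0<q))
    sample true  = mkℍ (fromℚ x +i fromℚ t) (fromℚ-< 0<t)

    sample∈△ : ∀ e → sample e ∈ △
    sample∈△ false = fromℚ-< (ℚ.positive⁻¹ ¼) , fromℚ-< (0<q-p⁻¹ (ℚ.positive⁻¹ _)) ,
      const-< (λ _ → ≡.refl) (λ _ → ≡.refl) (0<q-p⁻¹ (≡.subst (0ℚ ℚ.<_)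
        (QS.solve 1 (λ q → (q QS.:+ q) QS.:+ (q QS.:* q QS.:+ QS.con (¾ ℚ.* ¾)) QS.:=
          QS.con (¼ ℚ.+ ℚ.- 1ℚ) QS.:* QS.con (¼ ℚ.+ ℚ.- 1ℚ) QS.:+ ((QS.con 1ℚ QS.:+ q) QS.:+ QS.con 0ℚ) QS.:* ((QS.con 1ℚ QS.:+ q) QS.:+ QS.con 0ℚ) QS.:- QS.con 1ℚ) ≡.refl q)
        (0<p+q (0<p+q 0<q 0<q) (0<p+q (0<p*q 0<q 0<q) (ℚ.positive⁻¹ (¾ ℚ.* ¾))))))
      where ¾ = 1ℚ ℚ.- ¼
    sample∈△ true = fromℚ-< 0<x , fromℚ-< x<½ ,
      const-< (λ _ → ≡.refl) (λ _ → ≡.refl) (0<q-p⁻¹ (≡.subst (0ℚ ℚ.<_)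
        (QS.solve 1 (λ t → let x = QS.con ½ QS.:* (t QS.:* t) in x QS.:* x QS.:=
          (x QS.:+ QS.con (ℚ.- 1ℚ)) QS.:* (x QS.:+ QS.con (ℚ.- 1ℚ)) QS.:+ (t QS.:+ QS.con 0ℚ) QS.:* (t QS.:+ QS.con 0ℚ) QS.:- QS.con 1ℚ) ≡.refl t)
        (0<p*q 0<x 0<x)))
      where
      0<x = half>0 (0<p*q 0<t 0<t)
      x<½ = 0<q-p⁻¹ (≡.subst (0ℚ ℚ.<_)
        (QS.solve 1 (λ t → QS.con ½ QS.:* (QS.con 1ℚ QS.:- t QS.:* t) QS.:= QS.con ½ QS.:- QS.con ½ QS.:* (t QS.:* t)) ≡.refl t)
        (half>0 0<1-t²))

    sample-near : ∀ k e → Near (corner k e) (fromℚ q) (sample e)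
    sample-near k false = const-< (λ _ → ≡.refl) (λ _ → ≡.refl) (0<q-p⁻¹ (≡.subst (0ℚ ℚ.<_)
      (QS.solve 1 (λ q → QS.con 1ℚ QS.:= (QS.con 1ℚ QS.:+ q) QS.:- q QS.:* QuadraticForm.formᴾ (QS.con 0ℚ) (QS.con 1ℚ) (QS.con ¼) (QS.con 1ℚ QS.:+ q)) ≡.refl q)
      0<1))
    sample-near k true = const-< (λ _ → ≡.refl) (λ _ → ≡.refl) (0<q-p⁻¹ (≡.subst (0ℚ ℚ.<_) (begin
        t ℚ.* ½ ℚ.* (1ℚ ℚ.- ¼ ℚ.* (t ℚ.* t))
          ≡⟨ QS.solve 2 (λ t h → t QS.:* QS.con ½ QS.:* (QS.con 1ℚ QS.:- QS.con ¼ QS.:* (t QS.:* t)) QS.:=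
                t QS.:- (QS.con ½ QS.:* t QS.:+ QS.con ½ QS.:* QS.con ¼ QS.:* (t QS.:* t QS.:* t))) ≡.refl t q ⟩
        t ℚ.- (½ ℚ.* t ℚ.+ ½ ℚ.* ¼ ℚ.* (t ℚ.* t ℚ.* t))
          -- The two halves that stand for qt are turned back into qt; what remains is a polynomial
          -- identity in t and q.
          ≡⟨ ≡.cong (λ h → t ℚ.- (h ℚ.* t ℚ.+ h ℚ.* ¼ ℚ.* (t ℚ.* t ℚ.* t))) qt≡½ ⟨
        t ℚ.- (q ℚ.* t ℚ.* t ℚ.+ q ℚ.* t ℚ.* ¼ ℚ.* (t ℚ.* t ℚ.* t))
          ≡⟨ QS.solve 2 (λ t q → t QS.:- (q QS.:* t QS.:* t QS.:+ q QS.:* t QS.:* QS.con ¼ QS.:* (t QS.:* t QS.:* t)) QS.:=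
               t QS.:- q QS.:* QuadraticForm.formᴾ (QS.con 1ℚ) (QS.con 0ℚ) (QS.con ½ QS.:* (t QS.:* t)) t) ≡.refl t q ⟩
        t ℚ.- q ℚ.* QuadraticForm.form ℤ.1ℤ ℤ.0ℤ x t ∎)
      (0<p*q (0<p*q 0<t (ℚ.positive⁻¹ ½)) (≡.subst (0ℚ ℚ.<_)
        (QS.solve 1 (λ t → (QS.con 1ℚ QS.:- t QS.:* t) QS.:+ QS.con (1ℚ ℚ.- ¼) QS.:* (t QS.:* t) QS.:= QS.con 1ℚ QS.:- QS.con ¼ QS.:* (t QS.:* t)) ≡.refl t)
        (0<p+q 0<1-t² (0<p*q (ℚ.positive⁻¹ (1ℚ ℚ.- ¼)) (0<p*q 0<t 0<t)))))))
      where open ≡.≡-Reasoning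

-- Subgroups of ℤ of finite index.

-- Here index identifies A with ℤ/P, and the conclusion is P = wℤ: residues modulo
-- a positive element n of P give an injection of Fin w into Fin n, and the
-- pigeonhole principle gives such an n ≤ w.
module FiniteIndex {p a ℓ} {w : ℕ} (A : Setoid a ℓ) (bijection : Bijection (≡.setoid (Fin w)) A)
  (P : ℤ → Set p) (P-0 : P ℤ.0ℤ) (P-+ : ∀ {i j} → P i → P j → P (i ℤ.+ j)) (P-neg : ∀ {i} → P i → P (ℤ.- i))
  (index : Setoid.Carrier A → ℤ) (index-surjective : ∀ j → ∃ λ s → index s ≡ j)
  (≈⇒P : ∀ {s t} → Setoid._≈_ A s t → P (index s ℤ.- index t))
  (P⇒≈ : ∀ {s t} → P (index s ℤ.- index t) → Setoid._≈_ A s t) where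

  open Bijection bijection using (to; injective; surjective)
  private
    module A = Setoid A

    elem : ℤ → A.Carrier
    elem j = proj₁ (index-surjective j)

    index-elem : ∀ j → index (elem j) ≡ j
    index-elem j = proj₂ (index-surjective j)

    -- The inverse of the bijection, read through `index`. Its fibres turn out to be the cosets of
    -- P, so that ℤ/P has w elements.
    class : ℤ → Fin w
    class j = proj₁ (surjective (elem j))

    to-class : ∀ j → to (class j) A.≈ elem j
    to-class j = proj₂ (surjective (elem j)) ≡.refl

    rep : Fin w → ℤ
    rep c = index (to c)

    class-rep : ∀ c → class (rep c) ≡ c
    class-rep c = injective (A.trans (to-class (rep c)) (P⇒≈
      (≡.subst P (≡.sym (≡.trans (≡.cong (ℤ._- rep c) (index-elem (rep c))) (ℤ.+-inverseʳ (rep c)))) P-0)))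

    class-P : ∀ {i j} → class i ≡ class j → P (i ℤ.- j)
    class-P {i} {j} eq = ≡.subst₂ (λ i j → P (i ℤ.- j)) (index-elem i) (index-elem j)
      (≈⇒P (A.trans (A.sym (to-class i)) (≡.subst (λ c → to c A.≈ elem j) (≡.sym eq) (to-class j))))

    P-class : ∀ {i j} → P (i ℤ.- j) → class i ≡ class j
    P-class {i} {j} h = injective (A.trans (to-class i) (A.trans
      (P⇒≈ (≡.subst₂ (λ i j → P (i ℤ.- j)) (≡.sym (index-elem i)) (≡.sym (index-elem j)) h))
      (A.sym (to-class j))))

  open ℤ-RingSolver.+-*-Solver

  private
    P-* : ∀ {i} → P i → ∀ k → P (k ℤ.* i)
    P-* {i} Pi (ℤ.+ n) = multiple n
      where
      multiple : ∀ n → P (ℤ.+ n ℤ.* i)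
      multiple ℕ.zero = P-0
      multiple (ℕ.suc n) = ≡.subst P (≡.sym (ℤ.suc-* (ℤ.+ n) i)) (P-+ Pi (multiple n))
    P-* {i} Pi ℤ.-[1+ n ] = ≡.subst P (ℤ.neg-distribˡ-* ℤ.+[1+ n ] i) (P-neg (P-* Pi ℤ.+[1+ n ]))

  ≤period : ∀ n → P ℤ.+[1+ n ] → w ℕ.≤ ℕ.suc n
  ≤period n Ph = Fin.injective⇒≤ {f = λ c → Fin.fromℕ< (ℤ.n%ℕd<d (rep c) (ℕ.suc n))} λ {c} {c′} eq →
    ≡.trans (≡.sym (class-rep c)) (≡.trans (P-class (≡.subst P (≡.sym (difference (rep c) (rep c′)
        (Fin.fromℕ<-injective _ _ (ℤ.n%ℕd<d (rep c) (ℕ.suc n)) (ℤ.n%ℕd<d (rep c′) (ℕ.suc n)) eq)))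
      (P-* Ph ((rep c ℤ./ℕ ℕ.suc n) ℤ.- (rep c′ ℤ./ℕ ℕ.suc n))))) (class-rep c′))
    where
    difference : ∀ i j → i ℤ.%ℕ ℕ.suc n ≡ j ℤ.%ℕ ℕ.suc n →
                 i ℤ.- j ≡ ((i ℤ./ℕ ℕ.suc n) ℤ.- (j ℤ./ℕ ℕ.suc n)) ℤ.* ℤ.+[1+ n ]
    difference i j eq = ≡.trans
      (≡.cong₂ ℤ._-_ (ℤ.a≡a%ℕn+[a/ℕn]*n i (ℕ.suc n)) (≡.trans (ℤ.a≡a%ℕn+[a/ℕn]*n j (ℕ.suc n))
        (≡.cong (λ r → ℤ.+ r ℤ.+ (j ℤ./ℕ ℕ.suc n) ℤ.* ℤ.+[1+ n ]) (≡.sym eq))))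
      (solve 4 (λ r q q′ d → (r :+ q :* d) :- (r :+ q′ :* d) := (q :- q′) :* d) ≡.refl
        (ℤ.+ (i ℤ.%ℕ ℕ.suc n)) (i ℤ./ℕ ℕ.suc n) (j ℤ./ℕ ℕ.suc n) ℤ.+[1+ n ])

  period : P (ℤ.+ w)
  period with Fin.pigeonhole (ℕ.n<1+n w) (λ c → class (ℤ.+ Fin.toℕ c))
  -- Since `a<b` means suc a ≤ b, the difference b - a is 1 + n, hence positive.
  ... | a , b , a<b , eq with ℕ.m≤n⇒∃[o]m+o≡n a<b
  ... | n , a+n≡b = ≡.subst (λ k → P (ℤ.+ k)) (ℕ.≤-antisym 1+n≤w (≤period n P1+n)) P1+n
    where
    P1+n : P ℤ.+[1+ n ]
    P1+n = ≡.subst P (≡.trans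
        (≡.cong (λ k → ℤ.+ k ℤ.- ℤ.+ Fin.toℕ a) (≡.trans (≡.sym a+n≡b) (≡.sym (ℕ.+-suc (Fin.toℕ a) n))))
        (solve 2 (λ a n → (a :+ n) :- a := n) ≡.refl (ℤ.+ Fin.toℕ a) ℤ.+[1+ n ]))
      (class-P (≡.sym eq))
    1+n≤w : ℕ.suc n ℕ.≤ w
    1+n≤w = ℕ.≤-trans (ℕ.s≤s (ℕ.m≤n+m n (Fin.toℕ a)))
      (≡.subst (ℕ._≤ w) (≡.sym a+n≡b) (ℕ.s≤s⁻¹ (Fin.toℕ<n b)))

  w≢0 : w ≢ 0
  w≢0 ≡.refl with () ← class ℤ.0ℤ

  multiple-of-period : ∀ i → P i → ∃ λ m → i ≡ m ℤ.* ℤ.+ w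
  multiple-of-period i Pi = i ℤ./ℕ w , remainder (i ℤ.%ℕ w) (ℤ.n%ℕd<d i w) (ℤ.a≡a%ℕn+[a/ℕn]*n i w)
    where
    instance _ = ℕ.≢-nonZero w≢0
    q = i ℤ./ℕ w
    remainder : ∀ r → r ℕ.< w → i ≡ ℤ.+ r ℤ.+ q ℤ.* ℤ.+ w → i ≡ q ℤ.* ℤ.+ w
    remainder ℕ.zero _ eq = ≡.trans eq (ℤ.+-identityˡ _)
    -- A nonzero remainder would be a positive element of P below w, against `≤period`. Only the
    -- remainder is tested, never membership in P.
    remainder (ℕ.suc r) r<w eq = ⊥-elim (ℕ.<⇒≱ r<w (≤period r (≡.subst P (≡.trans
      (≡.cong (ℤ._+ ℤ.- (q ℤ.* ℤ.+ w)) eq)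
      (solve 2 (λ r s → (r :+ s) :- s := r) ≡.refl ℤ.+[1+ r ] (q ℤ.* ℤ.+ w)))
      (P-+ Pi (P-neg (P-* period q))))))

-- The width of a cusp as twice its least period.

module Periods {p} (G : Subgroup PSL₂ℤ p) where
  open Subgroup G
  open Group PSL₂ℤ using (_∙_; _⁻¹)
  open Translations using (T)

  Period : SL₂ℤ → ℤ → Set p
  Period σ k = σ ∙ T k ∙ σ ⁻¹ ∈ member

  -- The sign of h is left open here; where periods at different cusps are compared, the equation w
  -- = 2h fixes it.
  IsLeastPeriod : SL₂ℤ → ℤ → Set p
  IsLeastPeriod σ h = h ≢ ℤ.0ℤ × Period σ h × (∀ k → Period σ k → ∃ λ m → k ≡ m ℤ.* h)

module CuspWidth {p} (G : Subgroup PSL₂ℤ p) {x : ℚ∞} {σ : SL₂ℤ}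
  (a≡ : PSL₂-Definitions.SL₂.a σ ≡ HyperbolicPlane.num x) (c≡ : PSL₂-Definitions.SL₂.c σ ≡ HyperbolicPlane.den x) where
  open HyperbolicPlane
  open Reals using (ℝ; 1ℝ; fromℚ; bounded; seq; mk<; mapE)
  open Möbius using (↦-·; ↦-adj; ↦-resp±)
  open Action
  open Translations
  open Ends
  open PSL₂-Definitions ℤ.+-*-commutativeRing using (I; mk≋; ≋-sym)
  open Subgroup G
  open Periods G
  open Group PSL₂ℤ using (_≈_; _∙_; _⁻¹; setoid; sym; trans; assoc; identityʳ; inverseʳ; ∙-congˡ; ∙-congʳ)
  open GroupProperties PSL₂ℤ
    using (∙-cancelʳ; \\-leftDividesˡ; \\-leftDividesʳ; //-rightDividesʳ; inverseˡ-unique)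

  private
    T-+ : ∀ i j → T i ∙ T j ≈ T (i ℤ.+ j)
    T-+ i j = inj₁ (T-corner i j false)

    conj-∙ : ∀ A B → (σ ∙ A ∙ σ ⁻¹) ∙ (σ ∙ B ∙ σ ⁻¹) ≈ σ ∙ (A ∙ B) ∙ σ ⁻¹
    conj-∙ A B = begin
      (σ ∙ A ∙ σ ⁻¹) ∙ (σ ∙ B ∙ σ ⁻¹)   ≈⟨ assoc (σ ∙ A) (σ ⁻¹) (σ ∙ B ∙ σ ⁻¹) ⟩
      σ ∙ A ∙ (σ ⁻¹ ∙ (σ ∙ B ∙ σ ⁻¹))   ≈⟨ ∙-congˡ {σ ∙ A} (∙-congˡ {σ ⁻¹} (assoc σ B (σ ⁻¹))) ⟩
      σ ∙ A ∙ (σ ⁻¹ ∙ (σ ∙ (B ∙ σ ⁻¹))) ≈⟨ ∙-congˡ {σ ∙ A} (\\-leftDividesʳ σ (B ∙ σ ⁻¹)) ⟩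
      σ ∙ A ∙ (B ∙ σ ⁻¹)                ≈⟨ assoc (σ ∙ A) B (σ ⁻¹) ⟨
      σ ∙ A ∙ B ∙ σ ⁻¹                  ≈⟨ ∙-congʳ {σ ⁻¹} (assoc σ A B) ⟩
      σ ∙ (A ∙ B) ∙ σ ⁻¹                ∎
      where open SetoidReasoning setoid

    conj-cong : ∀ {A B} → A ≈ B → σ ∙ A ∙ σ ⁻¹ ≈ σ ∙ B ∙ σ ⁻¹
    conj-cong e = ∙-congʳ {σ ⁻¹} (∙-congˡ {σ} e)

    conj-ε : σ ∙ T ℤ.0ℤ ∙ σ ⁻¹ ≈ I
    conj-ε = trans (conj-cong (inj₁ (mk≋ ≡.refl ≡.refl ≡.refl ≡.refl)))
      (trans (∙-congʳ {σ ⁻¹} (identityʳ σ)) (inverseʳ σ))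

    Period-+ : ∀ {i j} → Period σ i → Period σ j → Period σ (i ℤ.+ j)
    Period-+ {i} {j} h k = resp (trans (conj-∙ (T i) (T j)) (conj-cong (T-+ i j))) (∙-closed h k)

    Period-neg : ∀ {i} → Period σ i → Period σ (ℤ.- i)
    Period-neg {i} h = resp (sym (inverseˡ-unique (σ ∙ T (ℤ.- i) ∙ σ ⁻¹) (σ ∙ T i ∙ σ ⁻¹)
      (trans (conj-∙ (T (ℤ.- i)) (T i)) (trans (conj-cong (T-+ (ℤ.- i) i))
        (≡.subst (λ k → σ ∙ T k ∙ σ ⁻¹ ≈ I) (≡.sym (ℤ.+-inverseˡ i)) conj-ε))))) (⁻¹-closed h)

    -- The subgroup P of `FiniteIndex`. Positions count half-units, so a period m shifts them by 2m.
    -- The witness m is kept so that membership of w hands over its half.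
    EvenPeriod : ℤ → Set p
    EvenPeriod n = ∃ λ m → n ≡ m ℤ.+ m × Period σ m

    EvenPeriod-0 : EvenPeriod ℤ.0ℤ
    EvenPeriod-0 = ℤ.0ℤ , ≡.refl , resp (sym conj-ε) ε-closed

    EvenPeriod-+ : ∀ {i j} → EvenPeriod i → EvenPeriod j → EvenPeriod (i ℤ.+ j)
    EvenPeriod-+ (m , ≡.refl , h) (n , ≡.refl , k) = m ℤ.+ n ,
      solve 2 (λ m n → (m :+ m) :+ (n :+ n) := (m :+ n) :+ (m :+ n)) ≡.refl m n , Period-+ h k
      where open ℤ-RingSolver.+-*-Solver

    EvenPeriod-neg : ∀ {i} → EvenPeriod i → EvenPeriod (ℤ.- i)
    EvenPeriod-neg (m , ≡.refl , h) = ℤ.- m , ℤ.neg-distrib-+ m m , Period-neg h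

  module _ {Y : ℝ} (1<Y : 1ℝ Reals.< Y) where
    private
      T-between : ∀ {A B} k l e → A ≈ corner k e → B ≈ corner l e → A ≈ T (k ℤ.- l) ∙ B
      T-between {A} {B} k l e A≈ B≈ = trans A≈ (trans
        (≡.subst (λ j → corner j e ≈ T (k ℤ.- l) ∙ corner l e) (k-l+l k l) (inj₁ (≋-sym (T-corner (k ℤ.- l) l e))))
        (∙-congˡ {T (k ℤ.- l)} (sym B≈)))
        where
        k-l+l : ∀ k l → k ℤ.- l ℤ.+ l ≡ k
        k-l+l = solve 2 (λ k l → k :- l :+ l := k) ≡.refl
          where open ℤ-RingSolver.+-*-Solver

    -- Used with σ⁻¹γ, σ⁻¹γ′ and σ⁻¹gγ′ for A, B and C. The copies of A and C share the point v, so
    -- their positions agree. Both B and C bring the point w of △ high up, so they use the same end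
    -- of △ and differ by a translation, the one whose conjugate by σ is g.
    compare-ends : ∀ {A B C z w v k e l f m g} → z ∈ △ → w ∈ △ →
      A ≈ corner k e → B ≈ corner l f → C ≈ corner m g → Near B Y w → Near C Y w → A · z ↦ v → C · w ↦ v →
      position k e ℤ.- position l f ≡ (m ℤ.- l) ℤ.+ (m ℤ.- l) × C ≈ T (m ℤ.- l) ∙ B
    compare-ends {A} {B} {C} {z} {w} {v} {k} {e} {l} {f} {m} {g} z∈ w∈ A≈ B≈ C≈ nearB nearC z↦v w↦v =
      same-end (corner-near-unique {Y} {w} {l} {m} {f} {g} 1<Y
        (Near-resp± {B} {corner l f} {Y} {w} B≈ nearB) (Near-resp± {C} {corner m g} {Y} {w} C≈ nearC))
      where
      open ℤ-RingSolver.+-*-Solver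
      pos≡ : position k e ≡ position m g
      pos≡ = position-unique {k} {e} {m} {g} {z} {w} {v} z∈ w∈
        (↦-resp± {A} {corner k e} {z} {v} A≈ z↦v) (↦-resp± {C} {corner m g} {w} {v} C≈ w↦v)
      same-end : f ≡ g → _
      same-end ≡.refl =
        ≡.trans (≡.cong (ℤ._- position l f) (≡.trans pos≡ (≡.trans (≡.cong (λ m → position m f) (m≡ m l)) (position-translate (m ℤ.- l) l f))))
          (solve 2 (λ d p → d :+ p :- p := d) ≡.refl ((m ℤ.- l) ℤ.+ (m ℤ.- l)) (position l f)) ,
        T-between m l f C≈ B≈
        where
        m≡ : ∀ m l → m ≡ m ℤ.- l ℤ.+ l
        m≡ = solve 2 (λ m l → m := m :- l :+ l) ≡.refl

    private
      Sector = Setoid.Carrier (Sectors G x Y)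
      _~_ = Setoid._≈_ (Sectors G x Y)

    isCorner : (s : Sector) → ∃ λ k → ∃ λ e → σ ⁻¹ ∙ proj₁ s ≈ corner k e
    isCorner (γ , z , (z₀ , z₀∈△ , z₀↦z) , z∈hor) =
      corner-near {Y = Y} {z₀} z₀∈△ 1<Y (horoball⇒Near {x} {σ} a≡ c≡ γ {Y} {z₀} {z} z₀↦z z∈hor)

    sectorPosition : Sector → ℤ
    sectorPosition s = position (proj₁ (isCorner s)) (proj₁ (proj₂ (isCorner s)))

    -- If the pieces of γ and γ′ meet in X(G) then, for some g ∈ G, the copies of
    -- gγ′ and γ meet near x, so they have the same position there.
    ~⇒EvenPeriod : ∀ {s t} → s ~ t → EvenPeriod (sectorPosition s ℤ.- sectorPosition t)
    ~⇒EvenPeriod {s@(γ , z , (z₀ , z₀∈△ , z₀↦z) , z∈hor)} {t@(γ′ , _)} (s⊆t , _) =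
      let k , e , δ≈ = isCorner s
          l , f , δ′≈ = isCorner t
          g , g∈ , z″ , ((z₁ , z₁∈△ , z₁↦z″) , z″∈hor) , z″↦z =
            s⊆t {z} (I , ε-closed , z , ((z₀ , z₀∈△ , z₀↦z) , z∈hor) , Möbius.↦-I z)
          z₁↦z = ↦-· {g} {γ′} {z₁} {z″} {z} z₁↦z″ z″↦z
          near″ = horoball⇒Near {x} {σ} a≡ c≡ (g ∙ γ′) {Y} {z₁} {z} z₁↦z z∈hor
          m , h , δ″≈ = corner-near {σ ⁻¹ ∙ (g ∙ γ′)} {Y} {z₁} z₁∈△ 1<Y near″
          v = act (σ ⁻¹) z
          z↦v = act-↦ (σ ⁻¹) z
          difference , δ″≈Tδ′ = compare-ends
            {σ ⁻¹ ∙ γ} {σ ⁻¹ ∙ γ′} {σ ⁻¹ ∙ (g ∙ γ′)} {z₀} {z₁} {v} {k} {e} {l} {f} {m} {h}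
            z₀∈△ z₁∈△ δ≈ δ′≈ δ″≈
            (horoball⇒Near {x} {σ} a≡ c≡ γ′ {Y} {z₁} {z″} z₁↦z″ z″∈hor) near″
            (↦-· {σ ⁻¹} {γ} {z₀} {z} {v} z₀↦z z↦v) (↦-· {σ ⁻¹} {g ∙ γ′} {z₁} {z} {v} z₁↦z z↦v)
      in m ℤ.- l , difference , resp (conjugate g γ′ (T (m ℤ.- l)) δ″≈Tδ′) g∈
      where
      open SetoidReasoning setoid
      conjugate : ∀ g γ′ A → σ ⁻¹ ∙ (g ∙ γ′) ≈ A ∙ (σ ⁻¹ ∙ γ′) → g ≈ σ ∙ A ∙ σ ⁻¹
      conjugate g γ′ A eq = ∙-cancelʳ γ′ g (σ ∙ A ∙ σ ⁻¹) (begin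
        g ∙ γ′                     ≈⟨ \\-leftDividesˡ σ (g ∙ γ′) ⟨
        σ ∙ (σ ⁻¹ ∙ (g ∙ γ′))      ≈⟨ ∙-congˡ {σ} eq ⟩
        σ ∙ (A ∙ (σ ⁻¹ ∙ γ′))      ≈⟨ assoc σ A (σ ⁻¹ ∙ γ′) ⟨
        σ ∙ A ∙ (σ ⁻¹ ∙ γ′)        ≈⟨ assoc (σ ∙ A) (σ ⁻¹) γ′ ⟨
        σ ∙ A ∙ σ ⁻¹ ∙ γ′          ∎)

    -- Let g = σTᵐσ⁻¹, an element of G. As γ = gγ′ in PSL₂(ℤ), the point γz₀ is g applied to γ′z₀
    -- with the same z₀ in △, and γ′z₀ is still in the horoball because `Near` does not see the
    -- translation.
    translate-⊆ : ∀ {γ γ′ k l m e} → σ ⁻¹ ∙ γ ≈ corner k e → σ ⁻¹ ∙ γ′ ≈ corner l e → k ≡ m ℤ.+ l → Period σ m →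
                  imageInX G (piece G x Y γ) ⊆ imageInX G (piece G x Y γ′)
    translate-⊆ {γ} {γ′} {k} {l} {m} {e} δ≈ δ′≈ ≡.refl Pm {w} (h , h∈ , z , ((z₀ , z₀∈△ , z₀↦z) , z∈hor) , z↦w) =
      h ∙ g , ∙-closed h∈ Pm , z′ ,
      ((z₀ , z₀∈△ , z₀↦z′) , Near⇒horoball {x} {σ} a≡ c≡ γ′ {Y} {z₀} {z′} z₀↦z′
        (Near-resp± {corner l e} {σ ⁻¹ ∙ γ′} {Y} {z₀} (sym δ′≈) (corner-near-translate {Y} {z₀} k l e
          (Near-resp± {σ ⁻¹ ∙ γ} {corner k e} {Y} {z₀} δ≈ (horoball⇒Near {x} {σ} a≡ c≡ γ {Y} {z₀} {z} z₀↦z z∈hor))))) ,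
      ↦-· {h} {g} {z′} {z} {w}
        (↦-resp± {γ ∙ γ′ ⁻¹} {g} {z′} {z} γγ′⁻¹≈g
          (↦-· {γ} {γ′ ⁻¹} {z′} {z₀} {z} (↦-adj {γ′} {z₀} {z′} z₀↦z′) z₀↦z))
        z↦w
      where
      open SetoidReasoning setoid
      g = σ ∙ T m ∙ σ ⁻¹
      z′ = act γ′ z₀
      z₀↦z′ = act-↦ γ′ z₀
      γγ′⁻¹≈g : γ ∙ γ′ ⁻¹ ≈ g
      γγ′⁻¹≈g = begin
        γ ∙ γ′ ⁻¹                            ≈⟨ ∙-congʳ {γ′ ⁻¹} (\\-leftDividesˡ σ γ) ⟨
        σ ∙ (σ ⁻¹ ∙ γ) ∙ γ′ ⁻¹               ≈⟨ ∙-congʳ {γ′ ⁻¹} (∙-congˡ {σ} (trans δ≈ (trans (sym (inj₁ (T-corner m l e))) (∙-congˡ {T m} (sym δ′≈))))) ⟩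
        σ ∙ (T m ∙ (σ ⁻¹ ∙ γ′)) ∙ γ′ ⁻¹      ≈⟨ ∙-congʳ {γ′ ⁻¹} (assoc σ (T m) (σ ⁻¹ ∙ γ′)) ⟨
        σ ∙ T m ∙ (σ ⁻¹ ∙ γ′) ∙ γ′ ⁻¹        ≈⟨ ∙-congʳ {γ′ ⁻¹} (assoc (σ ∙ T m) (σ ⁻¹) γ′) ⟨
        σ ∙ T m ∙ σ ⁻¹ ∙ γ′ ∙ γ′ ⁻¹          ≈⟨ //-rightDividesʳ γ′ g ⟩
        g                                    ∎

    EvenPeriod⇒~ : ∀ {s t} → EvenPeriod (sectorPosition s ℤ.- sectorPosition t) → s ~ t
    EvenPeriod⇒~ {s} {t} (m , eq , Pm) = both-⊆ (position-difference k e l f m eq)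
      where
      open ℤ-RingSolver.+-*-Solver
      k = proj₁ (isCorner s) ; e = proj₁ (proj₂ (isCorner s)) ; δ≈ = proj₂ (proj₂ (isCorner s))
      l = proj₁ (isCorner t) ; f = proj₁ (proj₂ (isCorner t)) ; δ′≈ = proj₂ (proj₂ (isCorner t))
      both-⊆ : k ≡ m ℤ.+ l × e ≡ f → s ~ t
      both-⊆ (k≡ , e≡f) =
        (λ {v} → translate-⊆ {proj₁ s} {proj₁ t} {k} {l} {m} {f} (≡.subst (λ e → σ ⁻¹ ∙ proj₁ s ≈ corner k e) e≡f δ≈) δ′≈ k≡ Pm {v}) ,
        (λ {v} → translate-⊆ {proj₁ t} {proj₁ s} {l} {k} {ℤ.- m} {f} δ′≈ (≡.subst (λ e → σ ⁻¹ ∙ proj₁ s ≈ corner k e) e≡f δ≈)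
          (≡.trans (solve 2 (λ m l → l := :- m :+ (m :+ l)) ≡.refl m l) (≡.cong (λ j → ℤ.- m ℤ.+ j) (≡.sym k≡)))
          (Period-neg Pm) {v})

  module _ {q : ℚ} (1<q : 1ℚ ℚ.< q) where
    private
      1<Y : 1ℝ Reals.< fromℚ q
      1<Y = Reals.fromℚ-< 1<q

    -- `isCorner` takes its pair from the classification, so it is not (k, e) by computation. But
    -- both corners equal σ⁻¹γ and take the sample point to the same v, which determines the
    -- position.
    sectorAt : ∀ k e → ∃ λ s → sectorPosition 1<Y s ≡ position k e
    sectorAt k e = s , position-unique {k′} {e′} {k} {e} {z₀} {z₀} {v} (sample∈△ 1<q e) (sample∈△ 1<q e)
        (↦-resp± {σ ⁻¹ ∙ γ} {corner k′ e′} {z₀} {v} δ≈ (act-↦ (σ ⁻¹ ∙ γ) z₀))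
        (↦-resp± {σ ⁻¹ ∙ γ} {corner k e} {z₀} {v} δ≈corner (act-↦ (σ ⁻¹ ∙ γ) z₀))
      where
      γ = σ ∙ corner k e
      z₀ = sample 1<q e
      z = act γ z₀
      v = act (σ ⁻¹ ∙ γ) z₀
      δ≈corner : σ ⁻¹ ∙ γ ≈ corner k e
      δ≈corner = \\-leftDividesʳ σ (corner k e)
      s : Setoid.Carrier (Sectors G x (fromℚ q))
      s = γ , z , (z₀ , sample∈△ 1<q e , act-↦ γ z₀) ,
        Near⇒horoball {x} {σ} a≡ c≡ γ {fromℚ q} {z₀} {z} (act-↦ γ z₀)
          (Near-resp± {corner k e} {σ ⁻¹ ∙ γ} {fromℚ q} {z₀} (sym δ≈corner) (sample-near 1<q k e))
      k′ = proj₁ (isCorner 1<Y s) ; e′ = proj₁ (proj₂ (isCorner 1<Y s)) ; δ≈ = proj₂ (proj₂ (isCorner 1<Y s))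

    sector-surjective : ∀ j → ∃ λ s → sectorPosition 1<Y s ≡ j
    sector-surjective j =
      let k , e , eq = position-surjective j
          s , eq′ = sectorAt k e
      in s , ≡.trans eq′ eq

    module _ {w : ℕ} (bijection : Bijection (≡.setoid (Fin w)) (Sectors G x (fromℚ q))) where
      private
        module FI = FiniteIndex (Sectors G x (fromℚ q)) bijection EvenPeriod EvenPeriod-0 EvenPeriod-+ EvenPeriod-neg
          (sectorPosition 1<Y) sector-surjective
          (λ {s} {t} → ~⇒EvenPeriod 1<Y {s} {t}) (λ {s} {t} → EvenPeriod⇒~ 1<Y {s} {t})

      w-EvenPeriod : EvenPeriod (ℤ.+ w)
      w-EvenPeriod = FI.period

      w≢0 : w ≢ 0
      w≢0 = FI.w≢0

      Period⇒multiple : ∀ {k} → Period σ k → ∃ λ m → k ℤ.+ k ≡ m ℤ.* ℤ.+ w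
      Period⇒multiple {k} Pk = FI.multiple-of-period (k ℤ.+ k) (k , ≡.refl , Pk)

  half-width-period : ∀ {w h} → ℤ.+ w ≡ h ℤ.+ h → w ≢ 0 → Period σ h →
    (∀ {k} → Period σ k → ∃ λ m → k ℤ.+ k ≡ m ℤ.* ℤ.+ w) → IsLeastPeriod σ h
  half-width-period {w} {h} w≡ w≢0 Ph multiple =
    (λ h≡0 → w≢0 (ℤ.+-injective (≡.trans w≡ (≡.cong₂ ℤ._+_ h≡0 h≡0)))) , Ph ,
    λ k Pk → let m , eq = multiple Pk in
      m , i+i-injective (≡.trans eq (≡.trans (≡.cong (m ℤ.*_) w≡) (ℤ.*-distribˡ-+ m h h)))

  private
    1+bound : ∀ Y₀ → ∃ λ q → 1ℚ ℚ.< q × Y₀ Reals.< fromℚ q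
    1+bound Y₀ =
      let B , 0<B , Y₀≤B = bounded Y₀
      in 1ℚ ℚ.+ B , ≡.subst (ℚ._< 1ℚ ℚ.+ B) (ℚ.+-identityʳ 1ℚ) (ℚ.+-monoʳ-< 1ℚ 0<B) ,
         mk< ½ (ℚ.positive⁻¹ ½) (mapE (λ {n} h → ≡.subst (seq Y₀ n ℚ.+ ½ ℚ.<_) (ℚ.+-comm B 1ℚ)
           (ℚ.+-mono-≤-< (ℚ.≤-trans (ℚ-Order.p≤∣p∣ (seq Y₀ n)) h) (ℚ-Order.0<q-p⁻¹ (ℚ.positive⁻¹ (1ℚ ℚ.- ½))))) Y₀≤B)

  -- One height is enough. It has to exceed Y₀ for the bijection and 1 for the classification of
  -- ends, and it is taken rational so that the sample points are available.
  width⇒period : ∀ {w} → HasWidth G x w → ∃ λ h → ℤ.+ w ≡ h ℤ.+ h × IsLeastPeriod σ h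
  width⇒period {w} (Y₀ , bijection) = helper (1+bound Y₀)
    where
    helper : (∃ λ q → 1ℚ ℚ.< q × Y₀ Reals.< fromℚ q) → ∃ λ h → ℤ.+ w ≡ h ℤ.+ h × IsLeastPeriod σ h
    helper (q , 1<q , Y₀<q) =
      proj₁ even , proj₁ (proj₂ even) , half-width-period {w} (proj₁ (proj₂ even)) (w≢0 {q} 1<q {w} β) (proj₂ (proj₂ even))
        (λ {k} → Period⇒multiple {q} 1<q {w} β {k})
      where
      β : Bijection (≡.setoid (Fin w)) (Sectors G x (fromℚ q))
      β = bijection (fromℚ q) Y₀<q
      even : EvenPeriod (ℤ.+ w)
      even = w-EvenPeriod {q} 1<q {w} β

-- Cusps and parabolic elements of PSL₂(ℤ).

module Frames where
  open HyperbolicPlane using (ℚ∞; ∞; rat; num; den)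
  open Translations
  open PSL₂-Definitions ℤ.+-*-commutativeRing using (module SL₂; I; mk≋)
  open Group PSL₂ℤ using (_≈_; _∙_; _⁻¹; setoid; ∙-congˡ; ∙-congʳ)
  open GroupProperties PSL₂ℤ using (\\-leftDividesˡ; //-rightDividesʳ)
  open ℤ-RingSolver.+-*-Solver

  -- Such a σ takes ∞ to the cusp, and its first column carries the sign fixed by `num` and `den`,
  -- as the computation with horoballs requires.
  record Frame (σ : SL₂ℤ) : Set where
    constructor frame
    field
      cusp : ℚ∞
      a≡   : SL₂.a σ ≡ num cusp
      c≡   : SL₂.c σ ≡ den cusp

  Frame-I : Frame I
  Frame-I = frame ∞ ≡.refl ≡.refl

  Frame-S : Frame S
  Frame-S = frame (rat 0ℚ) ≡.refl ≡.refl

  private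
    bézout-ℕ : ∀ {m n} → Bézout.Identity 1 m n → ∃ λ u → ∃ λ v → ℤ.+ m ℤ.* u ℤ.- v ℤ.* ℤ.+ n ≡ ℤ.1ℤ
    bézout-ℕ {m} {n} (Bézout.+- x y eq) = ℤ.+ x , ℤ.+ y , (begin
      ℤ.+ m ℤ.* ℤ.+ x ℤ.- ℤ.+ y ℤ.* ℤ.+ n
        ≡⟨ ≡.cong₂ ℤ._-_ (≡.trans (ℤ.*-comm (ℤ.+ m) (ℤ.+ x)) (≡.sym (ℤ.pos-* x m))) (≡.sym (ℤ.pos-* y n)) ⟩
      ℤ.+ (x ℕ.* m) ℤ.- ℤ.+ (y ℕ.* n)
        ≡⟨ ≡.cong (λ k → ℤ.+ k ℤ.- ℤ.+ (y ℕ.* n)) (≡.sym eq) ⟩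
      ℤ.1ℤ ℤ.+ ℤ.+ (y ℕ.* n) ℤ.- ℤ.+ (y ℕ.* n)
        ≡⟨ solve 1 (λ k → con ℤ.1ℤ :+ k :- k := con ℤ.1ℤ) ≡.refl (ℤ.+ (y ℕ.* n)) ⟩
      ℤ.1ℤ ∎)
      where open ≡.≡-Reasoning
    bézout-ℕ {m} {n} (Bézout.-+ x y eq) = ℤ.- (ℤ.+ x) , ℤ.- (ℤ.+ y) , (begin
      ℤ.+ m ℤ.* ℤ.- (ℤ.+ x) ℤ.- ℤ.- (ℤ.+ y) ℤ.* ℤ.+ n
        ≡⟨ solve 4 (λ m n x y → m :* :- x :- :- y :* n := y :* n :- x :* m) ≡.refl (ℤ.+ m) (ℤ.+ n) (ℤ.+ x) (ℤ.+ y) ⟩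
      ℤ.+ y ℤ.* ℤ.+ n ℤ.- ℤ.+ x ℤ.* ℤ.+ m
        ≡⟨ ≡.cong₂ ℤ._-_ (≡.sym (ℤ.pos-* y n)) (≡.sym (ℤ.pos-* x m)) ⟩
      ℤ.+ (y ℕ.* n) ℤ.- ℤ.+ (x ℕ.* m)
        ≡⟨ ≡.cong (λ k → ℤ.+ k ℤ.- ℤ.+ (x ℕ.* m)) (≡.sym eq) ⟩
      ℤ.1ℤ ℤ.+ ℤ.+ (x ℕ.* m) ℤ.- ℤ.+ (x ℕ.* m)
        ≡⟨ solve 1 (λ k → con ℤ.1ℤ :+ k :- k := con ℤ.1ℤ) ≡.refl (ℤ.+ (x ℕ.* m)) ⟩
      ℤ.1ℤ ∎)
      where open ≡.≡-Reasoning

    bézout-ℤ : ∀ i n → Coprimality.Coprime ℤ.∣ i ∣ n → ∃ λ u → ∃ λ v → i ℤ.* u ℤ.- v ℤ.* ℤ.+ n ≡ ℤ.1ℤ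
    bézout-ℤ (ℤ.+ m) n coprime = bézout-ℕ (Coprimality.coprime-Bézout coprime)
    bézout-ℤ ℤ.-[1+ m ] n coprime =
      let u , v , eq = bézout-ℕ (Coprimality.coprime-Bézout coprime)
      in ℤ.- u , v , ≡.trans (solve 4 (λ i u v n → :- i :* :- u :- v :* n := i :* u :- v :* n) ≡.refl ℤ.+[1+ m ] u v (ℤ.+ n)) eq

  -- Bézout completes the reduced fraction to a matrix of determinant 1.
  frameAt : ∀ x → ∃ λ σ → SL₂.a σ ≡ num x × SL₂.c σ ≡ den x
  frameAt ∞ = I , ≡.refl , ≡.refl
  frameAt (rat (ℚ.mkℚ n d-1 coprime)) with bézout-ℤ n (ℕ.suc d-1) (Coprimality.recompute coprime)
  ... | u , v , eq = σ , ≡.refl , ≡.refl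
    where
    σ : SL₂ℤ
    σ .SL₂.a = n
    σ .SL₂.b = v
    σ .SL₂.c = ℤ.+[1+ d-1 ]
    σ .SL₂.d = u
    σ .SL₂.det = eq

  private
    fraction : ∀ i n .⦃ _ : ℕ.NonZero n ⦄ → let x = rat (i ℚ./ n) in num x ℤ.* ℤ.+ n ≡ i ℤ.* den x
    fraction i n = begin
      ℚ.↥ (i ℚ./ n) ℤ.* ℤ.+ n                       ≡⟨ ≡.cong (ℚ.↥ (i ℚ./ n) ℤ.*_) (≡.sym (ℚ.↧-/ i n)) ⟩
      ℚ.↥ (i ℚ./ n) ℤ.* (ℚ.↧ (i ℚ./ n) ℤ.* g)       ≡⟨ solve 3 (λ u v g → u :* (v :* g) := (u :* g) :* v) ≡.refl (ℚ.↥ (i ℚ./ n)) (ℚ.↧ (i ℚ./ n)) g ⟩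
      ℚ.↥ (i ℚ./ n) ℤ.* g ℤ.* ℚ.↧ (i ℚ./ n)         ≡⟨ ≡.cong (ℤ._* ℚ.↧ (i ℚ./ n)) (ℚ.↥-/ i n) ⟩
      i ℤ.* ℚ.↧ (i ℚ./ n)                           ∎
      where
      open ≡.≡-Reasoning
      g = gcd i (ℤ.+ n)

  cuspWithSlope : ∀ i j → j ≢ ℤ.0ℤ → ∃ λ x → num x ℤ.* j ≡ i ℤ.* den x
  cuspWithSlope i (ℤ.+ 0) j≢0 = ⊥-elim (j≢0 ≡.refl)
  cuspWithSlope i ℤ.+[1+ n ] _ = rat (i ℚ./ ℕ.suc n) , fraction i (ℕ.suc n)
  cuspWithSlope i ℤ.-[1+ n ] _ = x , (begin
    num x ℤ.* ℤ.-[1+ n ]              ≡⟨ solve 2 (λ u v → u :* :- v := :- (u :* v)) ≡.refl (num x) ℤ.+[1+ n ] ⟩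
    ℤ.- (num x ℤ.* ℤ.+[1+ n ])        ≡⟨ ≡.cong ℤ.-_ (fraction (ℤ.- i) (ℕ.suc n)) ⟩
    ℤ.- (ℤ.- i ℤ.* den x)             ≡⟨ solve 2 (λ u v → :- (:- u :* v) := u :* v) ≡.refl i (den x) ⟩
    i ℤ.* den x                       ∎)
    where
    open ≡.≡-Reasoning
    x = rat (ℤ.- i ℚ./ ℕ.suc n)

  -- σ⁻¹gσ fixes the vector (1, 0) itself and not merely its line, so with determinant 1 it is
  -- unipotent upper triangular. This is why the trace is normalised to +2 before cusps are sought.
  stabiliser : ∀ g σ → let open SL₂ g in
    a ℤ.* SL₂.a σ ℤ.+ b ℤ.* SL₂.c σ ≡ SL₂.a σ → c ℤ.* SL₂.a σ ℤ.+ d ℤ.* SL₂.c σ ≡ SL₂.c σ →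
    ∃ λ k → g ≈ σ ∙ T k ∙ σ ⁻¹
  stabiliser g σ top bottom = M.b , (begin
    g                          ≈⟨ //-rightDividesʳ σ g ⟨
    g ∙ σ ∙ σ ⁻¹               ≈⟨ ∙-congʳ {σ ⁻¹} (\\-leftDividesˡ σ (g ∙ σ)) ⟨
    σ ∙ (σ ⁻¹ ∙ (g ∙ σ)) ∙ σ ⁻¹ ≈⟨ ∙-congʳ {σ ⁻¹} (∙-congˡ {σ} M≈T) ⟩
    σ ∙ T M.b ∙ σ ⁻¹           ∎)
    where
    open SetoidReasoning setoid
    module σ = SL₂ σ
    module M = SL₂ (σ ⁻¹ ∙ (g ∙ σ))
    Ma≡1 : M.a ≡ ℤ.1ℤ
    Ma≡1 = ≡.trans (≡.cong₂ (λ u v → σ.d ℤ.* u ℤ.+ ℤ.- σ.b ℤ.* v) top bottom)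
      (≡.trans (solve 4 (λ a b c d → d :* a :+ :- b :* c := a :* d :- b :* c) ≡.refl σ.a σ.b σ.c σ.d) σ.det)
    Mc≡0 : M.c ≡ ℤ.0ℤ
    Mc≡0 = ≡.trans (≡.cong₂ (λ u v → ℤ.- σ.c ℤ.* u ℤ.+ σ.a ℤ.* v) top bottom)
      (solve 2 (λ a c → :- c :* a :+ a :* c := con ℤ.0ℤ) ≡.refl σ.a σ.c)
    Md≡1 : M.d ≡ ℤ.1ℤ
    Md≡1 = ≡.trans (solve 2 (λ b d → d := con ℤ.1ℤ :* d :- b :* con ℤ.0ℤ) ≡.refl M.b M.d)
      (≡.trans (≡.cong₂ (λ a c → a ℤ.* M.d ℤ.- M.b ℤ.* c) (≡.sym Ma≡1) (≡.sym Mc≡0)) M.det)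
    M≈T : σ ⁻¹ ∙ (g ∙ σ) ≈ T M.b
    M≈T = inj₁ (mk≋ Ma≡1 ≡.refl Mc≡0 Md≡1)

  -- A parabolic element fixes the slope (a - 1)/c.
  parabolic : ∀ g → SL₂.a g ℤ.+ SL₂.d g ≡ ℤ.+ 2 → ∃ λ σ → Frame σ × ∃ λ k → g ≈ σ ∙ T k ∙ σ ⁻¹
  parabolic g tr≡2 with SL₂.c g ℤ.≟ ℤ.0ℤ
  ... | yes c≡0 = I , Frame-I , stabiliser g I
      (≡.trans (solve 2 (λ a b → a :* con ℤ.1ℤ :+ b :* con ℤ.0ℤ := a) ≡.refl a b) a≡1)
      (≡.trans (solve 2 (λ c d → c :* con ℤ.1ℤ :+ d :* con ℤ.0ℤ := c) ≡.refl c d) c≡0)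
    where
    open SL₂ g
    a≡1 : a ≡ ℤ.1ℤ
    a≡1 with i*j≡1⇒ a d (≡.trans (≡.sym (≡.trans (≡.cong (λ c → a ℤ.* d ℤ.- b ℤ.* c) c≡0)
        (solve 3 (λ a b d → a :* d :- b :* con ℤ.0ℤ := a :* d) ≡.refl a b d))) det)
    ... | inj₁ (a≡1 , _) = a≡1
    ... | inj₂ (a≡ , d≡) with () ← ≡.trans (≡.sym (≡.cong₂ ℤ._+_ a≡ d≡)) tr≡2
  ... | no c≢0 with cuspWithSlope (SL₂.a g ℤ.- ℤ.1ℤ) (SL₂.c g) c≢0
  ... | x , slope with frameAt x
  ... | σ , σa≡ , σc≡ = σ , frame x σa≡ σc≡ , stabiliser g σ
      (ℤ.*-cancelˡ-≡ c _ _ ⦃ ℤ.≢-nonZero c≢0 ⦄ (begin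
        c ℤ.* (a ℤ.* u ℤ.+ b ℤ.* v)
          ≡⟨ solve 5 (λ a b c u v → c :* (a :* u :+ b :* v) := a :* (u :* c) :+ (b :* c) :* v) ≡.refl a b c u v ⟩
        a ℤ.* (u ℤ.* c) ℤ.+ b ℤ.* c ℤ.* v
          ≡⟨ ≡.cong₂ (λ i j → a ℤ.* i ℤ.+ j ℤ.* v) uc bc ⟩
        a ℤ.* ((a ℤ.- ℤ.1ℤ) ℤ.* v) ℤ.+ (a ℤ.* (ℤ.+ 2 ℤ.- a) ℤ.- ℤ.1ℤ) ℤ.* v
          ≡⟨ solve 2 (λ a v → a :* ((a :- con ℤ.1ℤ) :* v) :+ (a :* (con (ℤ.+ 2) :- a) :- con ℤ.1ℤ) :* v := (a :- con ℤ.1ℤ) :* v) ≡.refl a v ⟩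
        (a ℤ.- ℤ.1ℤ) ℤ.* v
          ≡⟨ uc ⟨
        u ℤ.* c
          ≡⟨ ℤ.*-comm u c ⟩
        c ℤ.* u ∎))
      (begin
        c ℤ.* u ℤ.+ d ℤ.* v
          ≡⟨ ≡.cong₂ (λ i j → i ℤ.+ j ℤ.* v) (≡.trans (ℤ.*-comm c u) uc) d≡ ⟩
        (a ℤ.- ℤ.1ℤ) ℤ.* v ℤ.+ (ℤ.+ 2 ℤ.- a) ℤ.* v
          ≡⟨ solve 2 (λ a v → (a :- con ℤ.1ℤ) :* v :+ (con (ℤ.+ 2) :- a) :* v := v) ≡.refl a v ⟩
        v ∎)
    where
    open ≡.≡-Reasoning
    open SL₂ g
    u = SL₂.a σ ; v = SL₂.c σ
    uc : u ℤ.* c ≡ (a ℤ.- ℤ.1ℤ) ℤ.* v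
    uc = ≡.subst₂ (λ u v → u ℤ.* c ≡ (a ℤ.- ℤ.1ℤ) ℤ.* v) (≡.sym σa≡) (≡.sym σc≡) slope
    d≡ : d ≡ ℤ.+ 2 ℤ.- a
    d≡ = ≡.trans (solve 2 (λ a d → d := (a :+ d) :- a) ≡.refl a d) (≡.cong (ℤ._- a) tr≡2)
    bc : b ℤ.* c ≡ a ℤ.* (ℤ.+ 2 ℤ.- a) ℤ.- ℤ.1ℤ
    bc = ≡.trans (solve 2 (λ ad bc → bc := ad :- (ad :- bc)) ≡.refl (a ℤ.* d) (b ℤ.* c))
      (≡.cong₂ (λ d e → a ℤ.* d ℤ.- e) d≡ det)

-- Real matrices: triangular form and integrality.

module RealMatrices where
  open Reals
  open Integers
  open Translations using (T)
  open ℝ-Solver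
  private
    module R = CommutativeRing ℝ-commutativeRing
    module F = RingMorphisms.IsRingHomomorphism fromℤ-isRingHomomorphism
    module ℤM = PSL₂-Definitions ℤ.+-*-commutativeRing
  open PSL₂-Definitions ℝ-commutativeRing using (SL₂; mk≋; _≈±_)
  open Group PSL₂ℝ using (_∙_; _⁻¹)

  1≉0 : ¬ 1ℝ ≈ 0ℝ
  1≉0 eq = 1≢0 (fromℤ-injective {ℤ.1ℤ} {ℤ.0ℤ} eq)
    where
    1≢0 : ℤ.1ℤ ≢ ℤ.0ℤ
    1≢0 ()

  -- The sign of i is unknown while `*-cancelˡ` wants a positive factor, so both sides are
  -- multiplied once more by i, and i² is cancelled.
  fromℤ*-cancelˡ : ∀ {i x y} → i ≢ ℤ.0ℤ → fromℤ i * x ≈ fromℤ i * y → x ≈ y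
  fromℤ*-cancelˡ {i} {x} {y} i≢0 eq = *-cancelˡ (fromℤ-mono-< (0<i*i i≢0)) (begin
    fromℤ (i ℤ.* i) * x        ≈⟨ scale x ⟩
    fromℤ i * (fromℤ i * x)    ≈⟨ *-congˡ eq ⟩
    fromℤ i * (fromℤ i * y)    ≈⟨ scale y ⟨
    fromℤ (i ℤ.* i) * y        ∎)
    where
    open SetoidReasoning setoid
    scale : ∀ x → fromℤ (i ℤ.* i) * x ≈ fromℤ i * (fromℤ i * x)
    scale x = trans (*-congʳ (F.*-homo i i)) (R.*-assoc (fromℤ i) (fromℤ i) x)

  x+x≈0⇒x≈0 : ∀ {x} → x + x ≈ 0ℝ → x ≈ 0ℝ
  x+x≈0⇒x≈0 {x} eq = fromℤ*-cancelˡ {ℤ.+ 2} (λ ()) (trans (solve 1 (λ x → con (ℤ.+ 2) :* x := x :+ x) refl x)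
    (trans eq (solve 0 (con ℤ.0ℤ := con (ℤ.+ 2) :* con ℤ.0ℤ) refl)))

  -- A real cannot be compared with 0, but a rational term within 1/2 of the tail can. The two
  -- alternatives overlap, which leaves room for that error.
  0<1+x⊎0<1-x : ∀ x → 0ℝ < 1ℝ + x ⊎ 0ℝ < 1ℝ - x
  0<1+x⊎0<1-x x = decide (cauchy x ½ (ℚ.positive⁻¹ ½))
    where
    open ℚ-Order
    module S = ℚ-Solver.+-*-Solver
    decide : (∃ λ N → ∀ m n → N ℕ.≤ m → N ℕ.≤ n → ∣ seq x m ℚ.- seq x n ∣ ℚ.< ½) → 0ℝ < 1ℝ + x ⊎ 0ℝ < 1ℝ - x
    decide (N , close) with ℚ.≤-total 0ℚ (seq x N)
    ... | inj₁ 0≤ = inj₁ (mk< ½ (ℚ.positive⁻¹ ½) (N , λ n N≤n → 0<q-p⁻¹ (≡.subst (0ℚ ℚ.<_)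
            (S.solve 2 (λ a b → (S.con ½ S.:- S.:- (b S.:- a)) S.:+ a S.:= (S.con 1ℚ S.:+ b) S.:- (S.con 0ℚ S.:+ S.con ½)) ≡.refl (seq x N) (seq x n))
            (0<p+≤q (0<q-p (ℚ.≤-<-trans (-p≤∣p∣ (seq x n ℚ.- seq x N)) (close n N N≤n ℕ.≤-refl))) 0≤))))
    ... | inj₂ ≤0 = inj₂ (mk< ½ (ℚ.positive⁻¹ ½) (N , λ n N≤n → 0<q-p⁻¹ (≡.subst (0ℚ ℚ.<_)
            (S.solve 2 (λ a b → (S.con ½ S.:- (b S.:- a)) S.:+ (S.con 0ℚ S.:- a) S.:= (S.con 1ℚ S.:- b) S.:- (S.con 0ℚ S.:+ S.con ½)) ≡.refl (seq x N) (seq x n))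
            (0<p+≤q (0<q-p (ℚ.≤-<-trans (p≤∣p∣ (seq x n ℚ.- seq x N)) (close n N N≤n ℕ.≤-refl))) (0≤q-p ≤0)))))

  -- The product of 1 + x and 1 - x vanishes; the factor known to be positive is cancelled, so no
  -- test for zero is needed.
  x*x≈1⇒ : ∀ {x} → x * x ≈ 1ℝ → x ≈ 1ℝ ⊎ x ≈ - 1ℝ
  x*x≈1⇒ {x} eq with 0<1+x⊎0<1-x x
  ... | inj₁ 0<1+x = inj₁ (*-cancelˡ 0<1+x (begin
      (1ℝ + x) * x      ≈⟨ solve 1 (λ x → (con ℤ.1ℤ :+ x) :* x := x :+ x :* x) refl x ⟩
      x + x * x         ≈⟨ +-congˡ eq ⟩
      x + 1ℝ            ≈⟨ solve 1 (λ x → x :+ con ℤ.1ℤ := (con ℤ.1ℤ :+ x) :* con ℤ.1ℤ) refl x ⟩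
      (1ℝ + x) * 1ℝ     ∎))
    where open SetoidReasoning setoid
  ... | inj₂ 0<1-x = inj₂ (*-cancelˡ 0<1-x (begin
      (1ℝ - x) * x      ≈⟨ solve 1 (λ x → (con ℤ.1ℤ :- x) :* x := x :- x :* x) refl x ⟩
      x - x * x         ≈⟨ +-congˡ (-‿cong eq) ⟩
      x - 1ℝ            ≈⟨ solve 1 (λ x → x :- con ℤ.1ℤ := (con ℤ.1ℤ :- x) :* :- con ℤ.1ℤ) refl x ⟩
      (1ℝ - x) * - 1ℝ   ∎))
    where open SetoidReasoning setoid

  x*x≉-1 : ∀ x → ¬ x * x ≈ fromℤ ℤ.-1ℤ
  x*x≉-1 x eq = <-irrefl {0ℝ} (sym (trans (+-congʳ {1ℝ} eq) (solve 0 (con ℤ.-1ℤ :+ con ℤ.1ℤ := con ℤ.0ℤ) refl)))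
    (0<x*x+y x (fromℤ-mono-< {ℤ.0ℤ} {ℤ.1ℤ} (ℤ.+<+ (ℕ.s≤s ℕ.z≤n))))

  Integral : ℝ → Set
  Integral x = ∃ λ i → x ≈ fromℤ i

  Integral-neg : ∀ {x} → Integral x → Integral (- x)
  Integral-neg (i , eq) = ℤ.- i , trans (-‿cong eq) (sym (F.-‿homo i))

  trace : SL₂ → ℝ
  trace A = SL₂.a A + SL₂.d A

  trace-conj-T : ∀ B h → trace (B ∙ ι (T h) ∙ B ⁻¹) ≈ fromℤ (ℤ.+ 2)
  trace-conj-T B h = begin
    trace (B ∙ ι (T h) ∙ B ⁻¹)
      ≈⟨ solve 5 (λ a b c d h →
           ((a :* con ℤ.1ℤ :+ b :* con ℤ.0ℤ) :* d :+ (a :* h :+ b :* con ℤ.1ℤ) :* :- c)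
           :+ ((c :* con ℤ.1ℤ :+ d :* con ℤ.0ℤ) :* :- b :+ (c :* h :+ d :* con ℤ.1ℤ) :* a)
           := con (ℤ.+ 2) :* (a :* d :- b :* c)) refl a b c d (fromℤ h) ⟩
    fromℤ (ℤ.+ 2) * (a * d - b * c)
      ≈⟨ *-congˡ det ⟩
    fromℤ (ℤ.+ 2) * 1ℝ
      ≈⟨ R.*-identityʳ _ ⟩
    fromℤ (ℤ.+ 2) ∎
    where
    open SetoidReasoning setoid
    open SL₂ B

  -- h p² = k p s = k once ps = 1.
  intertwiner : ∀ C {h k} → h ≢ ℤ.0ℤ → (C ∙ ι (T h)) ≈± (ι (T k) ∙ C) →
    let open SL₂ C in c ≈ 0ℝ × fromℤ h * (a * a) ≈ fromℤ k
  intertwiner C {h} {k} h≢0 (inj₁ (mk≋ _ b≈ _ d≈)) = c≈0 , (begin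
    fromℤ h * (a * a)
      ≈⟨ solve 3 (λ a b h → h :* (a :* a) := a :* ((a :* h :+ b :* con ℤ.1ℤ) :- b)) refl a b (fromℤ h) ⟩
    a * ((a * fromℤ h + b * 1ℝ) - b)
      ≈⟨ *-congˡ (+-congʳ b≈) ⟩
    a * ((1ℝ * b + fromℤ k * d) - b)
      ≈⟨ solve 4 (λ a b d k → a :* ((con ℤ.1ℤ :* b :+ k :* d) :- b) := k :* ((a :* d :- b :* con ℤ.0ℤ))) refl a b d (fromℤ k) ⟩
    fromℤ k * (a * d - b * 0ℝ)
      ≈⟨ *-congˡ (+-congˡ (-‿cong (*-congˡ c≈0))) ⟨
    fromℤ k * (a * d - b * c)
      ≈⟨ *-congˡ det ⟩
    fromℤ k * 1ℝ
      ≈⟨ R.*-identityʳ _ ⟩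
    fromℤ k ∎)
    where
    open SetoidReasoning setoid
    open SL₂ C
    c≈0 : c ≈ 0ℝ
    c≈0 = fromℤ*-cancelˡ h≢0 (begin
      fromℤ h * c
        ≈⟨ solve 3 (λ c d h → h :* c := (c :* h :+ d :* con ℤ.1ℤ) :- d) refl c d (fromℤ h) ⟩
      (c * fromℤ h + d * 1ℝ) - d
        ≈⟨ +-congʳ d≈ ⟩
      (0ℝ * b + 1ℝ * d) - d
        ≈⟨ solve 3 (λ b d h → (con ℤ.0ℤ :* b :+ con ℤ.1ℤ :* d) :- d := h :* con ℤ.0ℤ) refl b d (fromℤ h) ⟩
      fromℤ h * 0ℝ ∎)
  intertwiner C {h} {k} h≢0 (inj₂ (mk≋ a≈ _ c≈ _)) = ⊥-elim (1≉0 (begin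
    1ℝ                  ≈⟨ det ⟨
    a * d - b * c       ≈⟨ +-cong (*-congʳ a≈0) (-‿cong (*-congˡ c≈0)) ⟩
    0ℝ * d - b * 0ℝ     ≈⟨ solve 2 (λ b d → con ℤ.0ℤ :* d :- b :* con ℤ.0ℤ := con ℤ.0ℤ) refl b d ⟩
    0ℝ                  ∎))
    where
    open SetoidReasoning setoid
    open SL₂ C
    c≈0 : c ≈ 0ℝ
    c≈0 = x+x≈0⇒x≈0 (begin
      c + c
        ≈⟨ solve 2 (λ c d → c :+ c := (c :* con ℤ.1ℤ :+ d :* con ℤ.0ℤ) :+ c) refl c d ⟩
      (c * 1ℝ + d * 0ℝ) + c
        ≈⟨ +-congʳ c≈ ⟩
      - (0ℝ * a + 1ℝ * c) + c
        ≈⟨ solve 2 (λ a c → :- (con ℤ.0ℤ :* a :+ con ℤ.1ℤ :* c) :+ c := con ℤ.0ℤ) refl a c ⟩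
      0ℝ ∎)
    a≈0 : a ≈ 0ℝ
    a≈0 = x+x≈0⇒x≈0 (begin
      a + a
        ≈⟨ solve 2 (λ a b → a :+ a := (a :* con ℤ.1ℤ :+ b :* con ℤ.0ℤ) :+ a) refl a b ⟩
      (a * 1ℝ + b * 0ℝ) + a
        ≈⟨ +-congʳ a≈ ⟩
      - (1ℝ * a + fromℤ k * c) + a
        ≈⟨ +-congʳ (-‿cong (+-congˡ (*-congˡ c≈0))) ⟩
      - (1ℝ * a + fromℤ k * 0ℝ) + a
        ≈⟨ solve 2 (λ a k → :- (con ℤ.1ℤ :* a :+ k :* con ℤ.0ℤ) :+ a := con ℤ.0ℤ) refl a (fromℤ k) ⟩
      0ℝ ∎)

  -- C′C is upper triangular and equals, up to sign, an integral matrix of determinant 1, whose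
  -- diagonal entries are therefore ±1; the product of the first entries of C′ and C is the first of
  -- them, up to sign.
  triangular-integral : ∀ C C′ κ → SL₂.c C ≈ 0ℝ → SL₂.c C′ ≈ 0ℝ → (C′ ∙ C) ≈± ι κ →
    (SL₂.a C′ * SL₂.a C) * (SL₂.a C′ * SL₂.a C) ≈ 1ℝ
  triangular-integral C C′ κ c≈0 c′≈0 eq = begin
    (C′.a * C.a) * (C′.a * C.a)                   ≈⟨ solve 2 (λ x b → x :* x := (x :+ b :* con ℤ.0ℤ) :* (x :+ b :* con ℤ.0ℤ)) refl (C′.a * C.a) C′.b ⟩
    (C′.a * C.a + C′.b * 0ℝ) * (C′.a * C.a + C′.b * 0ℝ)
      ≈⟨ *-cong (+-congˡ (*-congˡ c≈0)) (+-congˡ (*-congˡ c≈0)) ⟨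
    SL₂.a (C′ ∙ C) * SL₂.a (C′ ∙ C)               ≈⟨ square eq ⟩
    fromℤ κ.a * fromℤ κ.a                         ≈⟨ F.*-homo κ.a κ.a ⟨
    fromℤ (κ.a ℤ.* κ.a)                           ≈⟨ F.⟦⟧-cong a²≡1 ⟩
    1ℝ                                            ∎
    where
    open SetoidReasoning setoid
    module C = SL₂ C
    module C′ = SL₂ C′
    module κ = ℤM.SL₂ κ
    square : (C′ ∙ C) ≈± ι κ → SL₂.a (C′ ∙ C) * SL₂.a (C′ ∙ C) ≈ fromℤ κ.a * fromℤ κ.a
    square (inj₁ (mk≋ a≈ _ _ _)) = *-cong a≈ a≈
    square (inj₂ (mk≋ a≈ _ _ _)) = trans (*-cong a≈ a≈) (solve 1 (λ a → :- a :* :- a := a :* a) refl (fromℤ κ.a))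
    product-c≈0 : SL₂.c (C′ ∙ C) ≈ 0ℝ
    product-c≈0 = trans (+-cong (*-congʳ c′≈0) (*-congˡ c≈0))
      (solve 2 (λ a d → con ℤ.0ℤ :* a :+ d :* con ℤ.0ℤ := con ℤ.0ℤ) refl C.a C′.d)
    ±c≈0 : (C′ ∙ C) ≈± ι κ → κ.c ≡ ℤ.0ℤ
    ±c≈0 (inj₁ (mk≋ _ _ c≈ _)) = fromℤ-injective (trans (sym c≈) product-c≈0)
    ±c≈0 (inj₂ (mk≋ _ _ c≈ _)) = ℤ.neg-injective (fromℤ-injective (trans (F.-‿homo κ.c) (trans (sym c≈) product-c≈0)))
    ad≡1 : κ.a ℤ.* κ.d ≡ ℤ.1ℤ
    ad≡1 = ≡.trans (≡.sym (≡.trans (≡.cong (λ c → κ.a ℤ.* κ.d ℤ.- κ.b ℤ.* c) (±c≈0 eq))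
      (IS.solve 3 (λ a b d → a IS.:* d IS.:- b IS.:* IS.con ℤ.0ℤ IS.:= a IS.:* d) ≡.refl κ.a κ.b κ.d))) κ.det
      where module IS = ℤ-RingSolver.+-*-Solver
    a²≡1 : κ.a ℤ.* κ.a ≡ ℤ.1ℤ
    a²≡1 with i*j≡1⇒ κ.a κ.d ad≡1
    ... | inj₁ (a≡ , _) = ≡.cong (λ i → i ℤ.* i) a≡
    ... | inj₂ (a≡ , _) = ≡.cong (λ i → i ℤ.* i) a≡

  -- The integers x² and y² multiply to 1, so both are 1 or both are -1, and a real square is not
  -- -1.
  integral-squares : ∀ {x y m n} → x * x ≈ fromℤ m → y * y ≈ fromℤ n → (y * x) * (y * x) ≈ 1ℝ → x ≈ 1ℝ ⊎ x ≈ - 1ℝ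
  integral-squares {x} {y} {m} {n} x² y² yx² = unit (i*j≡1⇒ n m (fromℤ-injective (begin
    fromℤ (n ℤ.* m)        ≈⟨ F.*-homo n m ⟩
    fromℤ n * fromℤ m      ≈⟨ *-cong y² x² ⟨
    (y * y) * (x * x)      ≈⟨ solve 2 (λ x y → (y :* y) :* (x :* x) := (y :* x) :* (y :* x)) refl x y ⟩
    (y * x) * (y * x)      ≈⟨ yx² ⟩
    1ℝ                     ∎)))
    where
    open SetoidReasoning setoid
    unit : (n ≡ ℤ.1ℤ × m ≡ ℤ.1ℤ) ⊎ (n ≡ ℤ.-1ℤ × m ≡ ℤ.-1ℤ) → x ≈ 1ℝ ⊎ x ≈ - 1ℝ
    unit (inj₁ (_ , m≡1)) = x*x≈1⇒ (trans x² (F.⟦⟧-cong m≡1))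
    unit (inj₂ (_ , m≡-1)) = ⊥-elim (x*x≉-1 x (trans x² (F.⟦⟧-cong m≡-1)))

  integral-column : ∀ {M} σ C → M ≈± (ι σ ∙ C) → SL₂.c C ≈ 0ℝ → SL₂.a C ≈ 1ℝ ⊎ SL₂.a C ≈ - 1ℝ →
    Integral (SL₂.a M) × Integral (SL₂.c M)
  integral-column {M} σ C eq c≈0 a≈± = signed eq (column a≈±)
    where
    module σ = ℤM.SL₂ σ
    Column = λ M → Integral (SL₂.a M) × Integral (SL₂.c M)
    entry : ∀ i j {e} → SL₂.a C ≈ e → fromℤ i * SL₂.a C + fromℤ j * SL₂.c C ≈ e * fromℤ i
    entry i j {e} a≈ = trans (+-cong (*-congˡ a≈) (*-congˡ c≈0))
      (solve 3 (λ i j e → i :* e :+ j :* con ℤ.0ℤ := e :* i) refl (fromℤ i) (fromℤ j) e)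
    column : SL₂.a C ≈ 1ℝ ⊎ SL₂.a C ≈ - 1ℝ → Column (ι σ ∙ C)
    column (inj₁ a≈1) = (σ.a , trans (entry σ.a σ.b a≈1) (R.*-identityˡ _)) , (σ.c , trans (entry σ.c σ.d a≈1) (R.*-identityˡ _))
    column (inj₂ a≈-1) = (ℤ.- σ.a , negative σ.a σ.b) , (ℤ.- σ.c , negative σ.c σ.d)
      where
      negative : ∀ i j → fromℤ i * SL₂.a C + fromℤ j * SL₂.c C ≈ fromℤ (ℤ.- i)
      negative i j = trans (entry i j a≈-1)
        (trans (solve 1 (λ i → :- con ℤ.1ℤ :* i := :- i) refl (fromℤ i)) (sym (F.-‿homo i)))
    signed : M ≈± (ι σ ∙ C) → Column (ι σ ∙ C) → Column M
    signed (inj₁ (mk≋ a≈ _ c≈ _)) ((i , ai) , (j , cj)) = (i , trans a≈ ai) , (j , trans c≈ cj)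
    signed (inj₂ (mk≋ a≈ _ c≈ _)) ((i , ai) , (j , cj)) =
      (ℤ.- i , trans a≈ (proj₂ (Integral-neg (i , ai)))) , (ℤ.- j , trans c≈ (proj₂ (Integral-neg (j , cj))))

  integral-matrix : ∀ M → let open SL₂ M in Integral a × Integral c → Integral b × Integral d → ∃ λ n → ι n ≈± M
  integral-matrix M ((α , a≈) , (γ , c≈)) ((β , b≈) , (δ , d≈)) = n , inj₁ (mk≋ (sym a≈) (sym b≈) (sym c≈) (sym d≈))
    where
    open SetoidReasoning setoid
    n : SL₂ℤ
    n .ℤM.SL₂.a = α
    n .ℤM.SL₂.b = β
    n .ℤM.SL₂.c = γ
    n .ℤM.SL₂.d = δ
    n .ℤM.SL₂.det = fromℤ-injective (begin
      fromℤ (α ℤ.* δ ℤ.- β ℤ.* γ)                     ≈⟨ F.+-homo (α ℤ.* δ) (ℤ.- (β ℤ.* γ)) ⟩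
      fromℤ (α ℤ.* δ) + fromℤ (ℤ.- (β ℤ.* γ))         ≈⟨ +-cong (F.*-homo α δ) (trans (F.-‿homo (β ℤ.* γ)) (-‿cong (F.*-homo β γ))) ⟩
      fromℤ α * fromℤ δ - fromℤ β * fromℤ γ           ≈⟨ +-cong (*-cong a≈ d≈) (-‿cong (*-cong b≈ c≈)) ⟨
      SL₂.a M * SL₂.d M - SL₂.b M * SL₂.c M           ≈⟨ SL₂.det M ⟩
      1ℝ                                              ∎)

  ι-injective : ∀ {A B} → ι A ≈± ι B → A ℤM.≈± B
  ι-injective (inj₁ (mk≋ a b c d)) = inj₁ (ℤM.mk≋ (fromℤ-injective a) (fromℤ-injective b) (fromℤ-injective c) (fromℤ-injective d))
  ι-injective {B = B} (inj₂ (mk≋ a b c d)) = inj₂ (ℤM.mk≋ (signed a) (signed b) (signed c) (signed d))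
    where
    signed : ∀ {i j} → fromℤ i ≈ - fromℤ j → i ≡ ℤ.- j
    signed {i} {j} eq = fromℤ-injective (trans eq (sym (F.-‿homo j)))

module Conjugation {h ℓ} (H : Group h ℓ) where
  open Group H
  open GroupProperties H
  open SetoidReasoning setoid

  conj-conj : ∀ m n g → m ∙ (n ∙ g ∙ n ⁻¹) ∙ m ⁻¹ ≈ (m ∙ n) ∙ g ∙ (m ∙ n) ⁻¹
  conj-conj m n g = begin
    m ∙ (n ∙ g ∙ n ⁻¹) ∙ m ⁻¹       ≈⟨ ∙-congʳ (assoc _ _ _) ⟨
    (m ∙ (n ∙ g)) ∙ n ⁻¹ ∙ m ⁻¹     ≈⟨ assoc _ _ _ ⟩
    (m ∙ (n ∙ g)) ∙ (n ⁻¹ ∙ m ⁻¹)   ≈⟨ ∙-cong (sym (assoc _ _ _)) (sym (⁻¹-anti-homo-∙ m n)) ⟩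
    (m ∙ n) ∙ g ∙ (m ∙ n) ⁻¹        ∎

  conj⇒intertwine : ∀ {g b s x y} → g ≈ b ∙ x ∙ b ⁻¹ → g ≈ s ∙ y ∙ s ⁻¹ → (s ⁻¹ ∙ b) ∙ x ≈ y ∙ (s ⁻¹ ∙ b)
  conj⇒intertwine {g} {b} {s} {x} {y} g≈bx g≈sy = begin
    s ⁻¹ ∙ b ∙ x                    ≈⟨ assoc _ _ _ ⟩
    s ⁻¹ ∙ (b ∙ x)                  ≈⟨ ∙-congˡ (//-rightDividesˡ b (b ∙ x)) ⟨
    s ⁻¹ ∙ (b ∙ x ∙ b ⁻¹ ∙ b)       ≈⟨ ∙-congˡ (∙-congʳ (trans (sym g≈bx) g≈sy)) ⟩
    s ⁻¹ ∙ (s ∙ y ∙ s ⁻¹ ∙ b)       ≈⟨ ∙-congˡ (trans (assoc _ _ _) (assoc _ _ _)) ⟩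
    s ⁻¹ ∙ (s ∙ (y ∙ (s ⁻¹ ∙ b)))   ≈⟨ \\-leftDividesʳ s _ ⟩
    y ∙ (s ⁻¹ ∙ b)                  ∎

  -- Going from t to s by n and on to s′ by n⁻¹ cancels n, which leaves c′c expressed through s′ and
  -- t alone; in the application these are integral although n is not known to be.
  return : ∀ {n s s′ t c c′} → n ∙ t ≈ s ∙ c → n ⁻¹ ∙ s ≈ s′ ∙ c′ → c′ ∙ c ≈ s′ ⁻¹ ∙ t
  return {n} {s} {s′} {t} {c} {c′} p q = begin
    c′ ∙ c                          ≈⟨ \\-leftDividesʳ s′ _ ⟨
    s′ ⁻¹ ∙ (s′ ∙ (c′ ∙ c))         ≈⟨ ∙-congˡ (assoc _ _ _) ⟨
    s′ ⁻¹ ∙ (s′ ∙ c′ ∙ c)           ≈⟨ ∙-congˡ (∙-congʳ q) ⟨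
    s′ ⁻¹ ∙ (n ⁻¹ ∙ s ∙ c)          ≈⟨ ∙-congˡ (assoc _ _ _) ⟩
    s′ ⁻¹ ∙ (n ⁻¹ ∙ (s ∙ c))        ≈⟨ ∙-congˡ (∙-congˡ p) ⟨
    s′ ⁻¹ ∙ (n ⁻¹ ∙ (n ∙ t))        ≈⟨ ∙-congˡ (\\-leftDividesʳ n t) ⟩
    s′ ⁻¹ ∙ t                       ∎

  ≈⇒quotient∈ : ∀ {p} (G : Subgroup H p) {x y} → x ≈ y → x ⁻¹ ∙ y ∈ Subgroup.member G
  ≈⇒quotient∈ G {x} x≈y = Subgroup.resp G (trans (sym (inverseˡ x)) (∙-congˡ x≈y)) (Subgroup.ε-closed G)

private
  module Γ = Group PSL₂ℤ
  module K = Group PSL₂ℝ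
  module ι = GroupMorphisms.IsGroupHomomorphism ι-isGroupHomomorphism

-- Integrality of the real normaliser.

module NormaliserIntegral {p} (G : Subgroup PSL₂ℤ p) {w : ℕ} (widths : ∀ x → HasWidth G x w) where
  open Reals using (fromℤ; _*_; _≈_; 0ℝ; 1ℝ; trans; sym)
  open Integers using (fromℤ-injective)
  open Translations
  open Frames
  open RealMatrices
  open Subgroup G
  open Periods G
  private
    module ℤM = PSL₂-Definitions ℤ.+-*-commutativeRing
    module ℝM = PSL₂-Definitions ℝ-commutativeRing
    module F = RingMorphisms.IsRingHomomorphism fromℤ-isRingHomomorphism
    module Gℝ = Subgroup (inPSL₂ℝ G)
    Normalises-Gℝ = Normalises (inPSL₂ℝ G)
    open ℝM using (mk≋)

  leastPeriod : ∀ {σ} → Frame σ → ∃ λ h → ℤ.+ w ≡ h ℤ.+ h × IsLeastPeriod σ h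
  leastPeriod {σ} (frame x a≡ c≡) = CuspWidth.width⇒period G {x} {σ} a≡ c≡ {w} (widths x)

  h : ℤ
  h = proj₁ (leastPeriod Frame-I)

  -- Half of w is unique, so the period found at each cusp agrees with the one at ∞, signs included.
  h-least : ∀ {σ} → Frame σ → IsLeastPeriod σ h
  h-least {σ} F = least (leastPeriod F)
    where
    least : (∃ λ h′ → ℤ.+ w ≡ h′ ℤ.+ h′ × IsLeastPeriod σ h′) → IsLeastPeriod σ h
    least (h′ , w≡ , L) = ≡.subst (IsLeastPeriod σ)
      (i+i-injective {h′} {h} (≡.trans (≡.sym w≡) (proj₁ (proj₂ (leastPeriod Frame-I))))) L

  traceℤ : SL₂ℤ → ℤ
  traceℤ g = ℤM.SL₂.a g ℤ.+ ℤM.SL₂.d g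

  -- Equality in PSL₂(ℝ) determines the trace of g only up to sign, and `parabolic` wants +2, so g
  -- or its negative is taken.
  trace-2 : ∀ g {A} → ι g K.≈ A → trace A ≈ fromℤ (ℤ.+ 2) → ∃ λ g′ → g Γ.≈ g′ × traceℤ g′ ≡ ℤ.+ 2
  trace-2 g {A} (inj₁ (mk≋ a≈ _ _ d≈)) tr = g , Γ.refl , fromℤ-injective
    (trans (F.+-homo (ℤM.SL₂.a g) (ℤM.SL₂.d g)) (trans (Reals.+-cong a≈ d≈) tr))
  trace-2 g {A} (inj₂ (mk≋ a≈ _ _ d≈)) tr = ℤM.neg g , inj₂ (ℤM.≋-sym (ℤM.neg-neg g)) , fromℤ-injective
    (trans (F.+-homo (ℤ.- ℤM.SL₂.a g) (ℤ.- ℤM.SL₂.d g)) (trans (Reals.+-cong (negate (ℤM.SL₂.a g) a≈) (negate (ℤM.SL₂.d g) d≈)) tr))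
    where
    negate : ∀ i {x} → fromℤ i ≈ Reals.- x → fromℤ (ℤ.- i) ≈ x
    negate i {x} eq = trans (F.-‿homo i) (trans (Reals.-‿cong eq) (ℝ-Solver.solve 1 (λ x → ℝ-Solver.:- (ℝ-Solver.:- x) ℝ-Solver.:= x) Reals.refl x))

  -- C is σ⁻¹Nτ and m is the quotient k/h. Because σ is again a frame, the construction can be
  -- repeated from σ with N⁻¹.
  record Transported (N : K.Carrier) (τ : SL₂ℤ) : Set where
    field
      σ       : SL₂ℤ
      σ-frame : Frame σ
      C       : K.Carrier
      Nτ≈σC   : N K.∙ ι τ K.≈ ι σ K.∙ C
      c≈0     : ℝM.SL₂.c C ≈ 0ℝ
      m       : ℤ
      a²≈m    : ℝM.SL₂.a C * ℝM.SL₂.a C ≈ fromℤ m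

  -- N takes the generator τThτ⁻¹ of a cusp stabiliser in G into some σTᵏσ⁻¹ in
  -- G, and there h ∣ k because the cusp of σ has the same width.
  transport : ∀ {N τ} → Normalises-Gℝ N → Frame τ → Transported N τ
  transport {N} {τ} N∈ τ-frame = fromImage (Equivalence.to (N∈ (ι t)) (t , proj₁ (proj₂ (h-least τ-frame)) , K.refl))
    where
    t = τ Γ.∙ T h Γ.∙ τ Γ.⁻¹
    B = N K.∙ ι τ
    conjugate : N K.∙ ι t K.∙ N K.⁻¹ K.≈ B K.∙ ι (T h) K.∙ B K.⁻¹
    conjugate = K.trans
      (K.∙-congʳ {N K.⁻¹} (K.∙-congˡ {N} (K.trans (ι.homo (τ Γ.∙ T h) (τ Γ.⁻¹)) (K.∙-cong (ι.homo τ (T h)) (ι.⁻¹-homo τ)))))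
      (Conjugation.conj-conj PSL₂ℝ N (ι τ) (ι (T h)))

    fromParabolic : ∀ {g g′} → g ∈ member → g Γ.≈ g′ → ι g K.≈ B K.∙ ι (T h) K.∙ B K.⁻¹ →
      (∃ λ σ → Frame σ × ∃ λ k → g′ Γ.≈ σ Γ.∙ T k Γ.∙ σ Γ.⁻¹) → Transported N τ
    fromParabolic {g} {g′} g∈ g≈g′ ιg≈ (σ , σ-frame , k , g′≈) = record
      { σ = σ ; σ-frame = σ-frame ; C = C
      ; Nτ≈σC = K.sym (GroupProperties.\\-leftDividesˡ PSL₂ℝ (ι σ) B)
      ; c≈0 = proj₁ entries
      ; m = proj₁ h∣k
      ; a²≈m = fromℤ*-cancelˡ {h} (proj₁ (h-least σ-frame)) (trans (proj₂ entries)
          (trans (F.⟦⟧-cong (≡.trans (proj₂ h∣k) (ℤ.*-comm (proj₁ h∣k) h))) (F.*-homo h (proj₁ h∣k))))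
      }
      where
      C = ι σ K.⁻¹ K.∙ B
      g≈ : g Γ.≈ σ Γ.∙ T k Γ.∙ σ Γ.⁻¹
      g≈ = Γ.trans g≈g′ g′≈
      ιg≈′ : ι g K.≈ ι σ K.∙ ι (T k) K.∙ ι σ K.⁻¹
      ιg≈′ = K.trans (ι.⟦⟧-cong g≈) (K.trans (ι.homo (σ Γ.∙ T k) (σ Γ.⁻¹)) (K.∙-cong (ι.homo σ (T k)) (ι.⁻¹-homo σ)))
      h∣k = proj₂ (proj₂ (h-least σ-frame)) k (resp g≈ g∈)
      entries = intertwiner C {h} {k} (proj₁ (h-least σ-frame))
        (Conjugation.conj⇒intertwine PSL₂ℝ {ι g} {B} {ι σ} {ι (T h)} {ι (T k)} ιg≈ ιg≈′)

    fromImage : (∃ λ g → g ∈ member × ι g K.≈ N K.∙ ι t K.∙ N K.⁻¹) → Transported N τ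
    fromImage (g , g∈ , ιg≈) =
      let ιg≈B = K.trans ιg≈ conjugate
          g′ , g≈g′ , tr≡2 = trace-2 g {B K.∙ ι (T h) K.∙ B K.⁻¹} ιg≈B (trace-conj-T B h)
      in fromParabolic {g} {g′} g∈ g≈g′ ιg≈B (parabolic g′ tr≡2)

  -- The transport by N⁻¹ starts at the frame σ reached by N. The frame σ′ where it ends is not
  -- known to be τ, but σ′⁻¹τ is integral, which is what `triangular-integral` asks for.
  column : ∀ {N τ} → Normalises-Gℝ N → Frame τ → Integral (ℝM.SL₂.a (N K.∙ ι τ)) × Integral (ℝM.SL₂.c (N K.∙ ι τ))
  column {N} {τ} N∈ τ-frame = integral-column {N K.∙ ι τ} A.σ A.C A.Nτ≈σC A.c≈0
    (integral-squares {ℝM.SL₂.a A.C} {ℝM.SL₂.a A′.C} {A.m} {A′.m} A.a²≈m A′.a²≈m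
      (triangular-integral A.C A′.C (A′.σ Γ.⁻¹ Γ.∙ τ) A.c≈0 A′.c≈0
        (K.trans (Conjugation.return PSL₂ℝ {N} {ι A.σ} {ι A′.σ} {ι τ} {A.C} {A′.C} A.Nτ≈σC A′.Nτ≈σC)
          (K.sym (K.trans (ι.homo (A′.σ Γ.⁻¹) τ) (K.∙-congʳ {ι τ} (ι.⁻¹-homo A′.σ)))))))
    where
    module A = Transported (transport {N} {τ} N∈ τ-frame)
    module A′ = Transported (transport {N K.⁻¹} {A.σ} (Subgroup.⁻¹-closed (normaliser (inPSL₂ℝ G)) {N} N∈) A.σ-frame)

  integral : ∀ {N} → Normalises-Gℝ N → ∃ λ n → ι n K.≈ N
  integral {N} N∈ = integral-matrix N
    (replace (first a b) (proj₁ columnI) , replace (first c d) (proj₂ columnI))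
    (replace (second a b) (proj₁ columnS) , replace (second c d) (proj₂ columnS))
    where
    open ℝM.SL₂ N
    open ℝ-Solver
    columnI = column {N} {ℤM.I} N∈ Frame-I
    columnS = column {N} {S} N∈ Frame-S
    replace : ∀ {x y} → x ≈ y → Integral x → Integral y
    replace x≈y (i , x≈i) = i , trans (sym x≈y) x≈i
    first : ∀ x y → x * 1ℝ Reals.+ y * 0ℝ ≈ x
    first = solve 2 (λ x y → x :* con ℤ.1ℤ :+ y :* con ℤ.0ℤ := x) Reals.refl
    second : ∀ x y → x * 0ℝ Reals.+ y * 1ℝ ≈ y
    second = solve 2 (λ x y → x :* con ℤ.0ℤ :+ y :* con ℤ.1ℤ := y) Reals.refl

-- From PSL₂(ℝ) back to PSL₂(ℤ).

module Descent {p} (G : Subgroup PSL₂ℤ p) where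
  open Subgroup G
  open RealMatrices using (ι-injective)
  private
    module Gℝ = Subgroup (inPSL₂ℝ G)

  -- Membership in the image supplies some preimage in G; injectivity of ι on PSL₂(ℤ) identifies it
  -- with g.
  ι∈⇒∈ : ∀ {g} → ι g ∈ Gℝ.member → g ∈ member
  ι∈⇒∈ {g} (g′ , g′∈ , eq) = resp (ι-injective {g′} {g} eq) g′∈

  ∈⇒ι∈ : ∀ {g} → g ∈ member → ι g ∈ Gℝ.member
  ∈⇒ι∈ {g} g∈ = g , g∈ , K.refl

  ι-conj : ∀ {n N} → ι n K.≈ N → ∀ g → ι (n Γ.∙ g Γ.∙ n Γ.⁻¹) K.≈ N K.∙ ι g K.∙ N K.⁻¹
  ι-conj {n} {N} eq g = K.trans (ι.homo (n Γ.∙ g) (n Γ.⁻¹))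
    (K.∙-cong (K.trans (ι.homo n g) (K.∙-congʳ {ι g} eq)) (K.trans (ι.⁻¹-homo n) (K.⁻¹-cong eq)))

  ι-quotient : ∀ x y → ι (x Γ.⁻¹ Γ.∙ y) K.≈ ι x K.⁻¹ K.∙ ι y
  ι-quotient x y = K.trans (ι.homo (x Γ.⁻¹) y) (K.∙-congʳ {ι y} (ι.⁻¹-homo x))

  normalises : ∀ {n N} → ι n K.≈ N → Normalises (inPSL₂ℝ G) N → Normalises G n
  normalises {n} {N} eq N∈ g = mk⇔
    (λ g∈ → ι∈⇒∈ (Gℝ.resp (K.sym (ι-conj {n} {N} eq g)) (Equivalence.to (N∈ (ι g)) (∈⇒ι∈ g∈))))
    (λ g∈ → ι∈⇒∈ (Equivalence.from (N∈ (ι g)) (Gℝ.resp (ι-conj {n} {N} eq g) (∈⇒ι∈ g∈))))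

proposition4p4 : ∀ {p : Level} (G : Subgroup PSL₂ℤ p) (w : ℕ) →
    (∀ (x : ℚ∞) → HasWidth G x w) →
    GroupMorphisms.IsGroupIsomorphism
    (Group.rawGroup (Normaliser/ G))
    (Group.rawGroup (Normaliser/ (inPSL₂ℝ G)))
    (inclusion/ G)
proposition4p4 G w widths = record
  { isGroupMonomorphism = record
    { isGroupHomomorphism = record
      { isMonoidHomomorphism = record
        { isMagmaHomomorphism = record
          { isRelHomomorphism = record
            { cong = λ { {x , _} {y , _} x~y → Gℝ.resp (ι-quotient x y) (∈⇒ι∈ x~y) } }
          ; homo = λ { (x , _) (y , _) → ≈⇒quotient∈ (inPSL₂ℝ G) (ι.homo x y) }
          }
        ; ε-homo = ≈⇒quotient∈ (inPSL₂ℝ G) ι.ε-homo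
        }
      ; ⁻¹-homo = λ { (x , _) → ≈⇒quotient∈ (inPSL₂ℝ G) (ι.⁻¹-homo x) }
      }
    ; injective = λ { {x , _} {y , _} fx~fy → ι∈⇒∈ (Gℝ.resp (K.sym (ι-quotient x y)) fx~fy) }
    }
  ; surjective = λ { (N , N∈) →
      let n , ιn≈N = NormaliserIntegral.integral G {w} widths {N} N∈
      in (n , normalises {n} {N} ιn≈N N∈) ,
         λ { {z , _} z~n → Gℝ.resp (K.trans (ι-quotient z n) (K.∙-congˡ {ι z K.⁻¹} ιn≈N)) (∈⇒ι∈ z~n) } }
  }
  where
  open Descent G
  open Conjugation PSL₂ℝ using (≈⇒quotient∈)
  module Gℝ = Subgroup (inPSL₂ℝ G)
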